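{- Let $\mathcal M(C^n)$ be an oriented cube over $C^n=\{ -1,1\}^n$ whose underlying matroid $\underline{\mathcal M}(C^n)$ is realizable over $\mathbb{R}$. Then $\underline{\mathcal M}(C^n)\simeq\underline{\mathbf{Q}_n}$ (isomorphism of matroids).
   Context: Signed sets are written $X=(X^+,X^-)$; $\underline{\mathcal M}$ denotes the underlying (unoriented) matroid of an oriented matroid $\mathcal M$. $C^n=\{ -1,1\}^n$; for $B\subseteq[n]$ and $v\in C^n$, ${}_{ -B}v$ is obtained from $v$ by changing the sign of the coordinates indexed by $B$. The real cube is $\mathbf{Q}_n=\mathrm{Aff}(C^n)$, the oriented matroid of affine dependencies of $C^n$ over $\mathbb{R}$. The signed rectangles are the signed sets $(\{v,{}_{ -(A\cup B)}v\},\{{}_{ -A}v,{}_{ -B}v\})$ with $v\in C^n$ and $A,B\subseteq[n]$ disjoint and nonempty. The facets are $H_{i+}=\{v\in C^n:v(i)=1\}$, $H_{i- }=\{v\in C^n:v(i)=-1\}$; the skew-facets are $H_{ij+}=\{v\in C^n:v(i)=v(j)\}$, $H_{ij- }=\{v\in C^n:v(i)=-v(j)\}$ ($i\ne j$). An oriented cube over $C^n$ is an oriented matroid on the ground set $C^n$ such that all signed rectangles are signed circuits and all signed cocircuits of $\mathbf{Q}_n$ complementary to facets and skew-facets are signed cocircuits. -}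

module Defs where

open import Level using (0ℓ)
open import Algebra.Bundles using (CommutativeRing)
import Algebra.Consequences.Setoid as Consequences
import Algebra.Properties.CommutativeMonoid.Sum as Sum
open import Data.Bool.Base using (Bool; T; _∨_; if_then_else_)
open import Data.Nat.Base as ℕ using (ℕ; zero; suc; _^_)
import Data.Nat.Properties as ℕ
open import Data.Fin.Base using (Fin; zero)
import Data.Fin.Properties as Fin
open import Data.Fin.Subset as Subset using (Subset)
open import Data.Product using (∃; _×_; _,_; proj₁; proj₂; swap)
open import Data.Product.Function.NonDependent.Propositional using (_×-↔_)
open import Data.Rational as ℚ using (ℚ; 0ℚ; 1ℚ; ½; Positive)
import Data.Rational.Properties as ℚ
open import Data.Rational.Solver using (module +-*-Solver)
open import Data.Sign.Base as Sign using (Sign; opposite)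
open import Data.Sum using (_⊎_)
open import Data.Vec.Base using (Vec; []; _∷_; lookup; zipWith)
open import Function using (_∘_; _↔_; _⇔_; mk↔ₛ′; Inverse)
open import Function.Construct.Composition using (_↔-∘_)
open import Relation.Binary.Bundles using (Setoid)
open import Relation.Binary.Structures using (IsEquivalence)
open import Relation.Binary.PropositionalEquality
  using (_≡_; _≢_; refl; sym; trans; cong; cong₂; subst)
open import Relation.Nullary using (¬_)
open import Relation.Unary using (Pred)

------------------------------------------------------------------------
-- Double-indexed sequences of rationals tending to zero

Small : (ℕ → ℕ → ℚ) → Set
Small d = ∀ ε → 0ℚ ℚ.< ε →
          ∃ λ N → ∀ m n → N ℕ.≤ m → N ℕ.≤ n → ℚ.∣ d m n ∣ ℚ.< ε

Bounded : (ℕ → ℕ → ℚ) → Set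
Bounded a = ∃ λ B → Positive B ×
            ∃ λ N → ∀ m n → N ℕ.≤ m → N ℕ.≤ n → ℚ.∣ a m n ∣ ℚ.≤ B

small-≗ : ∀ {d e} → (∀ m n → d m n ≡ e m n) → Small d → Small e
small-≗ d≗e sd ε ε>0 with sd ε ε>0
... | N , p = N , λ m n N≤m N≤n →
      subst (λ q → ℚ.∣ q ∣ ℚ.< ε) (d≗e m n) (p m n N≤m N≤n)

small-0 : Small (λ _ _ → 0ℚ)
small-0 ε ε>0 = 0 , λ _ _ _ _ → ε>0

small-neg : ∀ {d} → Small d → Small (λ m n → ℚ.- d m n)
small-neg {d} sd ε ε>0 with sd ε ε>0
... | N , p = N , λ m n N≤m N≤n →
      subst (ℚ._< ε) (sym (ℚ.∣-p∣≡∣p∣ (d m n))) (p m n N≤m N≤n)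

halves : ∀ ε → ½ ℚ.* ε ℚ.+ ½ ℚ.* ε ≡ ε
halves ε = trans (sym (ℚ.*-distribʳ-+ ε ½ ½)) (ℚ.*-identityˡ ε)

half>0 : ∀ {ε} → 0ℚ ℚ.< ε → 0ℚ ℚ.< ½ ℚ.* ε
half>0 {ε} ε>0 = subst (ℚ._< ½ ℚ.* ε) (ℚ.*-zeroʳ ½) (ℚ.*-monoʳ-<-pos ½ ε>0)

small-+ : ∀ {d e} → Small d → Small e → Small (λ m n → d m n ℚ.+ e m n)
small-+ {d} {e} sd se ε ε>0 with sd (½ ℚ.* ε) (half>0 ε>0) | se (½ ℚ.* ε) (half>0 ε>0)
... | M , p | N , q = M ℕ.⊔ N , λ m n ≤m ≤n → begin-strict
      ℚ.∣ d m n ℚ.+ e m n ∣          ≤⟨ ℚ.∣p+q∣≤∣p∣+∣q∣ (d m n) (e m n) ⟩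
      ℚ.∣ d m n ∣ ℚ.+ ℚ.∣ e m n ∣    <⟨ ℚ.+-mono-<
                                          (p m n (ℕ.m⊔n≤o⇒m≤o M N ≤m) (ℕ.m⊔n≤o⇒m≤o M N ≤n))
                                          (q m n (ℕ.m⊔n≤o⇒n≤o M N ≤m) (ℕ.m⊔n≤o⇒n≤o M N ≤n)) ⟩
      ½ ℚ.* ε ℚ.+ ½ ℚ.* ε            ≡⟨ halves ε ⟩
      ε                              ∎
  where open ℚ.≤-Reasoning

small-* : ∀ {a d} → Bounded a → Small d → Small (λ m n → a m n ℚ.* d m n)
small-* {a} {d} (B , B>0 , M , p) sd ε ε>0 = helper (sd δ δ>0)
  where
  instance
    _ = B>0
    _ = ℚ.pos⇒nonZero B
    _ = ℚ.pos⇒nonNeg B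
    _ = ℚ.1/pos⇒pos B
  δ = ℚ.1/ B ℚ.* ε
  δ>0 : 0ℚ ℚ.< δ
  δ>0 = subst (ℚ._< δ) (ℚ.*-zeroʳ (ℚ.1/ B)) (ℚ.*-monoʳ-<-pos (ℚ.1/ B) ε>0)
  open ℚ.≤-Reasoning
  helper : (∃ λ N → ∀ m n → N ℕ.≤ m → N ℕ.≤ n → ℚ.∣ d m n ∣ ℚ.< δ) →
           ∃ λ N → ∀ m n → N ℕ.≤ m → N ℕ.≤ n → ℚ.∣ a m n ℚ.* d m n ∣ ℚ.< ε
  helper (N , q) = M ℕ.⊔ N , λ m n ≤m ≤n → begin-strict
    ℚ.∣ a m n ℚ.* d m n ∣          ≡⟨ ℚ.∣p*q∣≡∣p∣*∣q∣ (a m n) (d m n) ⟩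
    ℚ.∣ a m n ∣ ℚ.* ℚ.∣ d m n ∣    ≤⟨ ℚ.*-monoʳ-≤-nonNeg ℚ.∣ d m n ∣ {{ℚ.∣-∣-nonNeg (d m n)}}
                                        (p m n (ℕ.m⊔n≤o⇒m≤o M N ≤m) (ℕ.m⊔n≤o⇒m≤o M N ≤n)) ⟩
    B ℚ.* ℚ.∣ d m n ∣              <⟨ ℚ.*-monoʳ-<-pos B
                                        (q m n (ℕ.m⊔n≤o⇒n≤o M N ≤m) (ℕ.m⊔n≤o⇒n≤o M N ≤n)) ⟩
    B ℚ.* (ℚ.1/ B ℚ.* ε)           ≡⟨ ℚ.*-assoc B (ℚ.1/ B) ε ⟨
    (B ℚ.* ℚ.1/ B) ℚ.* ε           ≡⟨ cong (ℚ._* ε) (ℚ.*-inverseʳ B) ⟩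
    1ℚ ℚ.* ε                       ≡⟨ ℚ.*-identityˡ ε ⟩
    ε                              ∎

------------------------------------------------------------------------
-- The real numbers, as Cauchy sequences of rationals

record ℝ : Set where
  constructor mkℝ
  field
    seq    : ℕ → ℚ
    cauchy : ∀ ε → 0ℚ ℚ.< ε →
             ∃ λ N → ∀ m n → N ℕ.≤ m → N ℕ.≤ n → ℚ.∣ seq m ℚ.- seq n ∣ ℚ.< ε

open ℝ public

infix 4 _≈ᴿ_ _<ᴿ_

record _≈ᴿ_ (x y : ℝ) : Set where
  constructor mk≈
  field
    close : ∀ ε → 0ℚ ℚ.< ε →
            ∃ λ N → ∀ n → N ℕ.≤ n → ℚ.∣ seq x n ℚ.- seq y n ∣ ℚ.< ε

record _<ᴿ_ (x y : ℝ) : Set where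
  constructor mk<
  field
    gap   : ℚ
    gap>0 : 0ℚ ℚ.< gap
    apart : ∃ λ N → ∀ n → N ℕ.≤ n → seq x n ℚ.+ gap ℚ.< seq y n

open +-*-Solver using (solve; _:=_; _:+_; _:*_; _:-_; :-_)

EventuallyBounded : ℝ → Set
EventuallyBounded x = ∃ λ B → Positive B ×
                      ∃ λ N → ∀ n → N ℕ.≤ n → ℚ.∣ seq x n ∣ ℚ.≤ B

≈⇒small : ∀ x y → x ≈ᴿ y → Small (λ m _ → seq x m ℚ.- seq y m)
≈⇒small x y (mk≈ close) ε ε>0 with close ε ε>0
... | N , p = N , λ m _ N≤m _ → p m N≤m

small⇒≈ : ∀ x y → Small (λ m _ → seq x m ℚ.- seq y m) → x ≈ᴿ y
small⇒≈ x y s = mk≈ λ ε ε>0 →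
  let (N , p) = s ε ε>0 in N , λ n N≤n → p n n N≤n N≤n

≗⇒≈ : ∀ x y → (∀ n → seq x n ≡ seq y n) → x ≈ᴿ y
≗⇒≈ x y x≗y = small⇒≈ x y (small-≗
  (λ m _ → sym (trans (cong (ℚ._- seq y m) (x≗y m)) (ℚ.+-inverseʳ (seq y m)))) small-0)

eventuallyBounded : ∀ x → EventuallyBounded x
eventuallyBounded x with cauchy x 1ℚ (ℚ.positive⁻¹ 1ℚ)
... | N , p = B , B>0 , N , λ n N≤n → begin
      ℚ.∣ seq x n ∣                                      ≡⟨ cong ℚ.∣_∣ (split n) ⟩
      ℚ.∣ (seq x n ℚ.- seq x N) ℚ.+ seq x N ∣            ≤⟨ ℚ.∣p+q∣≤∣p∣+∣q∣ (seq x n ℚ.- seq x N) (seq x N) ⟩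
      ℚ.∣ seq x n ℚ.- seq x N ∣ ℚ.+ ℚ.∣ seq x N ∣        ≤⟨ ℚ.+-monoˡ-≤ ℚ.∣ seq x N ∣ (ℚ.<⇒≤ (p n N N≤n ℕ.≤-refl)) ⟩
      B                                                  ∎
  where
  open ℚ.≤-Reasoning
  B = 1ℚ ℚ.+ ℚ.∣ seq x N ∣
  B>0 : Positive B
  B>0 = ℚ.pos+nonNeg⇒pos 1ℚ ℚ.∣ seq x N ∣ {{ℚ.∣-∣-nonNeg (seq x N)}}
  split : ∀ n → seq x n ≡ (seq x n ℚ.- seq x N) ℚ.+ seq x N
  split n = solve 2 (λ a b → a := (a :- b) :+ b) refl (seq x n) (seq x N)

boundedˡ : ∀ x → Bounded (λ m _ → seq x m)
boundedˡ x = shift (eventuallyBounded x)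
  where
  shift : EventuallyBounded x → Bounded (λ m _ → seq x m)
  shift (B , B>0 , N , p) = B , B>0 , N , λ m _ N≤m _ → p m N≤m

boundedʳ : ∀ x → Bounded (λ _ n → seq x n)
boundedʳ x = shift (eventuallyBounded x)
  where
  shift : EventuallyBounded x → Bounded (λ _ n → seq x n)
  shift (B , B>0 , N , p) = B , B>0 , N , λ _ n _ N≤n → p n N≤n

infixl 6 _+ᴿ_
infixl 7 _*ᴿ_
infix  8 -ᴿ_

-- The ring operations are opaque only to keep rational arithmetic from being
-- unfolded by the type checker.
opaque

  constᴿ : ℚ → ℝ
  constᴿ q = mkℝ (λ _ → q) (small-≗ (λ _ _ → sym (ℚ.+-inverseʳ q)) small-0)

  _+ᴿ_ : ℝ → ℝ → ℝ
  x +ᴿ y = mkℝ (λ n → seq x n ℚ.+ seq y n) (small-≗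
    (λ m n → solve 4 (λ a b c d → (a :- b) :+ (c :- d) := (a :+ c) :- (b :+ d)) refl
               (seq x m) (seq x n) (seq y m) (seq y n))
    (small-+ (cauchy x) (cauchy y)))

  -ᴿ_ : ℝ → ℝ
  -ᴿ x = mkℝ (λ n → ℚ.- seq x n) (small-≗
    (λ m n → solve 2 (λ a b → :- (a :- b) := (:- a) :- (:- b)) refl (seq x m) (seq x n))
    (small-neg (cauchy x)))

  _*ᴿ_ : ℝ → ℝ → ℝ
  x *ᴿ y = mkℝ (λ n → seq x n ℚ.* seq y n) (small-≗
    (λ m n → solve 4 (λ a b c d → a :* (c :- d) :+ d :* (a :- b) := (a :* c) :- (b :* d)) refl
               (seq x m) (seq x n) (seq y m) (seq y n))
    (small-+ (small-* (boundedˡ x) (cauchy y)) (small-* (boundedʳ y) (cauchy x))))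

0ᴿ 1ᴿ : ℝ
0ᴿ = constᴿ 0ℚ
1ᴿ = constᴿ 1ℚ

opaque
  unfolding constᴿ _+ᴿ_ -ᴿ_ _*ᴿ_

  +ᴿ-assoc : ∀ x y z → (x +ᴿ y) +ᴿ z ≈ᴿ x +ᴿ (y +ᴿ z)
  +ᴿ-assoc x y z = ≗⇒≈ ((x +ᴿ y) +ᴿ z) (x +ᴿ (y +ᴿ z)) (λ n → ℚ.+-assoc (seq x n) (seq y n) (seq z n))

  +ᴿ-comm : ∀ x y → x +ᴿ y ≈ᴿ y +ᴿ x
  +ᴿ-comm x y = ≗⇒≈ (x +ᴿ y) (y +ᴿ x) (λ n → ℚ.+-comm (seq x n) (seq y n))

  +ᴿ-identityˡ : ∀ x → 0ᴿ +ᴿ x ≈ᴿ x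
  +ᴿ-identityˡ x = ≗⇒≈ (0ᴿ +ᴿ x) x (λ n → ℚ.+-identityˡ (seq x n))

  +ᴿ-inverseˡ : ∀ x → -ᴿ x +ᴿ x ≈ᴿ 0ᴿ
  +ᴿ-inverseˡ x = ≗⇒≈ (-ᴿ x +ᴿ x) 0ᴿ (λ n → ℚ.+-inverseˡ (seq x n))

  *ᴿ-assoc : ∀ x y z → (x *ᴿ y) *ᴿ z ≈ᴿ x *ᴿ (y *ᴿ z)
  *ᴿ-assoc x y z = ≗⇒≈ ((x *ᴿ y) *ᴿ z) (x *ᴿ (y *ᴿ z)) (λ n → ℚ.*-assoc (seq x n) (seq y n) (seq z n))

  *ᴿ-comm : ∀ x y → x *ᴿ y ≈ᴿ y *ᴿ x
  *ᴿ-comm x y = ≗⇒≈ (x *ᴿ y) (y *ᴿ x) (λ n → ℚ.*-comm (seq x n) (seq y n))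

  *ᴿ-identityˡ : ∀ x → 1ᴿ *ᴿ x ≈ᴿ x
  *ᴿ-identityˡ x = ≗⇒≈ (1ᴿ *ᴿ x) x (λ n → ℚ.*-identityˡ (seq x n))

  *ᴿ-distribˡ-+ᴿ : ∀ x y z → x *ᴿ (y +ᴿ z) ≈ᴿ x *ᴿ y +ᴿ x *ᴿ z
  *ᴿ-distribˡ-+ᴿ x y z = ≗⇒≈ (x *ᴿ (y +ᴿ z)) (x *ᴿ y +ᴿ x *ᴿ z) (λ n → ℚ.*-distribˡ-+ (seq x n) (seq y n) (seq z n))

  ≈ᴿ-sym : ∀ x y → x ≈ᴿ y → y ≈ᴿ x
  ≈ᴿ-sym x y p = small⇒≈ y x (small-≗
    (λ m _ → solve 2 (λ a b → :- (a :- b) := b :- a) refl (seq x m) (seq y m))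
    (small-neg (≈⇒small x y p)))

  ≈ᴿ-trans : ∀ x y z → x ≈ᴿ y → y ≈ᴿ z → x ≈ᴿ z
  ≈ᴿ-trans x y z p q = small⇒≈ x z (small-≗
    (λ m _ → solve 3 (λ a b c → (a :- b) :+ (b :- c) := a :- c) refl (seq x m) (seq y m) (seq z m))
    (small-+ (≈⇒small x y p) (≈⇒small y z q)))

  +ᴿ-cong : ∀ x y u v → x ≈ᴿ y → u ≈ᴿ v → x +ᴿ u ≈ᴿ y +ᴿ v
  +ᴿ-cong x y u v p q = small⇒≈ (x +ᴿ u) (y +ᴿ v) (small-≗
    (λ m _ → solve 4 (λ a b c d → (a :- b) :+ (c :- d) := (a :+ c) :- (b :+ d)) refl
               (seq x m) (seq y m) (seq u m) (seq v m))
    (small-+ (≈⇒small x y p) (≈⇒small u v q)))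

  -ᴿ-cong : ∀ x y → x ≈ᴿ y → -ᴿ x ≈ᴿ -ᴿ y
  -ᴿ-cong x y p = small⇒≈ (-ᴿ x) (-ᴿ y) (small-≗
    (λ m _ → solve 2 (λ a b → :- (a :- b) := (:- a) :- (:- b)) refl (seq x m) (seq y m))
    (small-neg (≈⇒small x y p)))

  *ᴿ-cong : ∀ x y u v → x ≈ᴿ y → u ≈ᴿ v → x *ᴿ u ≈ᴿ y *ᴿ v
  *ᴿ-cong x y u v p q = small⇒≈ (x *ᴿ u) (y *ᴿ v) (small-≗
    (λ m _ → solve 4 (λ a b c d → a :* (c :- d) :+ d :* (a :- b) := (a :* c) :- (b :* d)) refl
               (seq x m) (seq y m) (seq u m) (seq v m))
    (small-+ (small-* (boundedˡ x) (≈⇒small u v q)) (small-* (boundedˡ v) (≈⇒small x y p))))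

≈ᴿ-isEquivalence : IsEquivalence _≈ᴿ_
≈ᴿ-isEquivalence = record
  { refl  = λ {x} → ≗⇒≈ x x (λ _ → refl)
  ; sym   = λ {x} {y} → ≈ᴿ-sym x y
  ; trans = λ {x} {y} {z} → ≈ᴿ-trans x y z
  }

ℝ-setoid : Setoid 0ℓ 0ℓ
ℝ-setoid = record { isEquivalence = ≈ᴿ-isEquivalence }

ℝ-commutativeRing : CommutativeRing 0ℓ 0ℓ
ℝ-commutativeRing = record
  { Carrier = ℝ ; _≈_ = _≈ᴿ_ ; _+_ = _+ᴿ_ ; _*_ = _*ᴿ_ ; -_ = -ᴿ_ ; 0# = 0ᴿ ; 1# = 1ᴿ
  ; isCommutativeRing = record
    { isRing = record
      { +-isAbelianGroup = record
        { isGroup = record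
          { isMonoid = record
            { isSemigroup = record
              { isMagma = record
                { isEquivalence = ≈ᴿ-isEquivalence
                ; ∙-cong = λ {x} {y} {u} {v} → +ᴿ-cong x y u v
                }
              ; assoc = +ᴿ-assoc
              }
            ; identity = comm∧idˡ⇒id +ᴿ-comm +ᴿ-identityˡ
            }
          ; inverse = comm∧invˡ⇒inv +ᴿ-comm +ᴿ-inverseˡ
          ; ⁻¹-cong = λ {x} {y} → -ᴿ-cong x y
          }
        ; comm = +ᴿ-comm
        }
      ; *-cong = λ {x} {y} {u} {v} → *ᴿ-cong x y u v
      ; *-assoc = *ᴿ-assoc
      ; *-identity = comm∧idˡ⇒id *ᴿ-comm *ᴿ-identityˡ
      ; distrib = comm∧distrˡ⇒distr (λ {x} {y} {u} {v} → +ᴿ-cong x y u v) *ᴿ-comm *ᴿ-distribˡ-+ᴿ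
      }
    ; *-comm = *ᴿ-comm
    }
  }
  where open Consequences ℝ-setoid

open Sum (CommutativeRing.+-commutativeMonoid ℝ-commutativeRing) public using (sum)

-- Finite index sets E come with an enumeration Fin m ↔ E.
∑ᴿ : ∀ {m} {E : Set} → Fin m ↔ E → (E → ℝ) → ℝ
∑ᴿ F f = sum (f ∘ Inverse.to F)

------------------------------------------------------------------------
-- Signed sets

infix 4 _∈_ _⊆_ _≐_ _≃_

𝒫 : Set → Set
𝒫 E = E → Bool

_∈_ : {E : Set} → E → 𝒫 E → Set
e ∈ S = T (S e)

_⊆_ _≐_ : {E : Set} → 𝒫 E → 𝒫 E → Set
S ⊆ S′ = ∀ e → e ∈ S → e ∈ S′
S ≐ S′ = ∀ e → e ∈ S ⇔ e ∈ S′

record SignedSet (E : Set) : Set where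
  field
    _⁺ _⁻    : 𝒫 E
    disjoint : ∀ e → ¬ (e ∈ _⁺ × e ∈ _⁻)

open SignedSet public using (_⁺; _⁻)

module _ {E : Set} where

  infix 4 _≈_ _⟂_

  supp : SignedSet E → 𝒫 E
  supp X e = (X ⁺) e ∨ (X ⁻) e

  neg : SignedSet E → SignedSet E
  neg X = record
    { _⁺ = X ⁻ ; _⁻ = X ⁺ ; disjoint = λ e → SignedSet.disjoint X e ∘ swap }

  Nonempty : SignedSet E → Set
  Nonempty X = ∃ λ e → e ∈ supp X

  _≈_ : SignedSet E → SignedSet E → Set
  X ≈ Y = ((X ⁺) ≐ (Y ⁺)) × ((X ⁻) ≐ (Y ⁻))

  MinimalSupport : Pred (SignedSet E) 0ℓ → Pred (SignedSet E) 0ℓ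
  MinimalSupport 𝒱 X =
    𝒱 X × Nonempty X × (∀ Y → 𝒱 Y → Nonempty Y → supp Y ⊆ supp X → supp X ⊆ supp Y)

  _⟂_ : SignedSet E → SignedSet E → Set
  X ⟂ Y = (∀ e → ¬ (e ∈ supp X × e ∈ supp Y))
        ⊎ (∃ λ e → (e ∈ (X ⁺) × e ∈ (Y ⁺)) ⊎ (e ∈ (X ⁻) × e ∈ (Y ⁻)))
        × (∃ λ f → (f ∈ (X ⁺) × f ∈ (Y ⁻)) ⊎ (f ∈ (X ⁻) × f ∈ (Y ⁺)))

------------------------------------------------------------------------
-- Oriented matroids

  -- An oriented matroid is given by its family of signed circuits.
  record IsOrientedMatroid (𝒞 : Pred (SignedSet E) 0ℓ) : Set where
    field
      resp         : ∀ {X Y} → X ≈ Y → 𝒞 X → 𝒞 Y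
      nonempty     : ∀ {X} → 𝒞 X → Nonempty X
      symmetric    : ∀ {X} → 𝒞 X → 𝒞 (neg X)
      incomparable : ∀ {X Y} → 𝒞 X → 𝒞 Y → supp X ⊆ supp Y → (X ≈ Y) ⊎ (X ≈ neg Y)
      elimination  : ∀ {X Y} → 𝒞 X → 𝒞 Y → ¬ (X ≈ neg Y) →
                     ∀ e → e ∈ (X ⁺) → e ∈ (Y ⁻) →
                     ∃ λ Z → 𝒞 Z
                       × (∀ f → f ∈ (Z ⁺) → (f ∈ (X ⁺) ⊎ f ∈ (Y ⁺)) × f ≢ e)
                       × (∀ f → f ∈ (Z ⁻) → (f ∈ (X ⁻) ⊎ f ∈ (Y ⁻)) × f ≢ e)

  -- Signed cocircuits are the signed circuits of the dual oriented matroid, i.e.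
  -- the nonempty signed sets of minimal support orthogonal to all signed circuits.
  SignedCocircuits : Pred (SignedSet E) 0ℓ → Pred (SignedSet E) 0ℓ
  SignedCocircuits 𝒞 = MinimalSupport (λ Y → ∀ X → 𝒞 X → X ⟂ Y)

  -- The family of circuits of the underlying matroid.
  underlying : Pred (SignedSet E) 0ℓ → Pred (𝒫 E) 0ℓ
  underlying 𝒞 S = ∃ λ X → 𝒞 X × (supp X ≐ S)

------------------------------------------------------------------------
-- Matroids, given by their families of circuits

Independent : {E : Set} → Pred (𝒫 E) 0ℓ → Pred (𝒫 E) 0ℓ
Independent 𝒟 S = ¬ (∃ λ D → 𝒟 D × D ⊆ S)

-- Isomorphisms are required to match independent sets rather than circuits: an
-- arbitrary family of circuits need not be decidable, and independence, being
-- a negation, is insensitive to this.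
_≃_ : {E₁ E₂ : Set} → Pred (𝒫 E₁) 0ℓ → Pred (𝒫 E₂) 0ℓ → Set
_≃_ {E₁} {E₂} 𝒟₁ 𝒟₂ = ∃ λ (φ : E₁ ↔ E₂) →
  ∀ (S : 𝒫 E₂) → Independent 𝒟₁ (S ∘ Inverse.to φ) ⇔ Independent 𝒟₂ S

module _ {m : ℕ} {E : Set} (F : Fin m ↔ E) where

  LinearlyIndependent : ∀ {d} → (E → Fin d → ℝ) → 𝒫 E → Set
  LinearlyIndependent w S = ∀ (c : E → ℝ) →
    (∀ e → ¬ (e ∈ S) → c e ≈ᴿ 0ᴿ) →
    (∀ k → ∑ᴿ F (λ e → c e *ᴿ w e k) ≈ᴿ 0ᴿ) →
    ∀ e → c e ≈ᴿ 0ᴿ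

  RealizableOverℝ : Pred (𝒫 E) 0ℓ → Set
  RealizableOverℝ 𝒟 = ∃ λ d → ∃ λ (w : E → Fin d → ℝ) →
    ∀ S → Independent 𝒟 S ⇔ LinearlyIndependent w S

  -- Sign patterns of affine dependencies of a point configuration p, and the
  -- oriented matroid whose signed circuits are those of minimal support.
  AffineVectors : ∀ {d} → (E → Fin d → ℝ) → Pred (SignedSet E) 0ℓ
  AffineVectors p X = ∃ λ (c : E → ℝ) →
      ∑ᴿ F c ≈ᴿ 0ᴿ
    × (∀ k → ∑ᴿ F (λ e → c e *ᴿ p e k) ≈ᴿ 0ᴿ)
    × (∀ e → e ∈ (X ⁺) ⇔ 0ᴿ <ᴿ c e)
    × (∀ e → e ∈ (X ⁻) ⇔ c e <ᴿ 0ᴿ)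

  Aff : ∀ {d} → (E → Fin d → ℝ) → Pred (SignedSet E) 0ℓ
  Aff p = MinimalSupport (AffineVectors p)

------------------------------------------------------------------------
-- The cube

C : ℕ → Set
C n = Vec Sign n

enumC : ∀ n → Fin (2 ^ n) ↔ C n
enumC zero    = mk↔ₛ′ (λ _ → []) (λ _ → zero) (λ { [] → refl }) (λ { zero → refl })
enumC (suc n) = (cons ↔-∘ (signs ×-↔ enumC n)) ↔-∘ Fin.*↔×
  where
  signs : Fin 2 ↔ Sign
  signs = mk↔ₛ′
    (λ { zero → Sign.+ ; (Fin.suc zero) → Sign.- })
    (λ { Sign.+ → zero ; Sign.- → Fin.suc zero })
    (λ { Sign.+ → refl ; Sign.- → refl })
    (λ { zero → refl ; (Fin.suc zero) → refl })
  cons : (Sign × C n) ↔ C (suc n)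
  cons = mk↔ₛ′ (λ (s , v) → s ∷ v) (λ { (s ∷ v) → s , v }) (λ { (_ ∷ _) → refl }) (λ { (_ , _) → refl })

⟦_⟧ : Sign → ℝ
⟦ Sign.+ ⟧ = 1ᴿ
⟦ Sign.- ⟧ = -ᴿ 1ᴿ

𝐐 : ∀ n → Pred (SignedSet (C n)) 0ℓ
𝐐 n = Aff (enumC n) (λ v i → ⟦ lookup v i ⟧)

-[_]_ : ∀ {n} → Subset n → C n → C n
-[ A ] v = zipWith (λ inA s → if inA then opposite s else s) A v

IsRectangle : ∀ {n} → C n → Subset n → Subset n → Pred (SignedSet (C n)) 0ℓ
IsRectangle v A B X =
    (∀ u → u ∈ (X ⁺) ⇔ (u ≡ v ⊎ u ≡ -[ A Subset.∪ B ] v))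
  × (∀ u → u ∈ (X ⁻) ⇔ (u ≡ -[ A ] v ⊎ u ≡ -[ B ] v))

Facet : ∀ {n} → Fin n → Sign → Pred (C n) 0ℓ
Facet i s v = lookup v i ≡ s

SkewFacet : ∀ {n} → Fin n → Fin n → Sign → Pred (C n) 0ℓ
SkewFacet i j s v = lookup v i ≡ s Sign.* lookup v j

ComplementaryTo : ∀ {n} → Pred (C n) 0ℓ → Pred (SignedSet (C n)) 0ℓ
ComplementaryTo H Y = ∀ v → v ∈ supp Y ⇔ (¬ H v)

record IsOrientedCube (n : ℕ) (𝓜 : Pred (SignedSet (C n)) 0ℓ) : Set where
  field
    isOrientedMatroid : IsOrientedMatroid 𝓜
    rectangles : ∀ v A B → Subset.Nonempty A → Subset.Nonempty B →
                 Subset.Empty (A Subset.∩ B) →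
                 ∀ X → IsRectangle v A B X → 𝓜 X
    facets     : ∀ i s Y → SignedCocircuits (𝐐 n) Y → ComplementaryTo (Facet i s) Y →
                 SignedCocircuits 𝓜 Y
    skewFacets : ∀ i j s → i ≢ j →
                 ∀ Y → SignedCocircuits (𝐐 n) Y → ComplementaryTo (SkewFacet i j s) Y →
                 SignedCocircuits 𝓜 Y

{-# OPTIONS --safe #-}
module Submission where

-- Let w realize the underlying matroid.  Facets and skew-facets are zero sets of
-- covectors, hence flats of the linear matroid of w.  Facets make w(⊕) and the w(eᵢ)
-- independent, where ⊕ is the all-plus vertex and eᵢ its neighbours; the rectangles
-- through ⊕ write every other w(v) in this basis, with support the minus set of v.
-- Skew-facets force the ratio of the i-th and l-th coordinates to be the same for all v,
-- so that after rescaling w(v) = (t(v), indicator of the minus set of v).  The rectangles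
-- then say that t is modular away from ⊕, with a nonzero defect c at ⊕ which is common to
-- all pairs of directions; scaling w(⊕) so that t(⊕) = −c makes t affine in v.  Thus w is,
-- up to nonzero scalars and a linear change of coordinates, the affine realization of the
-- cube, and the identity is an isomorphism.
--
-- Independence is a negation, so all of this may be carried out under a double negation.

open import Defs
open import Level using (0ℓ)
open import Algebra.Bundles using (CommutativeRing)
import Algebra.Properties.CommutativeMonoid.Sum as Sum
import Algebra.Properties.Ring as RingProperties
import Algebra.Properties.Semiring.Sum as SemiringSum
import Algebra.Solver.Ring as RingSolver
import Algebra.Solver.Ring.AlmostCommutativeRing as ACR
open import Data.Bool.Base using (Bool; true; false; T; if_then_else_; _∨_; _∧_; not)
open import Data.Bool.Properties using (T?; T-≡; T-∧; T-∨; T-not-≡; ∨-identityʳ)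
open import Data.Empty using (⊥)
open import Data.Fin.Base as Fin using (Fin; zero; suc)
import Data.Fin.Properties as Fin
open import Data.Fin.Subset as Subset using (Subset; ⁅_⁆)
import Data.Fin.Subset.Properties as Subset
import Data.Maybe.Base as Maybe
open import Data.Nat.Base as ℕ using (ℕ; zero; suc; NonZero; _<_)
open import Data.Nat.Induction using (<-wellFounded; Acc; acc)
import Data.Nat.Properties as ℕ
open import Data.Product using (∃; _×_; _,_; proj₁; proj₂; map₂)
open import Data.Rational as ℚ using (ℚ; 0ℚ; 1ℚ; ½; Positive)
import Data.Rational.Properties as ℚ
open import Data.Rational.Solver using () renaming (module +-*-Solver to ℚ-Solver)
open import Data.Sign.Base as Sign using (Sign; opposite)
import Data.Sign.Properties as Sign
open import Data.Sum using (_⊎_; inj₁; inj₂; [_,_]′)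
open import Data.Vec.Base using ([]; _∷_; lookup; zipWith; updateAt; replicate; tabulate)
open import Data.Vec.Functional using () renaming (_∷_ to _◂_)
import Data.Vec.Properties as Vec
open import Effect.Monad using (RawMonad)
open import Function using (_∘_; _⇔_; mk⇔; Equivalence; Inverse; _↔_; id)
open import Function.Construct.Identity using (↔-id)
open import Relation.Binary.Consequences using (dec⇒weaklyDec)
open import Relation.Binary.Definitions using (DecidableEquality)
open import Relation.Binary.PropositionalEquality as ≡
  using (_≡_; _≢_; refl; cong; cong₂; subst; subst₂)
import Relation.Binary.Reasoning.Setoid as SetoidReasoning
open import Relation.Nullary using (¬_; Dec; yes; no)
open import Relation.Nullary.Decidable
  using (⌊_⌋; toWitness; fromWitness; from-yes; map′; _×-dec_; _⊎-dec_; ¬?; decidable-stable)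
open import Relation.Nullary.Negation using (contradiction; ¬¬-Monad)
open import Relation.Unary using (Pred; Decidable)

open RawMonad (¬¬-Monad {0ℓ}) using (_>>=_; pure; rawApplicative)

-- Order and division in ℝ

-- The hypotheses on facets and skew-facets speak only of signed sets already known to be cocircuits
-- of `𝐐 n`, so such cocircuits have to be exhibited; the minimality of their supports rests in turn
-- on rectangles being circuits of `𝐐 n`. Orthogonality is used in the form that two orthogonal
-- signed sets never have exactly one common element. The vertex `⊕` is special because its minus
-- set is empty. At any other `v` a minus coordinate fixes the scale of w(v), and the same
-- coordinate makes the coefficients of a rectangle with lowest vertex `v` sum to zero. Neither
-- happens at `⊕`: its scale is free, and this freedom absorbs the defect c. The defect is nonzero
-- because all four coefficients of a rectangle relation are, and c ≠ 0 is what recovers the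
-- condition that the coefficients of an affine dependency sum to zero.

q≤∣q∣ : ∀ q → q ℚ.≤ ℚ.∣ q ∣
q≤∣q∣ q with ℚ.≤-total 0ℚ q
... | inj₁ 0≤q = ℚ.≤-reflexive (≡.sym (ℚ.0≤p⇒∣p∣≡p 0≤q))
... | inj₂ q≤0 = ℚ.≤-trans q≤0 (ℚ.0≤∣p∣ q)

-- Later oscillation costs less than half of the margin `δ` reached at `N`, so `½ ℚ.* δ` can serve
-- as the gap of `0ᴿ <ᴿ x`. The margin is written as two halves so that the solver can cancel one of
-- them.
positive-gap : ∀ x N δ → 0ℚ ℚ.< δ → ½ ℚ.* δ ℚ.+ ½ ℚ.* δ ℚ.≤ seq x N →
               (∀ n → N ℕ.≤ n → ℚ.∣ seq x N ℚ.- seq x n ∣ ℚ.< ½ ℚ.* δ) →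
               ∀ n → N ℕ.≤ n → 0ℚ ℚ.+ ½ ℚ.* δ ℚ.< seq x n
positive-gap x N δ δ>0 big near n N≤n = begin-strict
  0ℚ ℚ.+ ½ ℚ.* δ                             ≡⟨ solve 1 (λ d → con 0ℚ :+ d := (d :+ d) :- d) refl (½ ℚ.* δ) ⟩
  (½ ℚ.* δ ℚ.+ ½ ℚ.* δ) ℚ.- ½ ℚ.* δ          <⟨ ℚ.+-mono-≤-< big (ℚ.neg-antimono-<
                                                  (ℚ.≤-<-trans (q≤∣q∣ (seq x N ℚ.- seq x n)) (near n N≤n))) ⟩
  seq x N ℚ.- (seq x N ℚ.- seq x n)          ≡⟨ solve 2 (λ a b → a :- (a :- b) := b) refl (seq x N) (seq x n) ⟩
  seq x n                                    ∎
  where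
  open ℚ.≤-Reasoning
  open ℚ-Solver using (solve; con; _:=_; _:+_; _:*_; _:-_; :-_)

opaque
  unfolding constᴿ _+ᴿ_ -ᴿ_ _*ᴿ_

  <0⇒0<- : ∀ {x} → x <ᴿ 0ᴿ → 0ᴿ <ᴿ -ᴿ x
  <0⇒0<- {x} (mk< g g>0 (N , p)) = mk< g g>0 (N , λ n N≤n →
    subst₂ ℚ._<_ (solve 2 (λ a g → (a :+ g) :- a := con 0ℚ :+ g) refl (seq x n) g)
                 (solve 1 (λ a → con 0ℚ :- a := :- a) refl (seq x n))
      (ℚ.+-monoˡ-< (ℚ.- seq x n) (p n N≤n)))
    where open ℚ-Solver using (solve; con; _:=_; _:+_; _:*_; _:-_; :-_)

  0<-⇒<0 : ∀ {x} → 0ᴿ <ᴿ -ᴿ x → x <ᴿ 0ᴿ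
  0<-⇒<0 {x} (mk< g g>0 (N , p)) = mk< g g>0 (N , λ n N≤n →
    subst₂ ℚ._<_ (solve 2 (λ a g → (con 0ℚ :+ g) :+ a := a :+ g) refl (seq x n) g)
                 (solve 1 (λ a → (:- a) :+ a := con 0ℚ) refl (seq x n))
      (ℚ.+-monoˡ-< (seq x n) (p n N≤n)))
    where open ℚ-Solver using (solve; con; _:=_; _:+_; _:*_; _:-_; :-_)

  0<-resp-≈ : ∀ {x y} → x ≈ᴿ y → 0ᴿ <ᴿ x → 0ᴿ <ᴿ y
  -- Half of the gap is spent on the distance between `x` and `y`.
  0<-resp-≈ {x} {y} (mk≈ close) (mk< g g>0 (M , p)) with close (½ ℚ.* g) (half>0 g>0)
  ... | N , q = mk< (½ ℚ.* g) (half>0 g>0) (M ℕ.⊔ N , λ n ≤n → begin-strict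
    0ℚ ℚ.+ ½ ℚ.* g                    ≡⟨ solve 1 (λ h → con 0ℚ :+ h := (con 0ℚ :+ (h :+ h)) :- h) refl (½ ℚ.* g) ⟩
    (0ℚ ℚ.+ (½ ℚ.* g ℚ.+ ½ ℚ.* g)) ℚ.- ½ ℚ.* g  ≡⟨ cong (λ z → (0ℚ ℚ.+ z) ℚ.- ½ ℚ.* g) (halves g) ⟩
    (0ℚ ℚ.+ g) ℚ.- ½ ℚ.* g            <⟨ ℚ.+-mono-< (p n (ℕ.m⊔n≤o⇒m≤o M N ≤n)) (ℚ.neg-antimono-<
                                          (ℚ.≤-<-trans (q≤∣q∣ (seq x n ℚ.- seq y n)) (q n (ℕ.m⊔n≤o⇒n≤o M N ≤n)))) ⟩
    seq x n ℚ.- (seq x n ℚ.- seq y n) ≡⟨ solve 2 (λ a b → a :- (a :- b) := b) refl (seq x n) (seq y n) ⟩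
    seq y n ∎)
    where
    open ℚ.≤-Reasoning
    open ℚ-Solver using (solve; con; _:=_; _:+_; _:*_; _:-_; :-_)

  0<+ : ∀ {x y} → 0ᴿ <ᴿ x → 0ᴿ <ᴿ y → 0ᴿ <ᴿ x +ᴿ y
  0<+ {x} {y} (mk< g g>0 (M , p)) (mk< h h>0 (N , q)) = mk< (g ℚ.+ h) (ℚ.+-mono-< g>0 h>0)
    (M ℕ.⊔ N , λ n ≤n → subst (ℚ._< _)
      (solve 2 (λ g h → (con 0ℚ :+ g) :+ (con 0ℚ :+ h) := con 0ℚ :+ (g :+ h)) refl g h)
      (ℚ.+-mono-< (p n (ℕ.m⊔n≤o⇒m≤o M N ≤n)) (q n (ℕ.m⊔n≤o⇒n≤o M N ≤n))))
    where open ℚ-Solver using (solve; con; _:=_; _:+_; _:*_; _:-_; :-_)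

  0<* : ∀ {x y} → 0ᴿ <ᴿ x → 0ᴿ <ᴿ y → 0ᴿ <ᴿ x *ᴿ y
  0<* {x} {y} (mk< g g>0 (M , p)) (mk< h h>0 (N , q)) =
    mk< (g ℚ.* h) (ℚ.positive⁻¹ (g ℚ.* h) {{ℚ.pos*pos⇒pos g h}}) (M ℕ.⊔ N , λ n ≤n →
      let g<x = subst (ℚ._< seq x n) (ℚ.+-identityˡ g) (p n (ℕ.m⊔n≤o⇒m≤o M N ≤n))
          h<y = subst (ℚ._< seq y n) (ℚ.+-identityˡ h) (q n (ℕ.m⊔n≤o⇒n≤o M N ≤n))
      in subst (ℚ._< seq x n ℚ.* seq y n) (≡.sym (ℚ.+-identityˡ (g ℚ.* h)))
           (ℚ.<-trans (ℚ.*-monoʳ-<-pos g h<y) (ℚ.*-monoˡ-<-pos (seq y n) {{ℚ.positive (ℚ.<-trans h>0 h<y)}} g<x)))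
    where
    instance
      g-pos : Positive g
      g-pos = ℚ.positive g>0
      h-pos : Positive h
      h-pos = ℚ.positive h>0

  0≮0 : ¬ 0ᴿ <ᴿ 0ᴿ
  0≮0 (mk< g g>0 (N , p)) = ℚ.<-asym g>0 (subst (ℚ._< 0ℚ) (ℚ.+-identityˡ g) (p N ℕ.≤-refl))

  0<1 : 0ᴿ <ᴿ 1ᴿ
  0<1 = mk< ½ (ℚ.positive⁻¹ ½) (0 , λ _ _ → from-yes (0ℚ ℚ.+ ½ ℚ.<? 1ℚ))

  -- Comparing the rational `seq x N` with `δ` is decidable; if it or its negative reached `δ`, then
  -- `positive-gap` would give `x` a sign. `≈0-stable` rests on this.
  ≮0≯0⇒≈0 : ∀ {x} → ¬ 0ᴿ <ᴿ x → ¬ x <ᴿ 0ᴿ → x ≈ᴿ 0ᴿ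
  ≮0≯0⇒≈0 {x} x≯0 x≮0 = mk≈ λ ε ε>0 → bound ε ε>0
    where
    open ℚ-Solver using (solve; con; _:=_; _:+_; _:*_; _:-_; :-_)
    bound : ∀ ε → 0ℚ ℚ.< ε → ∃ λ N → ∀ n → N ℕ.≤ n → ℚ.∣ seq x n ℚ.- 0ℚ ∣ ℚ.< ε
    bound ε ε>0 with cauchy x (½ ℚ.* (½ ℚ.* ε)) (half>0 (half>0 ε>0))
    ... | N , p = N , λ n N≤n → begin-strict
        ℚ.∣ seq x n ℚ.- 0ℚ ∣                            ≡⟨ cong ℚ.∣_∣ (solve 2 (λ a b → a :- con 0ℚ := (a :- b) :+ b) refl (seq x n) (seq x N)) ⟩
        ℚ.∣ (seq x n ℚ.- seq x N) ℚ.+ seq x N ∣         ≤⟨ ℚ.∣p+q∣≤∣p∣+∣q∣ (seq x n ℚ.- seq x N) (seq x N) ⟩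
        ℚ.∣ seq x n ℚ.- seq x N ∣ ℚ.+ ℚ.∣ seq x N ∣     <⟨ ℚ.+-mono-< (ℚ.<-trans (p n N N≤n ℕ.≤-refl) quarter<half) ∣x∣<δ ⟩
        δ ℚ.+ δ                                        ≡⟨ halves ε ⟩
        ε ∎
      where
      open ℚ.≤-Reasoning
      δ : ℚ
      δ = ½ ℚ.* ε
      δ>0 : 0ℚ ℚ.< δ
      δ>0 = half>0 ε>0
      quarter<half : ½ ℚ.* δ ℚ.< δ
      quarter<half = subst₂ ℚ._<_ (ℚ.+-identityʳ (½ ℚ.* δ)) (halves δ) (ℚ.+-monoʳ-< (½ ℚ.* δ) (half>0 {δ} δ>0))
      x<δ : seq x N ℚ.< δ
      x<δ with ℚ._<?_ (seq x N) δ
      ... | yes x<δ = x<δ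
      ... | no x≮δ = contradiction (mk< (½ ℚ.* δ) (half>0 {δ} δ>0) (N ,
              positive-gap x N δ δ>0 (ℚ.≤-trans (ℚ.≤-reflexive (halves δ)) (ℚ.≮⇒≥ x≮δ))
                (λ n N≤n → p N n ℕ.≤-refl N≤n))) x≯0
      -x<δ : ℚ.- seq x N ℚ.< δ
      -x<δ with ℚ._<?_ (ℚ.- seq x N) δ
      ... | yes x<δ = x<δ
      ... | no x≮δ = contradiction (0<-⇒<0 {x} (mk< (½ ℚ.* δ) (half>0 {δ} δ>0) (N ,
              positive-gap (-ᴿ x) N δ δ>0 (ℚ.≤-trans (ℚ.≤-reflexive (halves δ)) (ℚ.≮⇒≥ x≮δ))
                (λ n N≤n → subst (ℚ._< ½ ℚ.* δ)
                  (≡.trans (≡.sym (ℚ.∣-p∣≡∣p∣ (seq x N ℚ.- seq x n)))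
                    (cong ℚ.∣_∣ (solve 2 (λ a b → :- (a :- b) := (:- a) :- (:- b)) refl (seq x N) (seq x n))))
                  (p N n ℕ.≤-refl N≤n))))) x≮0
      ∣x∣<δ : ℚ.∣ seq x N ∣ ℚ.< δ
      ∣x∣<δ = [ (λ eq → subst (ℚ._< δ) (≡.sym eq) x<δ) , (λ eq → subst (ℚ._< δ) (≡.sym eq) -x<δ) ]′
                (ℚ.∣p∣≡p∨∣p∣≡-p (seq x N))

  -- Terms before `N` may be zero, so the reciprocals `r` are those of the shifted sequence `a`. The
  -- product then differs from one by `r m` times `seq x m − a m`, which is small because `x` is
  -- Cauchy and `r` is bounded.
  inverse-of-positive : ∀ {x} → 0ᴿ <ᴿ x → ∃ λ y → x *ᴿ y ≈ᴿ 1ᴿ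
  inverse-of-positive {x} (mk< g g>0 (N , p)) = mkℝ r r-cauchy , small⇒≈ (x *ᴿ mkℝ r r-cauchy) 1ᴿ (small-≗ {λ m _ → r m ℚ.* (seq x m ℚ.- a m)} product
      (small-* {λ m _ → r m} r-bounded
         λ ε ε>0 → map₂ (λ q m _ M≤m _ → q m (N ℕ.+ m) M≤m (ℕ.≤-trans M≤m (ℕ.m≤n+m m N))) (cauchy x ε ε>0)))
    where
    a : ℕ → ℚ
    a n = seq x (N ℕ.+ n)
    g<a : ∀ n → g ℚ.< a n
    g<a n = subst (ℚ._< a n) (ℚ.+-identityˡ g) (p (N ℕ.+ n) (ℕ.m≤m+n N n))
    instance
      g-pos : Positive g
      g-pos = ℚ.positive g>0
      a-pos : ∀ {n} → Positive (a n)
      a-pos {n} = ℚ.positive (ℚ.<-trans g>0 (g<a n))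
      g-nonZero : ℚ.NonZero g
      g-nonZero = ℚ.pos⇒nonZero g
      a-nonZero : ∀ {n} → ℚ.NonZero (a n)
      a-nonZero {n} = ℚ.pos⇒nonZero (a n)
    r : ℕ → ℚ
    r n = ℚ.1/ a n
    r-pos : ∀ n → Positive (r n)
    r-pos n = ℚ.1/pos⇒pos (a n)
    1/g-pos : Positive (ℚ.1/ g)
    1/g-pos = ℚ.1/pos⇒pos g
    open ℚ.≤-Reasoning
    r≤1/g : ∀ n → ℚ.∣ r n ∣ ℚ.≤ ℚ.1/ g
    r≤1/g n = begin
      ℚ.∣ r n ∣               ≡⟨ ℚ.0≤p⇒∣p∣≡p (ℚ.<⇒≤ (ℚ.positive⁻¹ (r n) {{r-pos n}})) ⟩
      r n                     ≡⟨ ℚ.*-identityʳ (r n) ⟨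
      r n ℚ.* 1ℚ              ≡⟨ cong (r n ℚ.*_) (ℚ.*-inverseʳ g) ⟨
      r n ℚ.* (g ℚ.* ℚ.1/ g)  ≤⟨ ℚ.*-monoˡ-≤-nonNeg (r n) {{ℚ.pos⇒nonNeg (r n) {{r-pos n}}}} (ℚ.*-monoʳ-≤-nonNeg (ℚ.1/ g) {{ℚ.pos⇒nonNeg (ℚ.1/ g) {{1/g-pos}}}} (ℚ.<⇒≤ (g<a n))) ⟩
      r n ℚ.* (a n ℚ.* ℚ.1/ g) ≡⟨ ℚ.*-assoc (r n) (a n) (ℚ.1/ g) ⟨
      (r n ℚ.* a n) ℚ.* ℚ.1/ g ≡⟨ cong (ℚ._* ℚ.1/ g) (ℚ.*-inverseˡ (a n)) ⟩
      1ℚ ℚ.* ℚ.1/ g           ≡⟨ ℚ.*-identityˡ (ℚ.1/ g) ⟩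
      ℚ.1/ g                  ∎
    r-bounded : Bounded (λ m _ → r m)
    r-bounded = ℚ.1/ g , 1/g-pos , 0 , λ m _ _ _ → r≤1/g m
    r-boundedʳ : Bounded (λ _ n → r n)
    r-boundedʳ = ℚ.1/ g , 1/g-pos , 0 , λ _ n _ _ → r≤1/g n
    open ℚ-Solver using (solve; con; _:=_; _:+_; _:*_; _:-_; :-_)
    r-cauchy : Small (λ m n → r m ℚ.- r n)
    r-cauchy = small-≗ (λ m n → ≡.trans
        (solve 4 (λ rm rn am an → rm :* (rn :* (an :- am)) := (rn :* an) :* rm :- (rm :* am) :* rn) refl (r m) (r n) (a m) (a n))
        (cong₂ ℚ._-_ (≡.trans (cong (ℚ._* r m) (ℚ.*-inverseˡ (a n))) (ℚ.*-identityˡ (r m)))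
                     (≡.trans (cong (ℚ._* r n) (ℚ.*-inverseˡ (a m))) (ℚ.*-identityˡ (r n)))))
      (small-* {λ m _ → r m} r-bounded (small-* {λ _ n → r n} r-boundedʳ
        λ ε ε>0 → map₂ (λ q m n M≤m M≤n → q (N ℕ.+ n) (N ℕ.+ m) (ℕ.≤-trans M≤n (ℕ.m≤n+m n N)) (ℕ.≤-trans M≤m (ℕ.m≤n+m m N)))
                    (cauchy x ε ε>0)))
    product : ∀ m (_ : ℕ) → r m ℚ.* (seq x m ℚ.- a m) ≡ seq x m ℚ.* r m ℚ.- 1ℚ
    product m _ = ≡.trans (solve 3 (λ r x a → r :* (x :- a) := x :* r :- r :* a) refl (r m) (seq x m) (a m))
                          (cong (λ z → seq x m ℚ.* r m ℚ.- z) (ℚ.*-inverseˡ (a m)))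

  constᴿ-+ : ∀ p q → constᴿ (p ℚ.+ q) ≈ᴿ constᴿ p +ᴿ constᴿ q
  constᴿ-+ p q = ≗⇒≈ (constᴿ (p ℚ.+ q)) (constᴿ p +ᴿ constᴿ q) (λ _ → refl)

  constᴿ-* : ∀ p q → constᴿ (p ℚ.* q) ≈ᴿ constᴿ p *ᴿ constᴿ q
  constᴿ-* p q = ≗⇒≈ (constᴿ (p ℚ.* q)) (constᴿ p *ᴿ constᴿ q) (λ _ → refl)

  constᴿ-neg : ∀ p → constᴿ (ℚ.- p) ≈ᴿ -ᴿ constᴿ p
  constᴿ-neg p = ≗⇒≈ (constᴿ (ℚ.- p)) (-ᴿ constᴿ p) (λ _ → refl)

module R where
  open CommutativeRing ℝ-commutativeRing public
    renaming (refl to ≈-refl; sym to ≈-sym; trans to ≈-trans; reflexive to ≈-reflexive)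
  open RingProperties ring public using (-‿involutive; -0#≈0#; -‿distribˡ-*; -‿distribʳ-*)
  open Sum +-commutativeMonoid public using (∑-distrib-+; ∑-comm; sum-cong-≋)
  open SemiringSum semiring public using (*-distribˡ-sum; *-distribʳ-sum)

open R using (≈-refl; ≈-sym; ≈-trans; ≈-reflexive)

-- Rational coefficients make the coefficient equality of the solver decidable.
ℚ⟶ℝ : ℚ.+-*-rawRing ACR.-Raw-AlmostCommutative⟶ ACR.fromCommutativeRing ℝ-commutativeRing
ℚ⟶ℝ = record
  { ⟦_⟧ = constᴿ ; +-homo = constᴿ-+ ; *-homo = constᴿ-* ; -‿homo = constᴿ-neg
  ; 0-homo = ≈-refl ; 1-homo = ≈-refl }

module ℝ-Solver = RingSolver ℚ.+-*-rawRing (ACR.fromCommutativeRing ℝ-commutativeRing) ℚ⟶ℝ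
  (λ p q → Maybe.map (≈-reflexive ∘ cong constᴿ) (dec⇒weaklyDec ℚ._≟_ p q))

open ℝ-Solver using (solve; con; _:=_; _:+_; _:*_; _:-_; :-_)

infix 4 _≉ᴿ_
_≉ᴿ_ : ℝ → ℝ → Set
x ≉ᴿ y = ¬ x ≈ᴿ y

0<⇒≉0 : ∀ {x} → 0ᴿ <ᴿ x → x ≉ᴿ 0ᴿ
0<⇒≉0 x>0 x≈0 = 0≮0 (0<-resp-≈ x≈0 x>0)

0<∧<0⇒⊥ : ∀ {x} → 0ᴿ <ᴿ x → ¬ x <ᴿ 0ᴿ
0<∧<0⇒⊥ {x} x>0 x<0 = 0<⇒≉0 (0<+ x>0 (<0⇒0<- x<0)) (R.-‿inverseʳ x)

-≈0⇒≈0 : ∀ {x} → -ᴿ x ≈ᴿ 0ᴿ → x ≈ᴿ 0ᴿ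
-≈0⇒≈0 {x} -x≈0 = ≈-trans (≈-sym (R.-‿involutive x)) (≈-trans (R.-‿cong -x≈0) R.-0#≈0#)

<0⇒≉0 : ∀ {x} → x <ᴿ 0ᴿ → x ≉ᴿ 0ᴿ
<0⇒≉0 x<0 x≈0 = 0<⇒≉0 (<0⇒0<- x<0) (≈-trans (R.-‿cong x≈0) R.-0#≈0#)

-- Allows an equation to be proved with signs, inverses and choices that are available only under a
-- double negation.
≈0-stable : ∀ {x} → ¬ ¬ x ≈ᴿ 0ᴿ → x ≈ᴿ 0ᴿ
≈0-stable ¬¬x≈0 = ≮0≯0⇒≈0 (λ x>0 → ¬¬x≈0 (0<⇒≉0 x>0)) (λ x<0 → ¬¬x≈0 (<0⇒≉0 x<0))

≉0⇒signed : ∀ {x} → x ≉ᴿ 0ᴿ → ¬ ¬ (0ᴿ <ᴿ x ⊎ 0ᴿ <ᴿ -ᴿ x)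
≉0⇒signed x≉0 ¬signed = x≉0 (≮0≯0⇒≈0 (¬signed ∘ inj₁) (¬signed ∘ inj₂ ∘ <0⇒0<-))

1≉0 : 1ᴿ ≉ᴿ 0ᴿ
1≉0 = 0<⇒≉0 0<1

-≉0 : ∀ {x} → x ≉ᴿ 0ᴿ → -ᴿ x ≉ᴿ 0ᴿ
-≉0 x≉0 = x≉0 ∘ -≈0⇒≈0

*≉0 : ∀ {x y} → x ≉ᴿ 0ᴿ → y ≉ᴿ 0ᴿ → x *ᴿ y ≉ᴿ 0ᴿ
*≉0 {x} {y} x≉0 y≉0 xy≈0 = ≉0⇒signed x≉0 λ sx → ≉0⇒signed y≉0 λ sy → absurd sx sy
  where
  absurd : 0ᴿ <ᴿ x ⊎ 0ᴿ <ᴿ -ᴿ x → 0ᴿ <ᴿ y ⊎ 0ᴿ <ᴿ -ᴿ y → _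
  absurd (inj₁ x>0) (inj₁ y>0) = 0<⇒≉0 (0<* x>0 y>0) xy≈0
  absurd (inj₁ x>0) (inj₂ y<0) = -≉0 (λ e → 0<⇒≉0 (0<* x>0 y<0) e)
    (≈-trans (R.-‿cong (≈-sym (R.-‿distribʳ-* x y))) (≈-trans (R.-‿involutive _) xy≈0))
  absurd (inj₂ x<0) (inj₁ y>0) = -≉0 (λ e → 0<⇒≉0 (0<* x<0 y>0) e)
    (≈-trans (R.-‿cong (≈-sym (R.-‿distribˡ-* x y))) (≈-trans (R.-‿involutive _) xy≈0))
  absurd (inj₂ x<0) (inj₂ y<0) = 0<⇒≉0 (0<* x<0 y<0)
    (≈-trans (solve 2 (λ x y → (:- x) :* (:- y) := x :* y) ≈-refl x y) xy≈0)

*-cancelˡ-≈0 : ∀ {x y} → x ≉ᴿ 0ᴿ → x *ᴿ y ≈ᴿ 0ᴿ → y ≈ᴿ 0ᴿ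
*-cancelˡ-≈0 x≉0 xy≈0 = ≈0-stable λ y≉0 → *≉0 x≉0 y≉0 xy≈0

≈0-*ʳ : ∀ {x y} → y ≈ᴿ 0ᴿ → x *ᴿ y ≈ᴿ 0ᴿ
≈0-*ʳ {x} y≈0 = ≈-trans (R.*-congˡ y≈0) (R.zeroʳ x)

≈0-*ˡ : ∀ {x y} → x ≈ᴿ 0ᴿ → x *ᴿ y ≈ᴿ 0ᴿ
≈0-*ˡ {x} {y} x≈0 = ≈-trans (R.*-congʳ x≈0) (R.zeroˡ y)

-- A reciprocal needs a rational bound away from zero, and `x ≉ᴿ 0ᴿ` supplies one only up to double
-- negation.
inverse : ∀ {x} → x ≉ᴿ 0ᴿ → ¬ ¬ ∃ λ y → x *ᴿ y ≈ᴿ 1ᴿ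
inverse {x} x≉0 ¬inv = ≉0⇒signed x≉0 λ
  { (inj₁ x>0) → ¬inv (inverse-of-positive x>0)
  ; (inj₂ x<0) → let (y , -xy≈1) = inverse-of-positive x<0
                 in ¬inv (-ᴿ y , ≈-trans (solve 2 (λ x y → x :* (:- y) := (:- x) :* y) ≈-refl x y) -xy≈1) }

unit≉0 : ∀ {x y} → x *ᴿ y ≈ᴿ 1ᴿ → x ≉ᴿ 0ᴿ
unit≉0 xy≈1 x≈0 = 1≉0 (≈-trans (≈-sym xy≈1) (≈0-*ˡ x≈0))

unitʳ≉0 : ∀ {x y} → x *ᴿ y ≈ᴿ 1ᴿ → y ≉ᴿ 0ᴿ
unitʳ≉0 xy≈1 y≈0 = 1≉0 (≈-trans (≈-sym xy≈1) (≈0-*ʳ y≈0))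

-- Finite sums

sum-≈0 : ∀ {m} {f : Fin m → ℝ} → (∀ i → f i ≈ᴿ 0ᴿ) → sum f ≈ᴿ 0ᴿ
sum-≈0 {zero}  f≈0 = ≈-refl
sum-≈0 {suc m} f≈0 = ≈-trans (R.+-cong (f≈0 zero) (sum-≈0 (f≈0 ∘ suc))) (R.+-identityˡ 0ᴿ)

sum-single : ∀ {m} {f : Fin m → ℝ} i → (∀ j → j ≢ i → f j ≈ᴿ 0ᴿ) → sum f ≈ᴿ f i
sum-single zero    off = ≈-trans (R.+-congˡ (sum-≈0 λ j → off (suc j) λ ())) (R.+-identityʳ _)
sum-single (suc i) off = ≈-trans
  (R.+-cong (off zero λ ()) (sum-single i λ j j≢i → off (suc j) (j≢i ∘ Fin.suc-injective)))
  (R.+-identityˡ _)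

-- Nonnegativity is given as a disjunction, so the induction never has to decide the sign of a real.
0<sum : ∀ {m} {f : Fin m → ℝ} → (∀ i → 0ᴿ <ᴿ f i ⊎ f i ≈ᴿ 0ᴿ) → ∀ i → 0ᴿ <ᴿ f i → 0ᴿ <ᴿ sum f
0<sum {suc m} {f} f≥0 i fi>0 = combine i fi>0 (tail (λ j → f≥0 (suc j)))
  where
  NonNegative : ℝ → Set
  NonNegative x = 0ᴿ <ᴿ x ⊎ x ≈ᴿ 0ᴿ
  nonNegative-+ : ∀ {x y} → NonNegative x → NonNegative y → NonNegative (x +ᴿ y)
  nonNegative-+ (inj₁ x>0) (inj₁ y>0) = inj₁ (0<+ x>0 y>0)
  nonNegative-+ (inj₁ x>0) (inj₂ y≈0) = inj₁ (0<-resp-≈ (≈-sym (≈-trans (R.+-congˡ y≈0) (R.+-identityʳ _))) x>0)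
  nonNegative-+ (inj₂ x≈0) (inj₁ y>0) = inj₁ (0<-resp-≈ (≈-sym (≈-trans (R.+-congʳ x≈0) (R.+-identityˡ _))) y>0)
  nonNegative-+ (inj₂ x≈0) (inj₂ y≈0) = inj₂ (≈-trans (R.+-cong x≈0 y≈0) (R.+-identityʳ _))
  tail : ∀ {k} {g : Fin k → ℝ} → (∀ j → NonNegative (g j)) → NonNegative (sum g)
  tail {zero}  g≥0 = inj₂ ≈-refl
  tail {suc k} g≥0 = nonNegative-+ (g≥0 zero) (tail (g≥0 ∘ suc))
  combine : ∀ i → 0ᴿ <ᴿ f i → NonNegative (sum (f ∘ suc)) → 0ᴿ <ᴿ sum f
  combine zero f0>0 (inj₁ t>0) = 0<+ f0>0 t>0
  combine zero f0>0 (inj₂ t≈0) = 0<-resp-≈ (≈-sym (≈-trans (R.+-congˡ t≈0) (R.+-identityʳ _))) f0>0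
  combine (suc i) fi>0 _ = [ (λ f0>0 → 0<+ f0>0 rest) , (λ f0≈0 →
      0<-resp-≈ (≈-sym (≈-trans (R.+-congʳ f0≈0) (R.+-identityˡ _))) rest) ]′ (f≥0 zero)
    where rest = 0<sum (f≥0 ∘ suc) i fi>0

module FiniteSum {m : ℕ} {E : Set} (F : Fin m ↔ E) (_≟_ : DecidableEquality E) where

  open Inverse F using (to; from; strictlyInverseˡ; strictlyInverseʳ)

  ∑ : (E → ℝ) → ℝ
  ∑ = ∑ᴿ F

  ∑-cong : ∀ {f g} → (∀ x → f x ≈ᴿ g x) → ∑ f ≈ᴿ ∑ g
  ∑-cong f≈g = R.sum-cong-≋ (λ i → f≈g (to i))

  ∑-+ : ∀ f g → ∑ (λ x → f x +ᴿ g x) ≈ᴿ ∑ f +ᴿ ∑ g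
  ∑-+ f g = R.∑-distrib-+ (f ∘ to) (g ∘ to)

  ∑-*ˡ : ∀ a f → ∑ (λ x → a *ᴿ f x) ≈ᴿ a *ᴿ ∑ f
  ∑-*ˡ a f = ≈-sym (R.*-distribˡ-sum a (f ∘ to))

  ∑-sum : ∀ {k} (f : E → Fin k → ℝ) → ∑ (λ x → sum (f x)) ≈ᴿ sum (λ i → ∑ (λ x → f x i))
  ∑-sum f = R.∑-comm (λ j i → f (to j) i)

  ∑-single : ∀ {f} e → (∀ x → x ≢ e → f x ≈ᴿ 0ᴿ) → ∑ f ≈ᴿ f e
  ∑-single {f} e off = ≈-trans
    (sum-single {f = f ∘ to} (from e) λ j j≢e → off (to j) λ toj≡e →
      j≢e (≡.trans (≡.sym (strictlyInverseʳ j)) (cong from toj≡e)))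
    (≈-reflexive (cong f (strictlyInverseˡ e)))

  0<∑ : ∀ {f} → (∀ x → 0ᴿ <ᴿ f x ⊎ f x ≈ᴿ 0ᴿ) → ∀ e → 0ᴿ <ᴿ f e → 0ᴿ <ᴿ ∑ f
  0<∑ {f} f≥0 e fe>0 = 0<sum (λ i → f≥0 (to i)) (from e)
    (subst (λ x → 0ᴿ <ᴿ f x) (≡.sym (strictlyInverseˡ e)) fe>0)

  δ : E → E → ℝ
  δ e x = if ⌊ x ≟ e ⌋ then 1ᴿ else 0ᴿ

  δ-≡ : ∀ {e x} → x ≡ e → δ e x ≈ᴿ 1ᴿ
  δ-≡ {e} {x} x≡e with x ≟ e
  ... | yes _  = ≈-refl
  ... | no x≢e = contradiction x≡e x≢e

  δ-≢ : ∀ {e x} → x ≢ e → δ e x ≈ᴿ 0ᴿ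
  δ-≢ {e} {x} x≢e with x ≟ e
  ... | yes x≡e = contradiction x≡e x≢e
  ... | no _  = ≈-refl

  -- The coefficient function of the formal combination Σᵢ aᵢ·pᵢ.
  formal : ∀ {k} → (Fin k → ℝ) → (Fin k → E) → E → ℝ
  formal a p x = sum (λ i → a i *ᴿ δ (p i) x)

  ∑-formal : ∀ {k} (a : Fin k → ℝ) (p : Fin k → E) (f : E → ℝ) →
             ∑ (λ x → formal a p x *ᴿ f x) ≈ᴿ sum (λ i → a i *ᴿ f (p i))
  ∑-formal a p f = begin
    ∑ (λ x → formal a p x *ᴿ f x)
      ≈⟨ ∑-cong {λ x → formal a p x *ᴿ f x} (λ x → R.*-distribʳ-sum (f x) (λ i → a i *ᴿ δ (p i) x)) ⟩
    ∑ (λ x → sum (λ i → (a i *ᴿ δ (p i) x) *ᴿ f x))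
      ≈⟨ ∑-sum (λ x i → (a i *ᴿ δ (p i) x) *ᴿ f x) ⟩
    sum (λ i → ∑ (λ x → (a i *ᴿ δ (p i) x) *ᴿ f x))
      ≈⟨ R.sum-cong-≋ (λ i → ≈-trans
           (∑-single {λ x → (a i *ᴿ δ (p i) x) *ᴿ f x} (p i) λ x x≢p → ≈0-*ˡ (≈0-*ʳ (δ-≢ x≢p)))
           (R.*-congʳ (≈-trans (R.*-congˡ (δ-≡ refl)) (R.*-identityʳ (a i))))) ⟩
    sum (λ i → a i *ᴿ f (p i)) ∎
    where open SetoidReasoning ℝ-setoid

  formal-at : ∀ {k} (a : Fin k → ℝ) (p : Fin k → E) {x} i → p i ≡ x →
              (∀ j → j ≢ i → p j ≡ x → a j ≈ᴿ 0ᴿ) → formal a p x ≈ᴿ a i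
  formal-at a p {x} i pi≡x off = ≈-trans
    (sum-single i vanish) (≈-trans (R.*-congˡ (δ-≡ (≡.sym pi≡x))) (R.*-identityʳ (a i)))
    where
    vanish : ∀ j → j ≢ i → a j *ᴿ δ (p j) x ≈ᴿ 0ᴿ
    vanish j j≢i with p j ≟ x
    ... | yes pj≡x = ≈0-*ˡ (off j j≢i pj≡x)
    ... | no pj≢x  = ≈0-*ʳ (δ-≢ (pj≢x ∘ ≡.sym))

  formal-off : ∀ {k} (a : Fin k → ℝ) (p : Fin k → E) {x} →
               (∀ j → p j ≡ x → a j ≈ᴿ 0ᴿ) → formal a p x ≈ᴿ 0ᴿ
  formal-off a p {x} off = sum-≈0 vanish
    where
    vanish : ∀ j → a j *ᴿ δ (p j) x ≈ᴿ 0ᴿ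
    vanish j with p j ≟ x
    ... | yes pj≡x = ≈0-*ˡ (off j pj≡x)
    ... | no pj≢x  = ≈0-*ʳ (δ-≢ (pj≢x ∘ ≡.sym))

  -- A function vanishing off the points `p i` is the formal combination of these points with its
  -- own values as coefficients; injectivity keeps a value from being counted twice.
  ∑-supported : ∀ {k} (p : Fin k → E) → (∀ i j → p i ≡ p j → i ≡ j) →
                ∀ {c} → (∀ x → (∀ i → p i ≢ x) → c x ≈ᴿ 0ᴿ) →
                ∀ (f : E → ℝ) → ∑ (λ x → c x *ᴿ f x) ≈ᴿ sum (λ i → c (p i) *ᴿ f (p i))
  ∑-supported p p-injective {c} off f = ≈-trans
    (∑-cong {λ x → c x *ᴿ f x} λ x → R.*-congʳ (c-formal x)) (∑-formal (c ∘ p) p f)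
    where
    c-formal : ∀ x → c x ≈ᴿ formal (c ∘ p) p x
    c-formal x with Fin.any? (λ i → p i ≟ x)
    ... | yes (i , refl) = ≈-sym (formal-at (c ∘ p) p i refl
            λ j j≢i pj≡pi → contradiction (p-injective j i pj≡pi) j≢i)
    ... | no x∉p = ≈-trans (off x λ i pi≡x → x∉p (i , pi≡x))
            (≈-sym (formal-off (c ∘ p) p λ j pj≡x → contradiction (j , pj≡x) x∉p))

-- Vertices and rectangles of the cube

module _ {E : Set} (Z : SignedSet E) where

  ∈supp⁺ : ∀ e → e ∈ (Z ⁺) → e ∈ supp Z
  ∈supp⁺ e = Equivalence.from (T-∨ {(Z ⁺) e}) ∘ inj₁

  ∈supp⁻ : ∀ e → e ∈ (Z ⁻) → e ∈ supp Z
  ∈supp⁻ e = Equivalence.from (T-∨ {(Z ⁺) e}) ∘ inj₂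

  ∈supp⇒± : ∀ e → e ∈ supp Z → e ∈ (Z ⁺) ⊎ e ∈ (Z ⁻)
  ∈supp⇒± e = Equivalence.to (T-∨ {(Z ⁺) e})

infix 4 _≟ᶜ_
_≟ᶜ_ : ∀ {n} → DecidableEquality (C n)
_≟ᶜ_ = Vec.≡-dec Sign._≟_

∃? : ∀ {m} {E : Set} → Fin m ↔ E → {P : Pred E 0ℓ} → Decidable P → Dec (∃ P)
∃? F {P} P? = map′ (λ (i , p) → to i , p) (λ (e , p) → from e , subst P (≡.sym (strictlyInverseˡ e)) p)
                   (Fin.any? (P? ∘ to))
  where open Inverse F

flipAt : ∀ {n} → Fin n → C n → C n
flipAt i v = updateAt v i opposite

lookup-flipAt : ∀ {n} (i : Fin n) v → lookup (flipAt i v) i ≡ opposite (lookup v i)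
lookup-flipAt i v = Vec.lookup∘updateAt i v

lookup-flipAt-≢ : ∀ {n} {i k : Fin n} → k ≢ i → ∀ v → lookup (flipAt i v) k ≡ lookup v k
lookup-flipAt-≢ {i = i} {k} k≢i v = Vec.lookup∘updateAt′ k i k≢i v

flipAt-comm : ∀ {n} {i j : Fin n} → i ≢ j → ∀ v → flipAt i (flipAt j v) ≡ flipAt j (flipAt i v)
flipAt-comm {i = i} {j} i≢j v = Vec.updateAt-commutes i j i≢j v

flipAt-involutive : ∀ {n} (i : Fin n) v → flipAt i (flipAt i v) ≡ v
flipAt-involutive i v = ≡.trans (Vec.updateAt-updateAt i v)
  (Vec.updateAt-id-local i v (Sign.opposite-involutive (lookup v i)))

flipAt-injective : ∀ {n} (i : Fin n) {u v} → flipAt i u ≡ flipAt i v → u ≡ v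
flipAt-injective i {u} {v} eq = ≡.trans (≡.sym (flipAt-involutive i u)) (≡.trans (cong (flipAt i) eq) (flipAt-involutive i v))

v≢flipAt : ∀ {n} {i : Fin n} {u v : C n} → lookup u i ≡ lookup v i → u ≢ flipAt i v
v≢flipAt {i = i} {u} {v} ui≡vi u≡flip = Sign.s≢opposite[s] (lookup v i)
  (≡.trans (≡.sym ui≡vi) (≡.trans (cong (λ w → lookup w i) u≡flip) (lookup-flipAt i v)))

⊕ : ∀ {n} → C n
⊕ = replicate _ Sign.+

⊕-lookup : ∀ {n} (i : Fin n) → lookup ⊕ i ≡ Sign.+
⊕-lookup i = Vec.lookup-replicate i Sign.+

-- Each vertex arises from `⊕` by turning plus signs into minus signs one at a time; the head is
-- turned last, when the tail is already in place.
cube-induction : ∀ {n} (P : C n → Set) → P ⊕ →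
                 (∀ v i → lookup v i ≡ Sign.+ → P v → P (flipAt i v)) → ∀ v → P v
cube-induction {zero}  P base step [] = base
cube-induction {suc n} P base step (s ∷ v) = extend s
  where
  plus : P (Sign.+ ∷ v)
  plus = cube-induction (P ∘ (Sign.+ ∷_)) base (λ u i → step (Sign.+ ∷ u) (suc i)) v
  extend : ∀ s → P (s ∷ v)
  extend Sign.+ = plus
  extend Sign.- = step (Sign.+ ∷ v) zero refl plus

≢⇒differ : ∀ {n} {p q : C n} → p ≢ q → ∃ λ k → lookup p k ≢ lookup q k
≢⇒differ {zero} {[]} {[]} p≢q = contradiction refl p≢q
≢⇒differ {suc n} {s ∷ p} {t ∷ q} p≢q with s Sign.≟ t
... | no s≢t = zero , s≢t
... | yes refl with ≢⇒differ {p = p} {q} (p≢q ∘ cong (s ∷_))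
...   | k , differ = suc k , differ

differing : Sign → Sign → Bool
differing s t = not ⌊ s Sign.≟ t ⌋

difference : ∀ {n} → C n → C n → Subset n
difference = zipWith differing

differing-≢ : ∀ {s t} → s ≢ t → differing s t ≡ true
differing-≢ {s} {t} s≢t with s Sign.≟ t
... | yes s≡t = contradiction s≡t s≢t
... | no  _   = refl

differing-≡ : ∀ {s t} → s ≡ t → differing s t ≡ false
differing-≡ {s} {t} s≡t with s Sign.≟ t
... | yes _  = refl
... | no s≢t = contradiction s≡t s≢t

if-differing : ∀ s t → (if differing s t then opposite s else s) ≡ t
if-differing Sign.+ Sign.+ = refl
if-differing Sign.+ Sign.- = refl
if-differing Sign.- Sign.+ = refl
if-differing Sign.- Sign.- = refl

-[difference] : ∀ {n} (p q : C n) → -[ difference p q ] p ≡ q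
-[difference] []      []      = refl
-[difference] (s ∷ p) (t ∷ q) = cong₂ _∷_ (if-differing s t) (-[difference] p q)

-[∅] : ∀ {n} (v : C n) → -[ Subset.⊥ ] v ≡ v
-[∅] []      = refl
-[∅] (s ∷ v) = cong (s ∷_) (-[∅] v)

-[⁅_⁆] : ∀ {n} (i : Fin n) v → -[ ⁅ i ⁆ ] v ≡ flipAt i v
-[⁅ zero  ⁆] (s ∷ v) = cong (opposite s ∷_) (-[∅] v)
-[⁅ suc i ⁆] (s ∷ v) = cong (s ∷_) (-[⁅ i ⁆] v)

-[_∪⁅_⁆] : ∀ {n} A (i : Fin n) v → lookup A i ≡ false → -[ A Subset.∪ ⁅ i ⁆ ] v ≡ flipAt i (-[ A ] v)
-[ false ∷ A ∪⁅ zero ⁆]  (s ∷ v) _   = cong (λ B → opposite s ∷ -[ B ] v) (Subset.∪-identityʳ A)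
-[ a ∷ A     ∪⁅ suc i ⁆] (s ∷ v) i∉A = cong₂ _∷_ (cong (if_then opposite s else s) (∨-identityʳ a)) (-[ A ∪⁅ i ⁆] v i∉A)

-- The signed rectangle with `v = p`, `A` the set of coordinates where `p` and `q` differ, and `B`
-- the singleton of `i`. Then `-[ A ] p` is `q`, and agreement at `i` makes `A` and `B` disjoint.
module Rectangle {n : ℕ} (p q : C n) (i : Fin n) (p≢q : p ≢ q) (pᵢ≡qᵢ : lookup p i ≡ lookup q i) where

  corner : Fin 4 → C n
  corner zero                   = p
  corner (suc zero)             = q
  corner (suc (suc zero))       = flipAt i p
  corner (suc (suc (suc zero))) = flipAt i q

  corner-injective : ∀ j k → corner j ≡ corner k → j ≡ k
  corner-injective zero zero _ = refl
  corner-injective zero (suc zero) e = contradiction e p≢q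
  corner-injective zero (suc (suc zero)) e = contradiction e (v≢flipAt refl)
  corner-injective zero (suc (suc (suc zero))) e = contradiction e (v≢flipAt pᵢ≡qᵢ)
  corner-injective (suc zero) zero e = contradiction (≡.sym e) p≢q
  corner-injective (suc zero) (suc zero) _ = refl
  corner-injective (suc zero) (suc (suc zero)) e = contradiction e (v≢flipAt (≡.sym pᵢ≡qᵢ))
  corner-injective (suc zero) (suc (suc (suc zero))) e = contradiction e (v≢flipAt refl)
  corner-injective (suc (suc zero)) zero e = contradiction (≡.sym e) (v≢flipAt refl)
  corner-injective (suc (suc zero)) (suc zero) e = contradiction (≡.sym e) (v≢flipAt (≡.sym pᵢ≡qᵢ))
  corner-injective (suc (suc zero)) (suc (suc zero)) _ = refl
  corner-injective (suc (suc zero)) (suc (suc (suc zero))) e = contradiction (flipAt-injective i e) p≢q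
  corner-injective (suc (suc (suc zero))) zero e = contradiction (≡.sym e) (v≢flipAt pᵢ≡qᵢ)
  corner-injective (suc (suc (suc zero))) (suc zero) e = contradiction (≡.sym e) (v≢flipAt refl)
  corner-injective (suc (suc (suc zero))) (suc (suc zero)) e = contradiction (≡.sym (flipAt-injective i e)) p≢q
  corner-injective (suc (suc (suc zero))) (suc (suc (suc zero))) _ = refl

  pair : C n → C n → 𝒫 (C n)
  pair a b u = ⌊ u ≟ᶜ a ⌋ ∨ ⌊ u ≟ᶜ b ⌋

  ∈pair : ∀ a b u → u ∈ pair a b ⇔ (u ≡ a ⊎ u ≡ b)
  ∈pair a b u = mk⇔
    ([ inj₁ ∘ toWitness , inj₂ ∘ toWitness ]′ ∘ Equivalence.to (T-∨ {⌊ u ≟ᶜ a ⌋}))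
    (Equivalence.from (T-∨ {⌊ u ≟ᶜ a ⌋}) ∘ [ inj₁ ∘ fromWitness , inj₂ ∘ fromWitness ]′)

  rectangle : SignedSet (C n)
  rectangle = record
    { _⁺ = pair p (flipAt i q)
    ; _⁻ = pair q (flipAt i p)
    ; disjoint = λ u (u∈⁺ , u∈⁻) → disjoint (Equivalence.to (∈pair p (flipAt i q) u) u∈⁺) (Equivalence.to (∈pair q (flipAt i p) u) u∈⁻) }
    where
    absurd : ∀ {u} j k → u ≡ corner j → u ≡ corner k → j ≡ k
    absurd j k u≡j u≡k = corner-injective j k (≡.trans (≡.sym u≡j) u≡k)
    disjoint : ∀ {u} → u ≡ p ⊎ u ≡ flipAt i q → ¬ (u ≡ q ⊎ u ≡ flipAt i p)
    disjoint (inj₁ a) (inj₁ b) with () ← absurd zero (suc zero) a b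
    disjoint (inj₁ a) (inj₂ b) with () ← absurd zero (suc (suc zero)) a b
    disjoint (inj₂ a) (inj₁ b) with () ← absurd (suc (suc (suc zero))) (suc zero) a b
    disjoint (inj₂ a) (inj₂ b) with () ← absurd (suc (suc (suc zero))) (suc (suc zero)) a b

  corner∈ : ∀ j → corner j ∈ supp rectangle
  corner∈ zero                   = ∈supp⁺ rectangle p (Equivalence.from (∈pair p (flipAt i q) p) (inj₁ refl))
  corner∈ (suc zero)             = ∈supp⁻ rectangle q (Equivalence.from (∈pair q (flipAt i p) q) (inj₁ refl))
  corner∈ (suc (suc zero))       = ∈supp⁻ rectangle (flipAt i p) (Equivalence.from (∈pair q (flipAt i p) (flipAt i p)) (inj₂ refl))
  corner∈ (suc (suc (suc zero))) = ∈supp⁺ rectangle (flipAt i q) (Equivalence.from (∈pair p (flipAt i q) (flipAt i q)) (inj₂ refl))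

  ∈⇒corner : ∀ u → u ∈ supp rectangle → ∃ λ j → corner j ≡ u
  ∈⇒corner u u∈ with ∈supp⇒± rectangle u u∈
  ... | inj₁ u∈⁺ = [ (λ e → zero , ≡.sym e) , (λ e → suc (suc (suc zero)) , ≡.sym e) ]′
                     (Equivalence.to (∈pair p (flipAt i q) u) u∈⁺)
  ... | inj₂ u∈⁻ = [ (λ e → suc zero , ≡.sym e) , (λ e → suc (suc zero) , ≡.sym e) ]′
                     (Equivalence.to (∈pair q (flipAt i p) u) u∈⁻)

  i∉difference : lookup (difference p q) i ≡ false
  i∉difference = ≡.trans (Vec.lookup-zipWith differing i p q) (differing-≡ pᵢ≡qᵢ)

  difference-nonempty : Subset.Nonempty (difference p q)
  difference-nonempty with ≢⇒differ p≢q
  ... | k , pk≢qk = k , Vec.lookup⇒[]= k _ (≡.trans (Vec.lookup-zipWith differing k p q) (differing-≢ pk≢qk))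

  difference∩⁅i⁆-empty : Subset.Empty (difference p q Subset.∩ ⁅ i ⁆)
  difference∩⁅i⁆-empty (x , x∈) with Subset.x∈p∩q⁻ (difference p q) ⁅ i ⁆ x∈
  ... | x∈d , x∈i with Subset.x∈⁅y⁆⇒x≡y i x∈i
  ... | refl with () ← ≡.trans (≡.sym (Vec.[]=⇒lookup x∈d)) i∉difference

  isRectangle : IsRectangle p (difference p q) ⁅ i ⁆ rectangle
  isRectangle =
      (λ u → subst (λ z → u ∈ (rectangle ⁺) ⇔ (u ≡ p ⊎ u ≡ z)) (≡.sym both) (∈pair p (flipAt i q) u))
    , (λ u → subst₂ (λ y z → u ∈ (rectangle ⁻) ⇔ (u ≡ y ⊎ u ≡ z))
               (≡.sym (-[difference] p q)) (≡.sym (-[⁅ i ⁆] p)) (∈pair q (flipAt i p) u))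
    where
    both : -[ difference p q Subset.∪ ⁅ i ⁆ ] p ≡ flipAt i q
    both = ≡.trans (-[ difference p q ∪⁅ i ⁆] p i∉difference) (cong (flipAt i) (-[difference] p q))

module _ {E : Set} where

  -- The agreeing and the opposing element demanded by `⟂` would both have to be `e`, against the
  -- disjointness of the two halves of a signed set. This turns orthogonality into the matroid fact
  -- that a circuit and a cocircuit never meet in a single element.
  meets-once⇒not-⟂ : ∀ {X Y : SignedSet E} {e} → e ∈ supp X → e ∈ supp Y →
                     (∀ f → f ∈ supp X → f ∈ supp Y → f ≡ e) → ¬ X ⟂ Y
  meets-once⇒not-⟂ {e = e} e∈X e∈Y once (inj₁ apart) = apart e (e∈X , e∈Y)
  meets-once⇒not-⟂ {X} {Y} {e} e∈X e∈Y once (inj₂ ((g , same) , (h , opp))) = clash (at-e-same same) (at-e-opp opp)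
    where
    Same Opposite : E → Set
    Same f     = (f ∈ (X ⁺) × f ∈ (Y ⁺)) ⊎ (f ∈ (X ⁻) × f ∈ (Y ⁻))
    Opposite f = (f ∈ (X ⁺) × f ∈ (Y ⁻)) ⊎ (f ∈ (X ⁻) × f ∈ (Y ⁺))
    at-e-same : Same g → Same e
    at-e-same s@(inj₁ (a , b)) = subst Same (once g (∈supp⁺ X g a) (∈supp⁺ Y g b)) s
    at-e-same s@(inj₂ (a , b)) = subst Same (once g (∈supp⁻ X g a) (∈supp⁻ Y g b)) s
    at-e-opp : Opposite h → Opposite e
    at-e-opp s@(inj₁ (a , b)) = subst Opposite (once h (∈supp⁺ X h a) (∈supp⁻ Y h b)) s
    at-e-opp s@(inj₂ (a , b)) = subst Opposite (once h (∈supp⁻ X h a) (∈supp⁺ Y h b)) s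
    clash : Same e → ¬ Opposite e
    clash (inj₁ (x⁺ , y⁺)) (inj₁ (_ , y⁻)) = SignedSet.disjoint Y e (y⁺ , y⁻)
    clash (inj₁ (x⁺ , y⁺)) (inj₂ (x⁻ , _)) = SignedSet.disjoint X e (x⁺ , x⁻)
    clash (inj₂ (x⁻ , y⁻)) (inj₁ (x⁺ , _)) = SignedSet.disjoint X e (x⁺ , x⁻)
    clash (inj₂ (x⁻ , y⁻)) (inj₂ (_ , y⁺)) = SignedSet.disjoint Y e (y⁺ , y⁻)

-- Rectangles as circuits of the real cube

+≈0 : ∀ {x y} → x ≈ᴿ 0ᴿ → y ≈ᴿ 0ᴿ → x +ᴿ y ≈ᴿ 0ᴿ
+≈0 x≈0 y≈0 = ≈-trans (R.+-cong x≈0 y≈0) (R.+-identityʳ 0ᴿ)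

-≈0 : ∀ {x} → x ≈ᴿ 0ᴿ → -ᴿ x ≈ᴿ 0ᴿ
-≈0 x≈0 = ≈-trans (R.-‿cong x≈0) R.-0#≈0#

≈⇒-≈0 : ∀ {x y} → x ≈ᴿ y → x +ᴿ -ᴿ y ≈ᴿ 0ᴿ
≈⇒-≈0 {x} {y} x≈y = ≈-trans (R.+-congʳ x≈y) (R.-‿inverseʳ y)

-≈0⇒≈ : ∀ {x y} → x +ᴿ -ᴿ y ≈ᴿ 0ᴿ → x ≈ᴿ y
-≈0⇒≈ {x} {y} d≈0 = ≈-trans (solve 2 (λ x y → x := (x :- y) :+ y) ≈-refl x y)
  (≈-trans (R.+-congʳ d≈0) (R.+-identityˡ y))

2ᴿ : ℝ
2ᴿ = 1ᴿ +ᴿ 1ᴿ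

0<2 : 0ᴿ <ᴿ 2ᴿ
0<2 = 0<+ 0<1 0<1

2≉0 : 2ᴿ ≉ᴿ 0ᴿ
2≉0 = 0<⇒≉0 0<2

⟦opposite⟧ : ∀ s → ⟦ opposite s ⟧ ≈ᴿ -ᴿ ⟦ s ⟧
⟦opposite⟧ Sign.+ = ≈-refl
⟦opposite⟧ Sign.- = ≈-sym (R.-‿involutive 1ᴿ)

⟦*⟧ : ∀ s t → ⟦ s Sign.* t ⟧ ≈ᴿ ⟦ s ⟧ *ᴿ ⟦ t ⟧
⟦*⟧ Sign.+ t = ≈-sym (R.*-identityˡ ⟦ t ⟧)
⟦*⟧ Sign.- Sign.+ = ≈-sym (R.*-identityʳ (-ᴿ 1ᴿ))
⟦*⟧ Sign.- Sign.- = solve 0 (con 1ℚ := (:- con 1ℚ) :* (:- con 1ℚ)) ≈-refl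

⟦⟧≉0 : ∀ s → ⟦ s ⟧ ≉ᴿ 0ᴿ
⟦⟧≉0 Sign.+ = 1≉0
⟦⟧≉0 Sign.- = -≉0 1≉0

≢⇒≡opposite : ∀ {s t : Sign} → s ≢ t → t ≡ opposite s
≢⇒≡opposite {Sign.+} {Sign.+} s≢t = contradiction refl s≢t
≢⇒≡opposite {Sign.+} {Sign.-} s≢t = refl
≢⇒≡opposite {Sign.-} {Sign.+} s≢t = refl
≢⇒≡opposite {Sign.-} {Sign.-} s≢t = contradiction refl s≢t

module CubeSum {n : ℕ} = FiniteSum (enumC n) _≟ᶜ_
open CubeSum

AffineDependency : ∀ {n} → (C n → ℝ) → Set
AffineDependency {n} c = ∑ c ≈ᴿ 0ᴿ × (∀ k → ∑ (λ v → c v *ᴿ ⟦ lookup v k ⟧) ≈ᴿ 0ᴿ)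

SignsOf : ∀ {n} → (C n → ℝ) → SignedSet (C n) → Set
SignsOf c X = (∀ e → e ∈ (X ⁺) ⇔ 0ᴿ <ᴿ c e) × (∀ e → e ∈ (X ⁻) ⇔ c e <ᴿ 0ᴿ)

module _ {n : ℕ} {c : C n → ℝ} {X : SignedSet (C n)} (signs : SignsOf c X) where

  ∉supp⇒≈0 : ∀ {e} → ¬ e ∈ supp X → c e ≈ᴿ 0ᴿ
  ∉supp⇒≈0 {e} e∉X = ≮0≯0⇒≈0 (e∉X ∘ ∈supp⁺ X e ∘ Equivalence.from (proj₁ signs e))
                              (e∉X ∘ ∈supp⁻ X e ∘ Equivalence.from (proj₂ signs e))

  ∈supp⇒≉0 : ∀ {e} → e ∈ supp X → c e ≉ᴿ 0ᴿ
  ∈supp⇒≉0 {e} e∈X = [ 0<⇒≉0 ∘ Equivalence.to (proj₁ signs e) , <0⇒≉0 ∘ Equivalence.to (proj₂ signs e) ]′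
                       (∈supp⇒± X e e∈X)

∑-*1 : ∀ {n} (c : C n → ℝ) → ∑ (λ v → c v *ᴿ 1ᴿ) ≈ᴿ ∑ c
∑-*1 c = ∑-cong {f = λ v → c v *ᴿ 1ᴿ} λ v → R.*-identityʳ (c v)

module RectangleCircuit {n : ℕ} (p q : C n) (i : Fin n) (p≢q : p ≢ q) (pᵢ≡qᵢ : lookup p i ≡ lookup q i) where

  open Rectangle p q i p≢q pᵢ≡qᵢ

  weight : Fin 4 → ℝ
  weight zero                   = 1ᴿ
  weight (suc zero)             = -ᴿ 1ᴿ
  weight (suc (suc zero))       = -ᴿ 1ᴿ
  weight (suc (suc (suc zero))) = 1ᴿ

  weight≉0 : ∀ j → weight j ≉ᴿ 0ᴿ
  weight≉0 zero                   = 1≉0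
  weight≉0 (suc zero)             = -≉0 1≉0
  weight≉0 (suc (suc zero))       = -≉0 1≉0
  weight≉0 (suc (suc (suc zero))) = 1≉0

  coefficient : C n → ℝ
  coefficient = formal weight corner

  coefficient-corner : ∀ j → coefficient (corner j) ≈ᴿ weight j
  coefficient-corner j = formal-at weight corner j refl
    λ k k≢j e → contradiction (corner-injective k j e) k≢j

  -- The alternating sum over the corners vanishes because flipping `i` adds the same increment `x`
  -- at `p` and at `q`. The increment is zero for constants and for coordinates other than `i`, and
  -- minus twice the common value for coordinate `i`.
  ∑-coefficient : ∀ {f : C n → ℝ} {x} → f (flipAt i p) ≈ᴿ f p +ᴿ x → f (flipAt i q) ≈ᴿ f q +ᴿ x →
                  ∑ (λ v → coefficient v *ᴿ f v) ≈ᴿ 0ᴿ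
  ∑-coefficient {f} {x} fp fq = begin
    ∑ (λ v → coefficient v *ᴿ f v)
      ≈⟨ ∑-formal weight corner f ⟩
    1ᴿ *ᴿ f p +ᴿ (-ᴿ 1ᴿ *ᴿ f q +ᴿ (-ᴿ 1ᴿ *ᴿ f (flipAt i p) +ᴿ (1ᴿ *ᴿ f (flipAt i q) +ᴿ 0ᴿ)))
      ≈⟨ R.+-congˡ (R.+-congˡ (R.+-cong (R.*-congˡ fp) (R.+-congʳ (R.*-congˡ fq)))) ⟩
    1ᴿ *ᴿ f p +ᴿ (-ᴿ 1ᴿ *ᴿ f q +ᴿ (-ᴿ 1ᴿ *ᴿ (f p +ᴿ x) +ᴿ (1ᴿ *ᴿ (f q +ᴿ x) +ᴿ 0ᴿ)))
      ≈⟨ solve 3 (λ a b x → con 1ℚ :* a :+ ((:- con 1ℚ) :* b :+ ((:- con 1ℚ) :* (a :+ x) :+ (con 1ℚ :* (b :+ x) :+ con 0ℚ)))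
                            := con 0ℚ) ≈-refl (f p) (f q) x ⟩
    0ᴿ ∎
    where
    open SetoidReasoning ℝ-setoid

  coefficient-dependency : AffineDependency coefficient
  coefficient-dependency = ≈-trans (≈-sym (∑-*1 coefficient)) (∑-coefficient {λ _ → 1ᴿ} {0ᴿ} step step) , coordinate
    where
    step : 1ᴿ ≈ᴿ 1ᴿ +ᴿ 0ᴿ
    step = ≈-sym (R.+-identityʳ 1ᴿ)
    coordinate : ∀ k → ∑ (λ v → coefficient v *ᴿ ⟦ lookup v k ⟧) ≈ᴿ 0ᴿ
    coordinate k with k Fin.≟ i
    ... | no k≢i = ∑-coefficient {λ v → ⟦ lookup v k ⟧} {0ᴿ} (unmoved p) (unmoved q)
      where
      unmoved : ∀ v → ⟦ lookup (flipAt i v) k ⟧ ≈ᴿ ⟦ lookup v k ⟧ +ᴿ 0ᴿ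
      unmoved v = ≈-trans (≈-reflexive (cong ⟦_⟧ (lookup-flipAt-≢ k≢i v))) (≈-sym (R.+-identityʳ _))
    ... | yes refl = ∑-coefficient {λ v → ⟦ lookup v k ⟧} {x = -ᴿ 2ᴿ *ᴿ ⟦ lookup p k ⟧}
            (moved p refl) (moved q pᵢ≡qᵢ)
      where
      moved : ∀ v → lookup p k ≡ lookup v k → ⟦ lookup (flipAt k v) k ⟧ ≈ᴿ ⟦ lookup v k ⟧ +ᴿ -ᴿ 2ᴿ *ᴿ ⟦ lookup p k ⟧
      moved v pₖ≡vₖ = begin
        ⟦ lookup (flipAt k v) k ⟧  ≈⟨ ≈-reflexive (cong ⟦_⟧ (lookup-flipAt k v)) ⟩
        ⟦ opposite (lookup v k) ⟧  ≈⟨ ⟦opposite⟧ (lookup v k) ⟩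
        -ᴿ ⟦ lookup v k ⟧          ≈⟨ solve 1 (λ x → :- x := x :+ (:- (con 1ℚ :+ con 1ℚ)) :* x) ≈-refl ⟦ lookup v k ⟧ ⟩
        ⟦ lookup v k ⟧ +ᴿ -ᴿ 2ᴿ *ᴿ ⟦ lookup v k ⟧  ≈⟨ ≈-reflexive (cong (λ s → ⟦ lookup v k ⟧ +ᴿ -ᴿ 2ᴿ *ᴿ ⟦ s ⟧) (≡.sym pₖ≡vₖ)) ⟩
        ⟦ lookup v k ⟧ +ᴿ -ᴿ 2ᴿ *ᴿ ⟦ lookup p k ⟧  ∎
        where open SetoidReasoning ℝ-setoid

  0≮-1 : ¬ 0ᴿ <ᴿ -ᴿ 1ᴿ
  0≮-1 0<-1 = 0<∧<0⇒⊥ 0<-1 (0<-⇒<0 (0<-resp-≈ (≈-sym (R.-‿involutive 1ᴿ)) 0<1))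

  -1<0 : -ᴿ 1ᴿ <ᴿ 0ᴿ
  -1<0 = 0<-⇒<0 (0<-resp-≈ (≈-sym (R.-‿involutive 1ᴿ)) 0<1)

  <0-resp-≈ : ∀ {x y} → x ≈ᴿ y → x <ᴿ 0ᴿ → y <ᴿ 0ᴿ
  <0-resp-≈ x≈y x<0 = 0<-⇒<0 (0<-resp-≈ (R.-‿cong x≈y) (<0⇒0<- x<0))

  coefficient-signs : SignsOf coefficient rectangle
  coefficient-signs = (λ e → mk⇔ (positive e) (positive⁻ e)) , (λ e → mk⇔ (negative e) (negative⁻ e))
    where
    open Equivalence
    positive : ∀ e → e ∈ (rectangle ⁺) → 0ᴿ <ᴿ coefficient e
    positive e e∈ with to (∈pair p (flipAt i q) e) e∈
    ... | inj₁ refl = 0<-resp-≈ (≈-sym (coefficient-corner zero)) 0<1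
    ... | inj₂ refl = 0<-resp-≈ (≈-sym (coefficient-corner (suc (suc (suc zero))))) 0<1
    negative : ∀ e → e ∈ (rectangle ⁻) → coefficient e <ᴿ 0ᴿ
    negative e e∈ with to (∈pair q (flipAt i p) e) e∈
    ... | inj₁ refl = <0-resp-≈ (≈-sym (coefficient-corner (suc zero))) -1<0
    ... | inj₂ refl = <0-resp-≈ (≈-sym (coefficient-corner (suc (suc zero)))) -1<0
    off : ∀ e → ¬ (∃ λ j → corner j ≡ e) → coefficient e ≈ᴿ 0ᴿ
    off e e∉ = formal-off weight corner λ j cj≡e → contradiction (j , cj≡e) e∉
    positive⁻ : ∀ e → 0ᴿ <ᴿ coefficient e → e ∈ (rectangle ⁺)
    positive⁻ e e>0 with Fin.any? (λ j → corner j ≟ᶜ e)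
    ... | no e∉ = contradiction (off e e∉) (0<⇒≉0 e>0)
    ... | yes (zero , refl) = from (∈pair p (flipAt i q) e) (inj₁ refl)
    ... | yes (suc zero , refl) = contradiction (0<-resp-≈ (coefficient-corner (suc zero)) e>0) 0≮-1
    ... | yes (suc (suc zero) , refl) = contradiction (0<-resp-≈ (coefficient-corner (suc (suc zero))) e>0) 0≮-1
    ... | yes (suc (suc (suc zero)) , refl) = from (∈pair p (flipAt i q) e) (inj₂ refl)
    negative⁻ : ∀ e → coefficient e <ᴿ 0ᴿ → e ∈ (rectangle ⁻)
    negative⁻ e e<0 with Fin.any? (λ j → corner j ≟ᶜ e)
    ... | no e∉ = contradiction (off e e∉) (<0⇒≉0 e<0)
    ... | yes (zero , refl) = contradiction (<0-resp-≈ (coefficient-corner zero) e<0) (0<∧<0⇒⊥ 0<1)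
    ... | yes (suc zero , refl) = from (∈pair q (flipAt i p) e) (inj₁ refl)
    ... | yes (suc (suc zero) , refl) = from (∈pair q (flipAt i p) e) (inj₂ refl)
    ... | yes (suc (suc (suc zero)) , refl) = contradiction (<0-resp-≈ (coefficient-corner (suc (suc (suc zero)))) e<0) (0<∧<0⇒⊥ 0<1)

  module _ {c : C n → ℝ} (dependency : AffineDependency c)
           (off : ∀ v → (∀ j → corner j ≢ v) → c v ≈ᴿ 0ᴿ) where

    private
      a b d e : ℝ
      a = c p
      b = c q
      d = c (flipAt i p)
      e = c (flipAt i q)

    ∑-corners : ∀ (f : C n → ℝ) → ∑ (λ v → c v *ᴿ f v) ≈ᴿ 0ᴿ →
                a *ᴿ f p +ᴿ (b *ᴿ f q +ᴿ (d *ᴿ f (flipAt i p) +ᴿ (e *ᴿ f (flipAt i q) +ᴿ 0ᴿ))) ≈ᴿ 0ᴿ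
    ∑-corners f ∑≈0 = ≈-trans (≈-sym (∑-supported corner corner-injective off f)) ∑≈0

    k : Fin n
    k = proj₁ (≢⇒differ p≢q)

    pₖ≢qₖ : lookup p k ≢ lookup q k
    pₖ≢qₖ = proj₂ (≢⇒differ p≢q)

    k≢i : k ≢ i
    k≢i k≡i = pₖ≢qₖ (subst (λ l → lookup p l ≡ lookup q l) (≡.sym k≡i) pᵢ≡qᵢ)

    open SetoidReasoning ℝ-setoid

    total : a +ᴿ (b +ᴿ (d +ᴿ e)) ≈ᴿ 0ᴿ
    total = ≈-trans
      (solve 4 (λ a b d e → a :+ (b :+ (d :+ e)) :=
         a :* con 1ℚ :+ (b :* con 1ℚ :+ (d :* con 1ℚ :+ (e :* con 1ℚ :+ con 0ℚ)))) ≈-refl a b d e)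
      (∑-corners (λ _ → 1ᴿ) (≈-trans (∑-*1 c) (proj₁ dependency)))

    along-i : (a +ᴿ b) +ᴿ -ᴿ (d +ᴿ e) ≈ᴿ 0ᴿ
    along-i = *-cancelˡ-≈0 (⟦⟧≉0 (lookup p i)) (begin
      x *ᴿ ((a +ᴿ b) +ᴿ -ᴿ (d +ᴿ e))
        ≈⟨ solve 5 (λ a b d e x → x :* ((a :+ b) :- (d :+ e)) :=
             a :* x :+ (b :* x :+ (d :* (:- x) :+ (e :* (:- x) :+ con 0ℚ)))) ≈-refl a b d e x ⟩
      a *ᴿ x +ᴿ (b *ᴿ x +ᴿ (d *ᴿ -ᴿ x +ᴿ (e *ᴿ -ᴿ x +ᴿ 0ᴿ)))
        ≈⟨ R.+-congˡ (R.+-cong (R.*-congˡ (≈-reflexive (cong ⟦_⟧ pᵢ≡qᵢ)))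
             (R.+-cong (R.*-congˡ (≈-sym (moved p refl))) (R.+-congʳ (R.*-congˡ (≈-sym (moved q pᵢ≡qᵢ)))))) ⟩
      a *ᴿ f p +ᴿ (b *ᴿ f q +ᴿ (d *ᴿ f (flipAt i p) +ᴿ (e *ᴿ f (flipAt i q) +ᴿ 0ᴿ)))
        ≈⟨ ∑-corners f (proj₂ dependency i) ⟩
      0ᴿ ∎)
      where
      f : C n → ℝ
      f v = ⟦ lookup v i ⟧
      x = f p
      moved : ∀ v → lookup p i ≡ lookup v i → f (flipAt i v) ≈ᴿ -ᴿ x
      moved v pᵢ≡vᵢ = ≈-trans (≈-reflexive (cong ⟦_⟧ (≡.trans (lookup-flipAt i v) (cong opposite (≡.sym pᵢ≡vᵢ)))))
                              (⟦opposite⟧ (lookup p i))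

    along-k : (a +ᴿ d) +ᴿ -ᴿ (b +ᴿ e) ≈ᴿ 0ᴿ
    along-k = *-cancelˡ-≈0 (⟦⟧≉0 (lookup p k)) (begin
      x *ᴿ ((a +ᴿ d) +ᴿ -ᴿ (b +ᴿ e))
        ≈⟨ solve 5 (λ a b d e x → x :* ((a :+ d) :- (b :+ e)) :=
             a :* x :+ (b :* (:- x) :+ (d :* x :+ (e :* (:- x) :+ con 0ℚ)))) ≈-refl a b d e x ⟩
      a *ᴿ x +ᴿ (b *ᴿ -ᴿ x +ᴿ (d *ᴿ x +ᴿ (e *ᴿ -ᴿ x +ᴿ 0ᴿ)))
        ≈⟨ R.+-congˡ (R.+-cong (R.*-congˡ (≈-sym fq))
             (R.+-cong (R.*-congˡ (≈-sym (unmoved p))) (R.+-congʳ (R.*-congˡ (≈-sym (≈-trans (unmoved q) fq)))))) ⟩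
      a *ᴿ f p +ᴿ (b *ᴿ f q +ᴿ (d *ᴿ f (flipAt i p) +ᴿ (e *ᴿ f (flipAt i q) +ᴿ 0ᴿ)))
        ≈⟨ ∑-corners f (proj₂ dependency k) ⟩
      0ᴿ ∎)
      where
      f : C n → ℝ
      f v = ⟦ lookup v k ⟧
      x = f p
      unmoved : ∀ v → f (flipAt i v) ≈ᴿ f v
      unmoved v = ≈-reflexive (cong ⟦_⟧ (lookup-flipAt-≢ k≢i v))
      fq : f q ≈ᴿ -ᴿ x
      fq = ≈-trans (≈-reflexive (cong ⟦_⟧ (≢⇒≡opposite pₖ≢qₖ))) (⟦opposite⟧ (lookup p k))

    -- The total, coordinate `i` and coordinate `k` give three equations in the four corner values:
    -- `i` separates `p` and `q` from their flips, `k` separates `p` and its flip from `q` and its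
    -- flip. Adding two of them at a time gives twice the desired equation, hence the cancellation
    -- of `2ᴿ`.
    proportional : ∀ j → c (corner j) ≈ᴿ weight j *ᴿ a
    proportional zero = ≈-sym (R.*-identityˡ a)
    proportional (suc zero) = -≈0⇒≈ (*-cancelˡ-≈0 2≉0 (≈-trans
      (solve 4 (λ a b d e → (con 1ℚ :+ con 1ℚ) :* (b :- (:- con 1ℚ) :* a) :=
         (a :+ (b :+ (d :+ e))) :+ ((a :+ b) :- (d :+ e))) ≈-refl a b d e)
      (+≈0 total along-i)))
    proportional (suc (suc zero)) = -≈0⇒≈ (*-cancelˡ-≈0 2≉0 (≈-trans
      (solve 4 (λ a b d e → (con 1ℚ :+ con 1ℚ) :* (d :- (:- con 1ℚ) :* a) :=
         (a :+ (b :+ (d :+ e))) :+ ((a :+ d) :- (b :+ e))) ≈-refl a b d e)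
      (+≈0 total along-k)))
    proportional (suc (suc (suc zero))) = -≈0⇒≈ (*-cancelˡ-≈0 2≉0 (≈-trans
      (solve 4 (λ a b d e → (con 1ℚ :+ con 1ℚ) :* (e :- con 1ℚ :* a) :=
         :- (((a :+ b) :- (d :+ e)) :+ ((a :+ d) :- (b :+ e)))) ≈-refl a b d e)
      (-≈0 (+≈0 along-i along-k))))

  rectangle∈𝐐 : 𝐐 n rectangle
  rectangle∈𝐐 = (coefficient , proj₁ coefficient-dependency , proj₂ coefficient-dependency , coefficient-signs)
    , (p , corner∈ zero) , minimal
    where
    minimal : ∀ Y → AffineVectors (enumC n) (λ v k → ⟦ lookup v k ⟧) Y → Nonempty Y →
              supp Y ⊆ supp rectangle → supp rectangle ⊆ supp Y
    -- If `Y` misses the corner `u`, proportionality makes the dependency vanish at every corner, in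
    -- particular at the element `y` of its support.
    minimal Y (c , ∑c≈0 , ∑cv≈0 , signs) (y , y∈Y) Y⊆ u u∈ = decidable-stable (T? _) λ u∉Y →
      let (j , cj≡u) = ∈⇒corner u u∈
          (l , cl≡y) = ∈⇒corner y (Y⊆ y y∈Y)
          a≈0 = *-cancelˡ-≈0 (weight≉0 j) (≈-trans (≈-sym (proportional′ j))
                  (≈-trans (≈-reflexive (cong c cj≡u)) (∉supp⇒≈0 {X = Y} signs u∉Y)))
      in ∈supp⇒≉0 {X = Y} signs y∈Y (≈-trans (≈-reflexive (cong c (≡.sym cl≡y))) (≈-trans (proportional′ l) (≈0-*ʳ a≈0)))
      where
      proportional′ : ∀ j → c (corner j) ≈ᴿ weight j *ᴿ c p
      proportional′ = proportional (∑c≈0 , ∑cv≈0) λ v v∉ → ∉supp⇒≈0 {X = Y} signs λ v∈Y →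
        let (j , cj≡v) = ∈⇒corner v (Y⊆ v v∈Y) in v∉ j cj≡v

-- Facet and skew-facet cocircuits of the real cube

both+ both- : Sign → Sign → Bool
both+ Sign.+ Sign.+ = true
both+ _      _      = false
both- Sign.- Sign.- = true
both- _      _      = false

both⇔≡ : ∀ s t → T (both+ s t ∨ both- s t) ⇔ s ≡ t
both⇔≡ Sign.+ Sign.+ = mk⇔ (λ _ → refl) (λ _ → _)
both⇔≡ Sign.+ Sign.- = mk⇔ (λ ()) (λ ())
both⇔≡ Sign.- Sign.+ = mk⇔ (λ ()) (λ ())
both⇔≡ Sign.- Sign.- = mk⇔ (λ _ → refl) (λ _ → _)

both-disjoint : ∀ s t → ¬ (T (both+ s t) × T (both- s t))
both-disjoint Sign.+ Sign.+ ()
both-disjoint Sign.+ Sign.- ()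
both-disjoint Sign.- Sign.+ ()
both-disjoint Sign.- Sign.- ()

both+⇒0< : ∀ s t → T (both+ s t) → 0ᴿ <ᴿ ⟦ s ⟧ +ᴿ ⟦ t ⟧
both+⇒0< Sign.+ Sign.+ _ = 0<2

both-⇒0<- : ∀ s t → T (both- s t) → 0ᴿ <ᴿ -ᴿ (⟦ s ⟧ +ᴿ ⟦ t ⟧)
both-⇒0<- Sign.- Sign.- _ = 0<-resp-≈ (solve 0 (con 1ℚ :+ con 1ℚ := :- ((:- con 1ℚ) :+ (:- con 1ℚ))) ≈-refl) 0<2

neither⇒≈0 : ∀ s t → ¬ T (both+ s t ∨ both- s t) → ⟦ s ⟧ +ᴿ ⟦ t ⟧ ≈ᴿ 0ᴿ
neither⇒≈0 Sign.+ Sign.+ ¬b = contradiction _ ¬b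
neither⇒≈0 Sign.+ Sign.- ¬b = R.-‿inverseʳ 1ᴿ
neither⇒≈0 Sign.- Sign.+ ¬b = R.-‿inverseˡ 1ᴿ
neither⇒≈0 Sign.- Sign.- ¬b = contradiction _ ¬b

-- The affine functional ⟦σ⟧ + ⟦τ⟧ vanishes exactly where σ and τ differ; the
-- functionals of facets (σ constant) and of skew-facets have this form.
module Cocircuit {n : ℕ} (σ τ : C n → Sign) (j : Fin n)
  (σ-fixed : ∀ v → σ (flipAt j v) ≡ σ v)
  (τ-moved : ∀ v → τ (flipAt j v) ≡ opposite (τ v))
  (σ-affine : ∀ c → AffineDependency c → ∑ (λ v → c v *ᴿ ⟦ σ v ⟧) ≈ᴿ 0ᴿ)
  (τ-affine : ∀ c → AffineDependency c → ∑ (λ v → c v *ᴿ ⟦ τ v ⟧) ≈ᴿ 0ᴿ)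
  where

  cocircuit : SignedSet (C n)
  cocircuit = record
    { _⁺ = λ v → both+ (σ v) (τ v) ; _⁻ = λ v → both- (σ v) (τ v)
    ; disjoint = λ v → both-disjoint (σ v) (τ v) }

  ∈cocircuit : ∀ v → v ∈ supp cocircuit ⇔ σ v ≡ τ v
  ∈cocircuit v = both⇔≡ (σ v) (τ v)

  -- Flipping `j` changes `τ` but not `σ`, so it exchanges the hyperplane and its complement.
  flip∉ : ∀ {v} → v ∈ supp cocircuit → ¬ flipAt j v ∈ supp cocircuit
  flip∉ {v} v∈ fv∈ = Sign.s≢opposite[s] (τ v) (≡.trans (≡.sym (Equivalence.to (∈cocircuit v) v∈))
    (≡.trans (≡.sym (σ-fixed v)) (≡.trans (Equivalence.to (∈cocircuit (flipAt j v)) fv∈) (τ-moved v))))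

  flip∈ : ∀ {v} → ¬ v ∈ supp cocircuit → flipAt j v ∈ supp cocircuit
  flip∈ {v} v∉ = Equivalence.from (∈cocircuit (flipAt j v)) (≡.trans (σ-fixed v)
    (≡.trans (≢⇒≡opposite (v∉ ∘ Equivalence.from (∈cocircuit v) ∘ ≡.sym)) (≡.sym (τ-moved v))))

  -- The function `g`, dependency times functional, sums to zero. It is positive where the two
  -- signed sets agree, negative where they oppose and zero elsewhere, so an element of one sort
  -- forces one of the other; both sorts can be searched for because supports are Boolean and the
  -- cube is finite.
  orthogonal : ∀ X → 𝐐 n X → X ⟂ cocircuit
  orthogonal X ((c , ∑c≈0 , ∑cv≈0 , signs) , _) = decide (∃? (enumC n) λ e → T? (supp X e) ×-dec T? (supp cocircuit e))
    where
    Y = cocircuit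
    value : C n → ℝ
    value v = ⟦ σ v ⟧ +ᴿ ⟦ τ v ⟧
    g : C n → ℝ
    g v = c v *ᴿ value v
    ∑g≈0 : ∑ g ≈ᴿ 0ᴿ
    ∑g≈0 = ≈-trans (∑-cong {f = g} λ v → R.distribˡ (c v) ⟦ σ v ⟧ ⟦ τ v ⟧)
      (≈-trans (∑-+ (λ v → c v *ᴿ ⟦ σ v ⟧) (λ v → c v *ᴿ ⟦ τ v ⟧))
        (+≈0 (σ-affine c (∑c≈0 , ∑cv≈0)) (τ-affine c (∑c≈0 , ∑cv≈0))))
    ∑-g≈0 : ∑ (λ v → -ᴿ g v) ≈ᴿ 0ᴿ
    ∑-g≈0 = ≈-trans (∑-cong {f = λ v → -ᴿ g v} {g = λ v → -ᴿ 1ᴿ *ᴿ g v}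
        λ v → ≈-trans (R.-‿cong (≈-sym (R.*-identityˡ (g v)))) (R.-‿distribˡ-* 1ᴿ (g v)))
      (≈-trans (∑-*ˡ (-ᴿ 1ᴿ) g) (≈0-*ʳ ∑g≈0))
    Same Opposite : Pred (C n) 0ℓ
    Same e     = (e ∈ (X ⁺) × e ∈ (Y ⁺)) ⊎ (e ∈ (X ⁻) × e ∈ (Y ⁻))
    Opposite e = (e ∈ (X ⁺) × e ∈ (Y ⁻)) ⊎ (e ∈ (X ⁻) × e ∈ (Y ⁺))
    same? : Decidable Same
    same? e = (T? _ ×-dec T? _) ⊎-dec (T? _ ×-dec T? _)
    opposite? : Decidable Opposite
    opposite? e = (T? _ ×-dec T? _) ⊎-dec (T? _ ×-dec T? _)
    open Equivalence
    same⇒0< : ∀ {e} → Same e → 0ᴿ <ᴿ g e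
    same⇒0< {e} (inj₁ (x , y)) = 0<* (to (proj₁ signs e) x) (both+⇒0< (σ e) (τ e) y)
    same⇒0< {e} (inj₂ (x , y)) = 0<-resp-≈ (solve 2 (λ a b → (:- a) :* (:- b) := a :* b) ≈-refl (c e) (value e))
      (0<* (<0⇒0<- (to (proj₂ signs e) x)) (both-⇒0<- (σ e) (τ e) y))
    opposite⇒0<- : ∀ {e} → Opposite e → 0ᴿ <ᴿ -ᴿ g e
    opposite⇒0<- {e} (inj₁ (x , y)) = 0<-resp-≈ (≈-sym (R.-‿distribʳ-* (c e) (value e)))
      (0<* (to (proj₁ signs e) x) (both-⇒0<- (σ e) (τ e) y))
    opposite⇒0<- {e} (inj₂ (x , y)) = 0<-resp-≈ (≈-sym (R.-‿distribˡ-* (c e) (value e)))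
      (0<* (<0⇒0<- (to (proj₂ signs e) x)) (both+⇒0< (σ e) (τ e) y))
    classify : ∀ e → e ∈ supp X → e ∈ supp Y → Same e ⊎ Opposite e
    classify e x y with ∈supp⇒± X e x | ∈supp⇒± Y e y
    ... | inj₁ x⁺ | inj₁ y⁺ = inj₁ (inj₁ (x⁺ , y⁺))
    ... | inj₁ x⁺ | inj₂ y⁻ = inj₂ (inj₁ (x⁺ , y⁻))
    ... | inj₂ x⁻ | inj₁ y⁺ = inj₂ (inj₂ (x⁻ , y⁺))
    ... | inj₂ x⁻ | inj₂ y⁻ = inj₁ (inj₂ (x⁻ , y⁻))
    g-cases : ∀ e → Same e ⊎ Opposite e ⊎ g e ≈ᴿ 0ᴿ
    g-cases e with T? (supp X e) | T? (supp Y e)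
    ... | no x∉ | _     = inj₂ (inj₂ (≈0-*ˡ (∉supp⇒≈0 {X = X} signs x∉)))
    ... | yes _ | no y∉ = inj₂ (inj₂ (≈0-*ʳ (neither⇒≈0 (σ e) (τ e) y∉)))
    ... | yes x | yes y = [ inj₁ , inj₂ ∘ inj₁ ]′ (classify e x y)
    opposite⇒same : ∃ Opposite → ∃ Same
    opposite⇒same (e , opp) = decidable-stable (∃? (enumC n) same?) λ ¬same →
      0<⇒≉0 (0<∑ (λ v → [ (λ s → contradiction (v , s) ¬same) , [ inj₁ ∘ opposite⇒0<- , inj₂ ∘ -≈0 ]′ ]′ (g-cases v))
                 e (opposite⇒0<- opp)) ∑-g≈0
    same⇒opposite : ∃ Same → ∃ Opposite
    same⇒opposite (e , same) = decidable-stable (∃? (enumC n) opposite?) λ ¬opp →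
      0<⇒≉0 (0<∑ (λ v → [ inj₁ ∘ same⇒0< , [ (λ o → contradiction (v , o) ¬opp) , inj₂ ]′ ]′ (g-cases v))
                 e (same⇒0< same)) ∑g≈0
    decide : Dec (∃ λ e → e ∈ supp X × e ∈ supp Y) → X ⟂ Y
    decide (no ¬meet) = inj₁ λ e meet → ¬meet (e , meet)
    decide (yes (e , x , y)) = inj₂ ([ (λ s → (e , s) , same⇒opposite (e , s))
                                     , (λ o → opposite⇒same (e , o) , (e , o)) ]′ (classify e x y))

  cocircuit-nonempty : Nonempty cocircuit
  cocircuit-nonempty with T? (supp cocircuit ⊕)
  ... | yes o∈ = ⊕ , o∈
  ... | no  o∉ = flipAt j ⊕ , flip∈ o∉

  -- Any two elements of the complement lie on a common rectangle whose other
  -- two corners are in the hyperplane.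
  minimal : ∀ Y → (∀ X → 𝐐 n X → X ⟂ Y) → Nonempty Y → supp Y ⊆ supp cocircuit → supp cocircuit ⊆ supp Y
  minimal Y orth (e , e∈Y) Y⊆ u u∈ = decidable-stable (T? _) absurd
    where
    absurd : ¬ ¬ u ∈ supp Y
    absurd u∉Y with lookup u j Sign.≟ lookup e j
    ... | yes uⱼ≡eⱼ = meets-once⇒not-⟂ {X = rectangle} {Y} {e} (corner∈ (suc zero)) e∈Y once (orth rectangle rectangle∈𝐐)
      where
      u≢e : u ≢ e
      u≢e refl = u∉Y e∈Y
      open Rectangle u e j u≢e uⱼ≡eⱼ
      open RectangleCircuit u e j u≢e uⱼ≡eⱼ
      once : ∀ f → f ∈ supp rectangle → f ∈ supp Y → f ≡ e
      once f f∈ f∈Y with ∈⇒corner f f∈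
      ... | zero , refl                   = contradiction f∈Y u∉Y
      ... | suc zero , refl               = refl
      ... | suc (suc zero) , refl         = contradiction (Y⊆ f f∈Y) (flip∉ u∈)
      ... | suc (suc (suc zero)) , refl   = contradiction (Y⊆ f f∈Y) (flip∉ (Y⊆ e e∈Y))
    -- Here `u` and `e` differ at `j`, so the rectangle is built on `u` and `e′`, which agree there;
    -- `e` reappears as the flip of `e′`.
    ... | no uⱼ≢eⱼ = meets-once⇒not-⟂ {X = rectangle} {Y} {e}
            (subst (_∈ supp rectangle) (flipAt-involutive j e) (corner∈ (suc (suc (suc zero))))) e∈Y once (orth rectangle rectangle∈𝐐)
      where
      e′ = flipAt j e
      e′∉ : ¬ e′ ∈ supp cocircuit
      e′∉ = flip∉ (Y⊆ e e∈Y)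
      u≢e′ : u ≢ e′
      u≢e′ u≡e′ = e′∉ (subst (_∈ supp cocircuit) u≡e′ u∈)
      uⱼ≡e′ⱼ : lookup u j ≡ lookup e′ j
      uⱼ≡e′ⱼ = ≡.trans (≢⇒≡opposite (uⱼ≢eⱼ ∘ ≡.sym)) (≡.sym (lookup-flipAt j e))
      open Rectangle u e′ j u≢e′ uⱼ≡e′ⱼ
      open RectangleCircuit u e′ j u≢e′ uⱼ≡e′ⱼ
      once : ∀ f → f ∈ supp rectangle → f ∈ supp Y → f ≡ e
      once f f∈ f∈Y with ∈⇒corner f f∈
      ... | zero , refl                   = contradiction f∈Y u∉Y
      ... | suc zero , refl               = contradiction (Y⊆ f f∈Y) e′∉
      ... | suc (suc zero) , refl         = contradiction (Y⊆ f f∈Y) (flip∉ u∈)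
      ... | suc (suc (suc zero)) , refl   = flipAt-involutive j e

  isCocircuit : SignedCocircuits (𝐐 n) cocircuit
  isCocircuit = orthogonal , cocircuit-nonempty , minimal

constant-affine : ∀ {n} (c : C n → ℝ) → AffineDependency c → ∑ (λ v → c v *ᴿ 1ᴿ) ≈ᴿ 0ᴿ
constant-affine c (∑c≈0 , _) = ≈-trans (∑-*1 c) ∑c≈0

coordinate-affine : ∀ {n} s (i : Fin n) (c : C n → ℝ) → AffineDependency c →
                    ∑ (λ v → c v *ᴿ ⟦ s Sign.* lookup v i ⟧) ≈ᴿ 0ᴿ
coordinate-affine s i c (_ , ∑cv≈0) = ≈-trans
  (∑-cong {f = λ v → c v *ᴿ ⟦ s Sign.* lookup v i ⟧} {g = λ v → ⟦ s ⟧ *ᴿ (c v *ᴿ ⟦ lookup v i ⟧)}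
    λ v → ≈-trans (R.*-congˡ (⟦*⟧ s (lookup v i)))
      (solve 3 (λ a b d → a :* (b :* d) := b :* (a :* d)) ≈-refl (c v) ⟦ s ⟧ ⟦ lookup v i ⟧))
  (≈-trans (∑-*ˡ ⟦ s ⟧ (λ v → c v *ᴿ ⟦ lookup v i ⟧)) (≈0-*ʳ (∑cv≈0 i)))

*-opposite : ∀ s t → s Sign.* opposite t ≡ opposite (s Sign.* t)
*-opposite Sign.+ t = refl
*-opposite Sign.- t = refl

-- Facets and skew-facets in an arbitrary oriented cube

module _ {n : ℕ} {𝓜 : Pred (SignedSet (C n)) 0ℓ} (cube : IsOrientedCube n 𝓜) where

  open IsOrientedCube cube

  -- The functional is 1 - s·v(i), which vanishes exactly on the facet.
  facet-cocircuit : ∀ i s → ∃ λ Y → (∀ X → 𝓜 X → X ⟂ Y) × (∀ v → v ∈ supp Y ⇔ lookup v i ≢ s)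
  facet-cocircuit i s = cocircuit , proj₁ (facets i s cocircuit isCocircuit complementary) , complementary
    where
    open Cocircuit (λ _ → Sign.+) (λ v → opposite s Sign.* lookup v i) i (λ _ → refl)
      (λ v → ≡.trans (cong (opposite s Sign.*_) (lookup-flipAt i v)) (*-opposite (opposite s) (lookup v i)))
      constant-affine (coordinate-affine (opposite s) i)
    differs : ∀ s t → Sign.+ ≡ opposite s Sign.* t ⇔ t ≢ s
    differs Sign.+ Sign.+ = mk⇔ (λ ()) (λ ≢ → contradiction refl ≢)
    differs Sign.+ Sign.- = mk⇔ (λ _ ()) (λ _ → refl)
    differs Sign.- Sign.+ = mk⇔ (λ _ ()) (λ _ → refl)
    differs Sign.- Sign.- = mk⇔ (λ ()) (λ ≢ → contradiction refl ≢)
    complementary : ComplementaryTo (Facet i s) cocircuit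
    complementary v = mk⇔ (Equivalence.to (differs s (lookup v i)) ∘ Equivalence.to (∈cocircuit v))
                          (Equivalence.from (∈cocircuit v) ∘ Equivalence.from (differs s (lookup v i)))

  -- The functional is v(i) - s·v(k), which vanishes exactly on the skew-facet; `i` is the flipped
  -- coordinate. The factor `Sign.+` only puts v(i) into the shape of `coordinate-affine`.
  skewFacet-cocircuit : ∀ i k s → i ≢ k →
                        ∃ λ Y → (∀ X → 𝓜 X → X ⟂ Y) × (∀ v → v ∈ supp Y ⇔ lookup v i ≢ s Sign.* lookup v k)
  skewFacet-cocircuit i k s i≢k =
      cocircuit , proj₁ (skewFacets i k s i≢k cocircuit isCocircuit complementary) , complementary
    where
    open Cocircuit (λ v → opposite s Sign.* lookup v k) (λ v → Sign.+ Sign.* lookup v i) i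
      (λ v → cong (opposite s Sign.*_) (lookup-flipAt-≢ (i≢k ∘ ≡.sym) v))
      (λ v → lookup-flipAt i v)
      (coordinate-affine (opposite s) k) (coordinate-affine Sign.+ i)
    differs : ∀ s t u → opposite s Sign.* t ≡ u ⇔ u ≢ s Sign.* t
    differs s t u = subst (λ z → z ≡ u ⇔ u ≢ s Sign.* t) (≡.sym (opposite-* s t)) (neq (s Sign.* t) u)
      where
      opposite-* : ∀ s t → opposite s Sign.* t ≡ opposite (s Sign.* t)
      opposite-* Sign.+ t = refl
      opposite-* Sign.- t = ≡.sym (Sign.opposite-involutive t)
      neq : ∀ z u → opposite z ≡ u ⇔ u ≢ z
      neq z u = mk⇔ (λ { refl e → Sign.s≢opposite[s] z (≡.sym e) }) (λ u≢z → ≡.sym (≢⇒≡opposite (u≢z ∘ ≡.sym)))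
    complementary : ComplementaryTo (SkewFacet i k s) cocircuit
    complementary v = mk⇔ (Equivalence.to (differs s (lookup v k) (lookup v i)) ∘ Equivalence.to (∈cocircuit v))
                          (Equivalence.from (∈cocircuit v) ∘ Equivalence.from (differs s (lookup v k) (lookup v i)))

-- Elements of minimal support

module _ {m : ℕ} {E : Set} (F : Fin m ↔ E) where

  open Inverse F using (to; from; strictlyInverseˡ)

  -- Holds because the index set is finite: the double negations are sequenced along the
  -- enumeration.
  ¬¬-choice : ∀ {P : E → Set} → (∀ e → ¬ ¬ P e) → ¬ ¬ (∀ e → P e)
  ¬¬-choice {P} ¬¬P = do
    p ← Fin.sequence rawApplicative (λ i → ¬¬P (to i))
    pure λ e → subst P (strictlyInverseˡ e) (p (from e))

  indices : 𝒫 E → Subset m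
  indices S = tabulate (S ∘ to)

  ∈indices : ∀ S e → e ∈ S ⇔ from e Subset.∈ indices S
  ∈indices S e = mk⇔
    (λ e∈S → Vec.lookup⇒[]= (from e) _ (≡.trans lookup≡ (Equivalence.to T-≡ e∈S)))
    (λ i∈ → Equivalence.from T-≡ (≡.trans (≡.sym lookup≡) (Vec.[]=⇒lookup i∈)))
    where
    lookup≡ : lookup (indices S) (from e) ≡ S e
    lookup≡ = ≡.trans (Vec.lookup∘tabulate (S ∘ to) (from e)) (cong S (strictlyInverseˡ e))

  indices-⊂ : ∀ {S S′ e} → S ⊆ S′ → e ∈ S′ → ¬ e ∈ S → indices S Subset.⊂ indices S′
  indices-⊂ {S} {S′} {e} S⊆S′ e∈S′ e∉S =
      (λ {i} i∈ → Vec.lookup⇒[]= i _ (≡.trans (Vec.lookup∘tabulate (S′ ∘ to) i) (Equivalence.to T-≡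
         (S⊆S′ (to i) (Equivalence.from T-≡ (≡.trans (≡.sym (Vec.lookup∘tabulate (S ∘ to) i)) (Vec.[]=⇒lookup i∈)))))))
    , from e , Equivalence.to (∈indices S′ e) e∈S′ , e∉S ∘ Equivalence.from (∈indices S e)

  -- `P` need not be decidable, hence the double negation. If no minimal set lay below `S`, then `S`
  -- itself would be minimal, since a proper subset satisfying `P` would yield one by induction on
  -- cardinality.
  minimal-subset : ∀ (P : Pred (𝒫 E) 0ℓ) S → P S →
                   ¬ ¬ ∃ λ M → P M × M ⊆ S × (∀ S′ → P S′ → S′ ⊆ M → M ⊆ S′)
  minimal-subset P S p = descend S p (<-wellFounded _)
    where
    descend : ∀ S → P S → Acc _<_ Subset.∣ indices S ∣ →
              ¬ ¬ ∃ λ M → P M × M ⊆ S × (∀ S′ → P S′ → S′ ⊆ M → M ⊆ S′)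
    descend S p (acc smaller) none = none (S , p , (λ _ → id) , λ S′ p′ S′⊆S e e∈S →
      decidable-stable (T? (S′ e)) λ e∉S′ →
        descend S′ p′ (smaller (Subset.p⊂q⇒∣p∣<∣q∣ (indices-⊂ S′⊆S e∈S e∉S′)))
          λ (M , pM , M⊆S′ , minimal) → none (M , pM , (λ f → S′⊆S f ∘ M⊆S′ f) , minimal))

signs-of : ∀ {n} (c : C n → ℝ) → ¬ ¬ ∃ (SignsOf c)
signs-of {n} c = do
    d ← ¬¬-choice (enumC n) decided
    pure (signedSet d , (λ e → positive (d e)) , (λ e → negative (d e)))
  where
  Decided : C n → Set
  Decided e = 0ᴿ <ᴿ c e ⊎ c e <ᴿ 0ᴿ ⊎ c e ≈ᴿ 0ᴿ
  decided : ∀ e → ¬ ¬ Decided e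
  decided e ¬d = ¬d (inj₂ (inj₂ (≮0≯0⇒≈0 (¬d ∘ inj₁) (¬d ∘ inj₂ ∘ inj₁))))
  isPositive isNegative : ∀ {e} → Decided e → Bool
  isPositive (inj₁ _) = true
  isPositive (inj₂ _) = false
  isNegative (inj₂ (inj₁ _)) = true
  isNegative _ = false
  positive : ∀ {e} (d : Decided e) → T (isPositive d) ⇔ 0ᴿ <ᴿ c e
  positive (inj₁ >0)        = mk⇔ (λ _ → >0) (λ _ → _)
  positive (inj₂ (inj₁ <0)) = mk⇔ (λ ()) (λ >0 → 0<∧<0⇒⊥ >0 <0)
  positive (inj₂ (inj₂ ≈0)) = mk⇔ (λ ()) (λ >0 → 0<⇒≉0 >0 ≈0)
  negative : ∀ {e} (d : Decided e) → T (isNegative d) ⇔ c e <ᴿ 0ᴿ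
  negative (inj₁ >0)        = mk⇔ (λ ()) (λ <0 → 0<∧<0⇒⊥ >0 <0)
  negative (inj₂ (inj₁ <0)) = mk⇔ (λ _ → <0) (λ _ → _)
  negative (inj₂ (inj₂ ≈0)) = mk⇔ (λ ()) (λ <0 → <0⇒≉0 <0 ≈0)
  signedSet : (∀ e → Decided e) → SignedSet (C n)
  signedSet d = record
    { _⁺ = λ e → isPositive (d e) ; _⁻ = λ e → isNegative (d e)
    ; disjoint = λ e (p , q) → 0<∧<0⇒⊥ (Equivalence.to (positive (d e)) p) (Equivalence.to (negative (d e)) q) }

AffinelyIndependent : ∀ {n} → 𝒫 (C n) → Set
AffinelyIndependent {n} S = ∀ (c : C n → ℝ) → (∀ v → ¬ v ∈ S → c v ≈ᴿ 0ᴿ) → AffineDependency c → ∀ v → c v ≈ᴿ 0ᴿ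

-- A nonzero dependency supported in `S` has a nonempty sign vector, and a nonempty vector of
-- minimal support below it is a circuit of `𝐐 n` inside `S`. Conversely a circuit carries a nonzero
-- dependency.
independent-𝐐⇔ : ∀ {n} S → Independent (underlying (𝐐 n)) S ⇔ AffinelyIndependent S
independent-𝐐⇔ {n} S = mk⇔ affinely independent
  where
  𝒱 = AffineVectors (enumC n) (λ v k → ⟦ lookup v k ⟧)
  affinely : Independent (underlying (𝐐 n)) S → AffinelyIndependent S
  affinely ind c off dep v = ≈0-stable λ cv≉0 → (do
      X , signs ← signs-of c
      let X∈𝒱 = c , proj₁ dep , proj₂ dep , signs
          v∈X = decidable-stable (T? (supp X v)) (cv≉0 ∘ ∉supp⇒≈0 {X = X} signs)
      M , (Y , Y∈𝒱 , ne , Y⊆M , M⊆Y) , M⊆X , min ← minimal-subset (enumC n)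
        (λ M → ∃ λ Y → 𝒱 Y × Nonempty Y × supp Y ⊆ M × M ⊆ supp Y) (supp X)
        (X , X∈𝒱 , (v , v∈X) , (λ _ → id) , (λ _ → id))
      let Y∈𝐐 : 𝐐 n Y
          Y∈𝐐 = Y∈𝒱 , ne , λ Z Z∈𝒱 neZ Z⊆Y e e∈Y →
            min (supp Z) (Z , Z∈𝒱 , neZ , (λ _ → id) , (λ _ → id)) (λ f → Y⊆M f ∘ Z⊆Y f) e (Y⊆M e e∈Y)
      pure (ind (supp Y , (Y , Y∈𝐐 , λ _ → mk⇔ id id) , λ e e∈Y →
        decidable-stable (T? (S e)) λ e∉S → ∈supp⇒≉0 {X = X} signs (M⊆X e (Y⊆M e e∈Y)) (off e e∉S)))) id
  independent : AffinelyIndependent S → Independent (underlying (𝐐 n)) S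
  independent ind (D , (X , ((c , ∑c , ∑cv , signs) , (e , e∈X) , _) , X≐D) , D⊆S) =
    ∈supp⇒≉0 {X = X} signs e∈X (ind c
      (λ v v∉S → ∉supp⇒≈0 {X = X} signs λ v∈X → v∉S (D⊆S v (Equivalence.to (X≐D v) v∈X))) (∑c , ∑cv) e)

-- Linear relations of a realization

module Realization {n d : ℕ} (w : C n → Fin d → ℝ) where

  Relation : (C n → ℝ) → Set
  Relation c = ∀ k → ∑ (λ v → c v *ᴿ w v k) ≈ᴿ 0ᴿ

  dependent⇒relation : ∀ {S} → ¬ LinearlyIndependent (enumC n) w S →
    ¬ ¬ ∃ λ c → (∀ v → ¬ v ∈ S → c v ≈ᴿ 0ᴿ) × Relation c × ∃ λ v → c v ≉ᴿ 0ᴿ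
  dependent⇒relation dep none = dep λ c off rel v → ≈0-stable λ cv≉0 → none (c , off , rel , v , cv≉0)

  module _ {𝓜 : Pred (SignedSet (C n)) 0ℓ}
           (real : ∀ S → Independent (underlying 𝓜) S ⇔ LinearlyIndependent (enumC n) w S) where

    circuit-dependent : ∀ {X} → 𝓜 X → ¬ LinearlyIndependent (enumC n) w (supp X)
    circuit-dependent {X} X∈𝓜 ind =
      Equivalence.from (real (supp X)) ind (supp X , (X , X∈𝓜 , λ _ → mk⇔ id id) , λ _ → id)

    -- The complement of a covector is a flat of the linear matroid.
    coefficient≈0 : ∀ {Y} → (∀ X → 𝓜 X → X ⟂ Y) → ∀ {e} → e ∈ supp Y →
                    ∀ c → Relation c → (∀ f → f ∈ supp Y → f ≢ e → c f ≈ᴿ 0ᴿ) → c e ≈ᴿ 0ᴿ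
    coefficient≈0 {Y} orth {e} e∈Y c₀ rel₀ off₀ = ≈0-stable λ c₀e≉0 → (do
        -- `S₀` is the complement of `Y` with `e` added. A minimal set `M` inside it that carries a
        -- relation nonzero at `e` is dependent, hence contains a circuit; minimality will put `e`
        -- on that circuit, which then meets `Y` in `e` alone.
        M , (c , off , rel , ce≉0) , M⊆S , minimal ← minimal-subset (enumC n) Supports S₀ (c₀ , off-S₀ , rel₀ , c₀e≉0)
        D , (X , X∈𝓜 , X≐D) , D⊆M ← λ ¬D → ce≉0 (Equivalence.to (real M) ¬D c off rel e)
        let X⊆M : supp X ⊆ M
            X⊆M f = D⊆M f ∘ Equivalence.to (X≐D f)
            e∈X = decidable-stable (T? (supp X e)) (eliminate c off rel ce≉0 minimal X∈𝓜 X⊆M)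
        pure (meets-once⇒not-⟂ {X = X} {Y} e∈X e∈Y
               (λ f f∈X f∈Y → in-S₀ f (M⊆S f (X⊆M f f∈X)) f∈Y) (orth X X∈𝓜))) id
      where
      S₀ : 𝒫 (C n)
      S₀ f = not (supp Y f) ∨ ⌊ f ≟ᶜ e ⌋
      in-S₀ : ∀ f → f ∈ S₀ → f ∈ supp Y → f ≡ e
      in-S₀ f f∈S₀ f∈Y with Equivalence.to (T-∨ {not (supp Y f)}) f∈S₀
      ... | inj₂ f≡e = toWitness f≡e
      ... | inj₁ f∉Y with () ← ≡.trans (≡.sym (Equivalence.to T-≡ f∈Y)) (Equivalence.to T-not-≡ f∉Y)
      off-S₀ : ∀ f → ¬ f ∈ S₀ → c₀ f ≈ᴿ 0ᴿ
      off-S₀ f f∉ = off₀ f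
        (decidable-stable (T? (supp Y f)) λ f∉Y → f∉ (Equivalence.from (T-∨ {not (supp Y f)}) (inj₁ (T-not f∉Y))))
        (λ f≡e → f∉ (Equivalence.from (T-∨ {not (supp Y f)}) (inj₂ (fromWitness f≡e))))
        where
        T-not : ∀ {b} → ¬ T b → T (not b)
        T-not {false} _ = _
        T-not {true} ¬b = ¬b _
      Supports : Pred (𝒫 (C n)) 0ℓ
      Supports M = ∃ λ c → (∀ v → ¬ v ∈ M → c v ≈ᴿ 0ᴿ) × Relation c × c e ≉ᴿ 0ᴿ
      -- Strong elimination: if the circuit avoided `e`, the combination `y` of `c` with the
      -- relation of the circuit would cancel at some `f` of the circuit and stay nonzero at `e`, so
      -- that `M` without `f` would still qualify.
      eliminate : ∀ {M} c → (∀ v → ¬ v ∈ M → c v ≈ᴿ 0ᴿ) → Relation c → c e ≉ᴿ 0ᴿ →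
                  (∀ M′ → Supports M′ → M′ ⊆ M → M ⊆ M′) →
                  ∀ {X} → 𝓜 X → supp X ⊆ M → ¬ ¬ e ∈ supp X
      eliminate {M} c off rel ce≉0 minimal {X} X∈𝓜 X⊆M e∉X = dependent⇒relation (circuit-dependent X∈𝓜)
        λ (x , x-off , x-rel , f , xf≉0) →
          let f∈X = decidable-stable (T? (supp X f)) (xf≉0 ∘ x-off f)
              M′ : 𝒫 (C n)
              M′ v = M v ∧ not ⌊ v ≟ᶜ f ⌋
              y : C n → ℝ
              y v = x f *ᴿ c v +ᴿ -ᴿ c f *ᴿ x v
              y-off : ∀ v → ¬ v ∈ M′ → y v ≈ᴿ 0ᴿ
              y-off v v∉M′ = off-M′ x x-off X⊆M v v∉M′ (v ≟ᶜ f)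
              y-rel : Relation y
              y-rel k = ≈-trans (∑-cong {f = λ v → y v *ᴿ w v k} λ v →
                  solve 5 (λ a b s t u → (a :* s :+ (:- b) :* t) :* u := a :* (s :* u) :+ (:- b) :* (t :* u)) ≈-refl
                    (x f) (c f) (c v) (x v) (w v k))
                (≈-trans (∑-+ (λ v → x f *ᴿ (c v *ᴿ w v k)) (λ v → -ᴿ c f *ᴿ (x v *ᴿ w v k)))
                  (+≈0 (≈-trans (∑-*ˡ (x f) (λ v → c v *ᴿ w v k)) (≈0-*ʳ (rel k)))
                       (≈-trans (∑-*ˡ (-ᴿ c f) (λ v → x v *ᴿ w v k)) (≈0-*ʳ (x-rel k)))))
              ye≉0 : y e ≉ᴿ 0ᴿ
              ye≉0 ye≈0 = *≉0 xf≉0 ce≉0 (≈-trans (≈-sym (≈-trans (R.+-congˡ (≈0-*ʳ (x-off e e∉X))) (R.+-identityʳ _))) ye≈0)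
              f∈M′ = minimal M′ (y , y-off , y-rel , ye≉0) (λ v → proj₁ ∘ Equivalence.to (T-∧ {M v})) f (X⊆M f f∈X)
          in not-self f (proj₂ (Equivalence.to (T-∧ {M f}) f∈M′))
        where
        not-self : ∀ f → ¬ T (not ⌊ f ≟ᶜ f ⌋)
        not-self f t with f ≟ᶜ f
        ... | yes _ = t
        ... | no f≢f = f≢f refl
        off-M′ : ∀ x → (∀ v → ¬ v ∈ supp X → x v ≈ᴿ 0ᴿ) → supp X ⊆ M →
                 ∀ {f} v → ¬ T (M v ∧ not ⌊ v ≟ᶜ f ⌋) → Dec (v ≡ f) → x f *ᴿ c v +ᴿ -ᴿ c f *ᴿ x v ≈ᴿ 0ᴿ
        off-M′ x x-off X⊆M {f} .f v∉ (yes refl) = solve 2 (λ a b → a :* b :+ (:- b) :* a := con 0ℚ) ≈-refl (x f) (c f)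
        off-M′ x x-off X⊆M {f} v v∉ (no v≢f) = +≈0 (≈0-*ʳ (off v v∉M)) (≈0-*ʳ (x-off v (v∉M ∘ X⊆M v)))
          where
          v∉M : ¬ v ∈ M
          v∉M v∈M = v∉ (Equivalence.from (T-∧ {M v}) (v∈M , distinct))
            where
            distinct : T (not ⌊ v ≟ᶜ f ⌋)
            distinct with v ≟ᶜ f
            ... | yes v≡f = v≢f v≡f
            ... | no _ = _

    module _ (cube : IsOrientedCube n 𝓜) where

      open IsOrientedCube cube
      open IsOrientedMatroid isOrientedMatroid

      -- A rectangle is a circuit, so it carries a nonzero relation. No coefficient vanishes: by
      -- incomparability the other three corners contain no circuit, so a relation that is zero at
      -- one corner is zero everywhere.
      rectangle-relation : ∀ p q i (p≢q : p ≢ q) (pᵢ≡qᵢ : lookup p i ≡ lookup q i) →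
        let open Rectangle p q i p≢q pᵢ≡qᵢ in
        ¬ ¬ ∃ λ (a : Fin 4 → ℝ) → (∀ j → a j ≉ᴿ 0ᴿ) × (∀ k → sum (λ j → a j *ᴿ w (corner j) k) ≈ᴿ 0ᴿ)
      rectangle-relation p q i p≢q pᵢ≡qᵢ = do
          c , off , rel , e , ce≉0 ← dependent⇒relation (circuit-dependent rectangle∈𝓜)
          pure (c ∘ corner , (λ j cj≈0 → ce≉0 (all-zero c off rel j cj≈0 e)) , λ k →
            ≈-trans (≈-sym (∑-supported corner corner-injective {c} (λ v v∉ → off v λ v∈ →
              let (j , cj≡v) = ∈⇒corner v v∈ in v∉ j cj≡v) (λ v → w v k))) (rel k))
        where
        open Rectangle p q i p≢q pᵢ≡qᵢ
        rectangle∈𝓜 : 𝓜 rectangle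
        rectangle∈𝓜 = rectangles p (difference p q) Subset.⁅ i ⁆ difference-nonempty (i , Subset.x∈⁅x⁆ i)
          difference∩⁅i⁆-empty rectangle isRectangle
        all-zero : ∀ c → (∀ v → ¬ v ∈ supp rectangle → c v ≈ᴿ 0ᴿ) → Relation c →
                   ∀ j → c (corner j) ≈ᴿ 0ᴿ → ∀ v → c v ≈ᴿ 0ᴿ
        all-zero c off rel j cj≈0 = Equivalence.to (real S) independent c off-S rel
          where
          S : 𝒫 (C n)
          S v = supp rectangle v ∧ not ⌊ v ≟ᶜ corner j ⌋
          S-corner : ¬ corner j ∈ S
          S-corner j∈ with corner j ≟ᶜ corner j | proj₂ (Equivalence.to (T-∧ {supp rectangle (corner j)}) j∈)
          ... | yes _ | ()
          ... | no j≢j | _ = j≢j refl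
          off-S : ∀ v → ¬ v ∈ S → c v ≈ᴿ 0ᴿ
          off-S v v∉S with v ≟ᶜ corner j
          ... | yes refl = cj≈0
          ... | no v≢cj = off v λ v∈ → v∉S (Equivalence.from (T-∧ {supp rectangle v}) (v∈ , _))
          independent : Independent (underlying 𝓜) S
          independent (D , (X , X∈𝓜 , X≐D) , D⊆S) = S-corner (X⊆S (corner j) (same-support X≈±R))
            where
            X⊆S : supp X ⊆ S
            X⊆S v = D⊆S v ∘ Equivalence.to (X≐D v)
            X≈±R = incomparable X∈𝓜 rectangle∈𝓜 λ v v∈X → proj₁ (Equivalence.to (T-∧ {supp rectangle v}) (X⊆S v v∈X))
            same-support : X ≈ rectangle ⊎ X ≈ neg rectangle → corner j ∈ supp X
            same-support (inj₁ (≐⁺ , ≐⁻)) = [ ∈supp⁺ X _ ∘ Equivalence.from (≐⁺ (corner j)) , ∈supp⁻ X _ ∘ Equivalence.from (≐⁻ (corner j)) ]′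
              (∈supp⇒± rectangle (corner j) (corner∈ j))
            same-support (inj₂ (≐⁺ , ≐⁻)) = [ ∈supp⁻ X _ ∘ Equivalence.from (≐⁻ (corner j)) , ∈supp⁺ X _ ∘ Equivalence.from (≐⁺ (corner j)) ]′
              (∈supp⇒± rectangle (corner j) (corner∈ j))

-- Coordinates of a realization

module ProjectiveCoordinates {n d : ℕ} (w : C n → Fin d → ℝ) (i₀ : Fin n) where

  open Realization w

  -- In terms of coefficients: w(e) is not in the span of the vectors indexed by `P` unless `e`
  -- satisfies `P`.
  Flat : Pred (C n) 0ℓ → Set
  Flat P = ∀ {e} → ¬ P e → ∀ c → Relation c → (∀ f → ¬ P f → f ≢ e → c f ≈ᴿ 0ᴿ) → c e ≈ᴿ 0ᴿ

  -- Formulated for families that may repeat a vertex: in `proportional` the vertex `v` may coincide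
  -- with `⊖` or with a member of the basis.
  flat-family : ∀ {P} → Flat P → ∀ {m} (a : Fin m → ℝ) (p : Fin m → C n) →
                (∀ k → sum (λ j → a j *ᴿ w (p j) k) ≈ᴿ 0ᴿ) →
                ∀ i → ¬ P (p i) → (∀ j → j ≢ i → ¬ P (p j) → a j ≈ᴿ 0ᴿ) → a i ≈ᴿ 0ᴿ
  flat-family {P} flat a p rel i pᵢ∉ off = ≈-trans
    (≈-sym (formal-at a p i refl λ j j≢i pj≡pi → off j j≢i (pᵢ∉ ∘ subst P pj≡pi)))
    (flat pᵢ∉ (formal a p) (λ k → ≈-trans (∑-formal a p (λ v → w v k)) (rel k))
      λ f f∉ f≢pi → formal-off a p λ j pj≡f →
        off j (λ j≡i → f≢pi (≡.trans (≡.sym pj≡f) (cong p j≡i))) (f∉ ∘ subst P pj≡f))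

  unit : Fin n → C n
  unit i = flipAt i ⊕

  unit-self : ∀ i → lookup (unit i) i ≡ Sign.-
  unit-self i = ≡.trans (lookup-flipAt i ⊕) (cong opposite (⊕-lookup i))

  unit-other : ∀ {i l} → l ≢ i → lookup (unit i) l ≡ Sign.+
  unit-other {l = l} l≢i = ≡.trans (lookup-flipAt-≢ l≢i ⊕) (⊕-lookup l)

  basis : Fin (suc n) → C n
  basis = ⊕ ◂ unit

  comb : (Fin (suc n) → ℝ) → Fin d → ℝ
  comb x k = sum (λ j → x j *ᴿ w (basis j) k)

  comb-cong : ∀ {x y} → (∀ j → x j ≈ᴿ y j) → ∀ k → comb x k ≈ᴿ comb y k
  comb-cong {x} {y} x≈y k = R.sum-cong-≋ {x = λ j → x j *ᴿ w (basis j) k} {y = λ j → y j *ᴿ w (basis j) k} λ j → R.*-congʳ (x≈y j)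

  comb-+ : ∀ x y k → comb (λ j → x j +ᴿ y j) k ≈ᴿ comb x k +ᴿ comb y k
  comb-+ x y k = ≈-trans (R.sum-cong-≋ λ j → R.distribʳ (w (basis j) k) (x j) (y j))
    (R.∑-distrib-+ (λ j → x j *ᴿ w (basis j) k) (λ j → y j *ᴿ w (basis j) k))

  comb-* : ∀ a x k → comb (λ j → a *ᴿ x j) k ≈ᴿ a *ᴿ comb x k
  comb-* a x k = ≈-trans (R.sum-cong-≋ λ j → R.*-assoc a (x j) (w (basis j) k))
    (≈-sym (R.*-distribˡ-sum a (λ j → x j *ᴿ w (basis j) k)))

  open FiniteSum (↔-id (Fin (suc n))) Fin._≟_ using ()
    renaming (δ to κ; δ-≡ to κ-≡; δ-≢ to κ-≢)

  comb-κ : ∀ j k → comb (κ j) k ≈ᴿ w (basis j) k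
  comb-κ j k = ≈-trans (sum-single {f = λ l → κ j l *ᴿ w (basis l) k} j λ l l≢j → ≈0-*ˡ (κ-≢ l≢j))
    (≈-trans (R.*-congʳ (κ-≡ refl)) (R.*-identityˡ _))

  ⊖ : C n
  ⊖ = replicate _ Sign.-

  ⊖-lookup : ∀ i → lookup ⊖ i ≡ Sign.-
  ⊖-lookup i = Vec.lookup-replicate i Sign.-

  +≢- : ∀ {s : Sign} → s ≡ Sign.+ → s ≢ Sign.-
  +≢- refl ()

  plus⇒≢ : ∀ {v : C n} {i j} → lookup v i ≡ Sign.+ → lookup v j ≡ Sign.- → i ≢ j
  plus⇒≢ vᵢ≡+ vⱼ≡- refl = +≢- vᵢ≡+ vⱼ≡-

  ≢⊕⇒minus : ∀ {v : C n} → v ≢ ⊕ → ∃ λ l → lookup v l ≡ Sign.-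
  ≢⊕⇒minus v≢⊕ with ≢⇒differ v≢⊕
  ... | l , vₗ≢ = l , ≢⇒≡opposite {Sign.+} (λ +≡vₗ → vₗ≢ (≡.trans (≡.sym +≡vₗ) (≡.sym (⊕-lookup l))))

  minus⇒≢⊕ : ∀ {v : C n} {l} → lookup v l ≡ Sign.- → v ≢ ⊕
  minus⇒≢⊕ {l = l} vₗ≡- refl = +≢- (⊕-lookup l) vₗ≡-

  flip-minus : ∀ {v : C n} {i} → lookup v i ≡ Sign.+ → lookup (flipAt i v) i ≡ Sign.-
  flip-minus {v} {i} vᵢ≡+ = ≡.trans (lookup-flipAt i v) (cong opposite vᵢ≡+)

  flip≢⊕ : ∀ {v : C n} {i} → lookup v i ≡ Sign.+ → flipAt i v ≢ ⊕
  flip≢⊕ {v} {i} vᵢ≡+ = minus⇒≢⊕ (flip-minus {v} {i} vᵢ≡+)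

  flip-plus : ∀ {v : C n} {i l} → lookup v i ≡ Sign.+ → lookup (flipAt i v) l ≡ Sign.+ → l ≢ i × lookup v l ≡ Sign.+
  flip-plus {v} {i} {l} vᵢ≡+ vₗ≡+ = l≢i , ≡.trans (≡.sym (lookup-flipAt-≢ l≢i v)) vₗ≡+
    where
    l≢i : l ≢ i
    l≢i = plus⇒≢ {flipAt i v} vₗ≡+ (flip-minus {v} {i} vᵢ≡+)

  module _
    (facet : ∀ i s → Flat (Facet i s))
    (skewFacet : ∀ i l → i ≢ l → Flat (SkewFacet i l Sign.+))
    (rectangle-relation : ∀ p q i (p≢q : p ≢ q) (pᵢ≡qᵢ : lookup p i ≡ lookup q i) →
      ¬ ¬ ∃ λ (a : Fin 4 → ℝ) → (∀ j → a j ≉ᴿ 0ᴿ) ×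
        (∀ k → sum (λ j → a j *ᴿ w (Rectangle.corner p q i p≢q pᵢ≡qᵢ j) k) ≈ᴿ 0ᴿ))
    where

    -- `unit i` is the only basis vertex off the plus facet of `i`, so its coefficient vanishes.
    -- Once all of these are zero, the minus facet of `i₀`, which misses `⊕`, disposes of the last
    -- coefficient.
    basis-independent : ∀ x → (∀ k → comb x k ≈ᴿ 0ᴿ) → ∀ j → x j ≈ᴿ 0ᴿ
    basis-independent x rel (suc i) = flat-family (facet i Sign.+) x basis rel (suc i)
      (λ uᵢ≡+ → +≢- uᵢ≡+ (unit-self i)) others
      where
      others : ∀ j → j ≢ suc i → lookup (basis j) i ≢ Sign.+ → x j ≈ᴿ 0ᴿ
      others zero    _   ∉H = contradiction (⊕-lookup i) ∉H
      others (suc l) l≢i ∉H = contradiction (unit-other (l≢i ∘ cong suc ∘ ≡.sym)) ∉H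
    basis-independent x rel zero = flat-family (facet i₀ Sign.-) x basis rel zero
      (+≢- (⊕-lookup i₀)) others
      where
      others : ∀ j → j ≢ zero → lookup (basis j) i₀ ≢ Sign.- → x j ≈ᴿ 0ᴿ
      others zero    0≢0 _ = contradiction refl 0≢0
      others (suc l) _   _ = basis-independent x rel (suc l)

    record Coordinates (v : C n) : Set where
      field
        x         : Fin (suc n) → ℝ
        expansion : ∀ k → w v k ≈ᴿ comb x k
        at-plus   : ∀ i → lookup v i ≡ Sign.+ → x (suc i) ≈ᴿ 0ᴿ
        at-minus  : ∀ i → lookup v i ≡ Sign.- → x (suc i) ≉ᴿ 0ᴿ

    -- When `i` is flipped at `v`, the rectangle on `⊕`, `v`, `unit i` and the new vertex expresses
    -- the new vector by the three others. Its `i`-th coordinate comes from `unit i` alone and the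
    -- remaining unit coordinates are nonzero multiples of the old ones, so the support is exactly
    -- the minus set.
    coordinates : ∀ v → ¬ ¬ Coordinates v
    coordinates = cube-induction (λ v → ¬ ¬ Coordinates v) (pure base) step
      where
      base : Coordinates ⊕
      base = record
        { x = κ zero ; expansion = λ k → ≈-sym (comb-κ zero k)
        ; at-plus = λ i _ → κ-≢ {zero} {suc i} λ ()
        ; at-minus = λ i +≡- → contradiction +≡- (+≢- (⊕-lookup i)) }
      unit-coordinates : ∀ i → Coordinates (unit i)
      unit-coordinates i = record
        { x = κ (suc i) ; expansion = λ k → ≈-sym (comb-κ (suc i) k)
        ; at-plus = λ l uₗ≡+ → κ-≢ λ l≡i → +≢- (subst (λ z → lookup (unit i) z ≡ Sign.+) (Fin.suc-injective l≡i) uₗ≡+) (unit-self i)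
        ; at-minus = λ l uₗ≡- κ≈0 → 1≉0 (≈-trans (≈-sym (κ-≡ (cong suc (decidable-stable (l Fin.≟ i)
            λ l≢i → +≢- (unit-other l≢i) uₗ≡-)))) κ≈0) }
      step : ∀ v i → lookup v i ≡ Sign.+ → ¬ ¬ Coordinates v → ¬ ¬ Coordinates (flipAt i v)
      step v i vᵢ≡+ ¬¬coords with ⊕ ≟ᶜ v
      -- At `v = ⊕` the rectangle degenerates, but the new vertex is a basis vertex.
      ... | yes refl = pure (unit-coordinates i)
      ... | no ⊕≢v = do
          coords ← ¬¬coords
          a , a≉0 , rel ← rectangle-relation ⊕ v i ⊕≢v (≡.trans (⊕-lookup i) (≡.sym vᵢ≡+))
          r , ar≈1 ← inverse (a≉0 (suc (suc (suc zero))))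
          pure (extend coords a a≉0 rel r ar≈1)
        where
        open Rectangle ⊕ v i ⊕≢v (≡.trans (⊕-lookup i) (≡.sym vᵢ≡+))
        extend : Coordinates v → (a : Fin 4 → ℝ) → (∀ j → a j ≉ᴿ 0ᴿ) →
                 (∀ k → sum (λ j → a j *ᴿ w (corner j) k) ≈ᴿ 0ᴿ) →
                 ∀ r → a (suc (suc (suc zero))) *ᴿ r ≈ᴿ 1ᴿ → Coordinates (flipAt i v)
        extend coords a a≉0 rel r a₃r≈1 = record
          { x = x′ ; expansion = expansion′ ; at-plus = at-plus′ ; at-minus = at-minus′ }
          where
          open Coordinates coords
          a₀ = a zero
          a₁ = a (suc zero)
          a₂ = a (suc (suc zero))
          a₃ = a (suc (suc (suc zero)))
          -- `y` collects the first three terms of the relation, so the new vector is `−y` divided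
          -- by `a₃`; `r` is the reciprocal of `a₃`.
          y x′ : Fin (suc n) → ℝ
          y j = a₀ *ᴿ κ zero j +ᴿ (a₁ *ᴿ x j +ᴿ a₂ *ᴿ κ (suc i) j)
          x′ j = -ᴿ r *ᴿ y j
          y-other : ∀ {l} → l ≢ i → y (suc l) ≈ᴿ a₁ *ᴿ x (suc l)
          y-other {l} l≢i = ≈-trans
            (R.+-cong (≈0-*ʳ (κ-≢ {zero} {suc l} λ ())) (R.+-congˡ (≈0-*ʳ (κ-≢ (l≢i ∘ Fin.suc-injective)))))
            (≈-trans (R.+-identityˡ _) (R.+-identityʳ _))
          y-self : y (suc i) ≈ᴿ a₂
          y-self = ≈-trans
            (R.+-cong (≈0-*ʳ (κ-≢ {zero} {suc i} λ ()))
              (R.+-cong (≈0-*ʳ (at-plus i vᵢ≡+)) (≈-trans (R.*-congˡ (κ-≡ refl)) (R.*-identityʳ a₂))))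
            (≈-trans (R.+-identityˡ _) (R.+-identityˡ _))
          y≈0 : ∀ {j} → x′ j ≈ᴿ 0ᴿ → y j ≈ᴿ 0ᴿ
          y≈0 = *-cancelˡ-≈0 (-≉0 (unitʳ≉0 a₃r≈1))
          expansion′ : ∀ k → w (flipAt i v) k ≈ᴿ comb x′ k
          expansion′ k = begin
            w′                                        ≈⟨ R.*-identityˡ w′ ⟨
            1ᴿ *ᴿ w′                                  ≈⟨ R.*-congʳ a₃r≈1 ⟨
            (a₃ *ᴿ r) *ᴿ w′                           ≈⟨ solve 9 (λ r a b c d t u s z → (d :* r) :* s :=
                r :* (a :* t :+ (b :* u :+ (c :* z :+ (d :* s :+ con 0ℚ)))) :+ (:- r) :* (a :* t :+ (b :* u :+ c :* z))) ≈-refl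
                r a₀ a₁ a₂ a₃ (w ⊕ k) (w v k) w′ (w (unit i) k) ⟩
            r *ᴿ (a₀ *ᴿ w ⊕ k +ᴿ (a₁ *ᴿ w v k +ᴿ (a₂ *ᴿ w (unit i) k +ᴿ (a₃ *ᴿ w′ +ᴿ 0ᴿ)))) +ᴿ -ᴿ r *ᴿ (a₀ *ᴿ w ⊕ k +ᴿ (a₁ *ᴿ w v k +ᴿ a₂ *ᴿ w (unit i) k))
                                                      ≈⟨ R.+-congʳ (≈0-*ʳ (rel k)) ⟩
            0ᴿ +ᴿ -ᴿ r *ᴿ (a₀ *ᴿ w ⊕ k +ᴿ (a₁ *ᴿ w v k +ᴿ a₂ *ᴿ w (unit i) k))
                                                      ≈⟨ R.+-identityˡ _ ⟩
            -ᴿ r *ᴿ (a₀ *ᴿ w ⊕ k +ᴿ (a₁ *ᴿ w v k +ᴿ a₂ *ᴿ w (unit i) k))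
                                                      ≈⟨ R.*-congˡ (R.+-cong (term a₀ zero)
                                                           (R.+-cong (≈-trans (R.*-congˡ (expansion k)) (≈-sym (comb-* a₁ x k))) (term a₂ (suc i)))) ⟩
            -ᴿ r *ᴿ (comb (λ j → a₀ *ᴿ κ zero j) k +ᴿ (comb (λ j → a₁ *ᴿ x j) k +ᴿ comb (λ j → a₂ *ᴿ κ (suc i) j) k))
                                                      ≈⟨ R.*-congˡ (≈-trans (comb-+ (λ j → a₀ *ᴿ κ zero j) (λ j → a₁ *ᴿ x j +ᴿ a₂ *ᴿ κ (suc i) j) k)
                                                           (R.+-congˡ (comb-+ (λ j → a₁ *ᴿ x j) (λ j → a₂ *ᴿ κ (suc i) j) k))) ⟨
            -ᴿ r *ᴿ comb y k                          ≈⟨ comb-* (-ᴿ r) y k ⟨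
            comb x′ k                                 ∎
            where
            open SetoidReasoning ℝ-setoid
            w′ = w (flipAt i v) k
            term : ∀ b j → b *ᴿ w (basis j) k ≈ᴿ comb (λ l → b *ᴿ κ j l) k
            term b j = ≈-trans (R.*-congˡ (≈-sym (comb-κ j k))) (≈-sym (comb-* b (κ j) k))
          at-plus′ : ∀ l → lookup (flipAt i v) l ≡ Sign.+ → x′ (suc l) ≈ᴿ 0ᴿ
          at-plus′ l v′ₗ≡+ = let (l≢i , vₗ≡+) = flip-plus {v} {i} vᵢ≡+ v′ₗ≡+ in
            ≈0-*ʳ (≈-trans (y-other l≢i) (≈0-*ʳ (at-plus l vₗ≡+)))
          at-minus′ : ∀ l → lookup (flipAt i v) l ≡ Sign.- → x′ (suc l) ≉ᴿ 0ᴿ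
          at-minus′ l v′ₗ≡- x′ₗ≈0 = by-case (l Fin.≟ i)
            where
            by-case : Dec (l ≡ i) → ⊥
            by-case (yes refl) = a≉0 (suc (suc zero)) (≈-trans (≈-sym y-self) (y≈0 {suc i} x′ₗ≈0))
            by-case (no l≢i) = *≉0 (a≉0 (suc zero)) (at-minus l (≡.trans (≡.sym (lookup-flipAt-≢ l≢i v)) v′ₗ≡-))
              (≈-trans (≈-sym (y-other l≢i)) (y≈0 {suc l} x′ₗ≈0))

    m : Sign → ℝ
    m Sign.+ = 0ᴿ
    m Sign.- = 1ᴿ

    -- Rescaling to the indicator of the minus set

    module Scaled (coords : ∀ v → Coordinates v) where

      x : C n → Fin (suc n) → ℝ
      x v = Coordinates.x (coords v)

      -- `⊖` is the reference vertex because its minus set is everything, so that no `y i` vanishes.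
      y : Fin n → ℝ
      y i = x ⊖ (suc i)

      y≉0 : ∀ i → y i ≉ᴿ 0ᴿ
      y≉0 i = Coordinates.at-minus (coords ⊖) i (⊖-lookup i)

      -- v and ⊖ lie on the skew-facet v(i) = v(l), while the i-th unit vertex does not.
      proportional : ∀ v {i l} → lookup v i ≡ Sign.- → lookup v l ≡ Sign.- →
                     x v (suc l) *ᴿ y i ≈ᴿ y l *ᴿ x v (suc i)
      proportional v {i} {l} vᵢ≡- vₗ≡- = by-case (i Fin.≟ l)
        where
        by-case : Dec (i ≡ l) → x v (suc l) *ᴿ y i ≈ᴿ y l *ᴿ x v (suc i)
        by-case (yes refl) = R.*-comm (x v (suc i)) (y i)
        by-case (no i≢l) = -≈0⇒≈ (-≈0⇒≈0 (flat-family (skewFacet i l i≢l) a p rel (suc (suc (suc i)))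
            (λ e → +≢- (unit-other (i≢l ∘ ≡.sym)) (≡.trans (≡.sym e) (unit-self i))) off))
          where
          -- This combination of the coordinates of `⊖` and `v` is made to vanish at `l`. In the
          -- resulting relation `unit i` is the only vertex off the skew-facet that can have a
          -- nonzero coefficient, so `b (suc i)` vanishes too, which is the claim.
          b : Fin (suc n) → ℝ
          b j = x v (suc l) *ᴿ x ⊖ j +ᴿ -ᴿ (y l *ᴿ x v j)
          a : Fin (3 ℕ.+ n) → ℝ
          a = x v (suc l) ◂ ((-ᴿ y l) ◂ λ j → -ᴿ b j)
          p : Fin (3 ℕ.+ n) → C n
          p = ⊖ ◂ (v ◂ basis)
          rel : ∀ k → sum (λ j → a j *ᴿ w (p j) k) ≈ᴿ 0ᴿ
          rel k = begin
            x v (suc l) *ᴿ w ⊖ k +ᴿ (-ᴿ y l *ᴿ w v k +ᴿ comb (λ j → -ᴿ b j) k)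
              ≈⟨ R.+-cong (R.*-congˡ (Coordinates.expansion (coords ⊖) k))
                   (R.+-cong (R.*-congˡ (Coordinates.expansion (coords v) k)) comb-b) ⟩
            x v (suc l) *ᴿ comb (x ⊖) k +ᴿ (-ᴿ y l *ᴿ comb (x v) k +ᴿ (-ᴿ x v (suc l) *ᴿ comb (x ⊖) k +ᴿ y l *ᴿ comb (x v) k))
              ≈⟨ solve 4 (λ s t f g → s :* f :+ ((:- t) :* g :+ ((:- s) :* f :+ t :* g)) := con 0ℚ) ≈-refl
                   (x v (suc l)) (y l) (comb (x ⊖) k) (comb (x v) k) ⟩
            0ᴿ ∎
            where
            open SetoidReasoning ℝ-setoid
            comb-b : comb (λ j → -ᴿ b j) k ≈ᴿ -ᴿ x v (suc l) *ᴿ comb (x ⊖) k +ᴿ y l *ᴿ comb (x v) k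
            comb-b = ≈-trans (comb-cong {λ j → -ᴿ b j} {λ j → -ᴿ x v (suc l) *ᴿ x ⊖ j +ᴿ y l *ᴿ x v j}
                (λ j → solve 4 (λ s t f g → :- (s :* f :- t :* g) := (:- s) :* f :+ t :* g) ≈-refl
                         (x v (suc l)) (y l) (x ⊖ j) (x v j)) k)
              (≈-trans (comb-+ (λ j → -ᴿ x v (suc l) *ᴿ x ⊖ j) (λ j → y l *ᴿ x v j) k)
                (R.+-cong (comb-* (-ᴿ x v (suc l)) (x ⊖) k) (comb-* (y l) (x v) k)))
          off : ∀ j → j ≢ suc (suc (suc i)) → lookup (p j) i ≢ lookup (p j) l → a j ≈ᴿ 0ᴿ
          off zero             _   ∉H = contradiction (≡.trans (⊖-lookup i) (≡.sym (⊖-lookup l))) ∉H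
          off (suc zero)       _   ∉H = contradiction (≡.trans vᵢ≡- (≡.sym vₗ≡-)) ∉H
          off (suc (suc zero)) _   ∉H = contradiction (≡.trans (⊕-lookup i) (≡.sym (⊕-lookup l))) ∉H
          off (suc (suc (suc r))) r≢i ∉H = at-unit (r Fin.≟ l)
            where
            at-unit : Dec (r ≡ l) → -ᴿ b (suc r) ≈ᴿ 0ᴿ
            at-unit (yes refl) = -≈0 (≈⇒-≈0 (R.*-comm (x v (suc l)) (y l)))
            at-unit (no r≢l) = contradiction
              (≡.trans (unit-other {r} {i} (λ { refl → r≢i refl })) (≡.sym (unit-other {r} {l} (r≢l ∘ ≡.sym)))) ∉H

      normal : ℝ → C n → Fin (suc n) → ℝ
      normal t v = t ◂ λ i → m (lookup v i) *ᴿ y i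

      record Normalized (v : C n) : Set where
        field
          ν t       : ℝ
          ν≉0       : ν ≉ᴿ 0ᴿ
          expansion : ∀ k → w v k ≈ᴿ ν *ᴿ comb (normal t v) k
          t-⊕       : v ≡ ⊕ → t ≈ᴿ 1ᴿ

      w-⊕ : ∀ t k → comb (normal t ⊕) k ≈ᴿ t *ᴿ w ⊕ k
      w-⊕ t k = ≈-trans (R.+-congˡ {t *ᴿ w ⊕ k} (sum-≈0 {f = λ i → (m (lookup ⊕ i) *ᴿ y i) *ᴿ w (unit i) k}
          λ i → ≈0-*ˡ (≈0-*ˡ (≈-reflexive (cong m (⊕-lookup i)))))) (R.+-identityʳ _)

      -- A minus coordinate `l` fixes the scalar: `ν` is `x v (suc l)` divided by `y l`, and `t` is
      -- `x v zero` divided by `ν`; by `proportional` the choice of `l` does not matter. At `⊕` the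
      -- scalar is free, and `t = 1` is chosen.
      normalize : ∀ v → ¬ ¬ Normalized v
      normalize v with v ≟ᶜ ⊕
      ... | yes refl = pure record
              { ν = 1ᴿ ; t = 1ᴿ ; ν≉0 = 1≉0 ; t-⊕ = λ _ → ≈-refl
              ; expansion = λ k → ≈-sym (≈-trans (R.*-identityˡ _) (≈-trans (w-⊕ 1ᴿ k) (R.*-identityˡ _))) }
      ... | no v≢⊕ = do
              let (l , vₗ≡-) = ≢⊕⇒minus v≢⊕
              r , xr≈1 ← inverse (Coordinates.at-minus (coords v) l vₗ≡-)
              s , ys≈1 ← inverse (y≉0 l)
              pure record
                { ν = x v (suc l) *ᴿ s ; t = x v zero *ᴿ (r *ᴿ y l)
                ; ν≉0 = *≉0 (unit≉0 xr≈1) (unitʳ≉0 ys≈1)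
                ; expansion = λ k → ≈-trans (Coordinates.expansion (coords v) k)
                    (≈-trans (comb-cong (coefficients l vₗ≡- r s xr≈1 ys≈1) k) (comb-* _ (normal (x v zero *ᴿ (r *ᴿ y l)) v) k))
                ; t-⊕ = λ v≡⊕ → contradiction v≡⊕ v≢⊕ }
        where
        coefficients : ∀ l → lookup v l ≡ Sign.- → ∀ r s → x v (suc l) *ᴿ r ≈ᴿ 1ᴿ → y l *ᴿ s ≈ᴿ 1ᴿ →
                       ∀ j → x v j ≈ᴿ (x v (suc l) *ᴿ s) *ᴿ normal (x v zero *ᴿ (r *ᴿ y l)) v j
        coefficients l vₗ≡- r s xr≈1 ys≈1 zero = begin
          x v zero                            ≈⟨ solve 1 (λ a → a := a :* con 1ℚ :* con 1ℚ) ≈-refl (x v zero) ⟩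
          x v zero *ᴿ 1ᴿ *ᴿ 1ᴿ                ≈⟨ R.*-cong (R.*-congˡ (≈-sym xr≈1)) (≈-sym ys≈1) ⟩
          x v zero *ᴿ (x v (suc l) *ᴿ r) *ᴿ (y l *ᴿ s)
            ≈⟨ solve 5 (λ a b r c s → a :* (b :* r) :* (c :* s) := (b :* s) :* (a :* (r :* c))) ≈-refl
                 (x v zero) (x v (suc l)) r (y l) s ⟩
          (x v (suc l) *ᴿ s) *ᴿ (x v zero *ᴿ (r *ᴿ y l)) ∎
          where open SetoidReasoning ℝ-setoid
        coefficients l vₗ≡- r s xr≈1 ys≈1 (suc i) with lookup v i in vᵢ
        ... | Sign.+ = ≈-trans (Coordinates.at-plus (coords v) i vᵢ) (≈-sym (≈0-*ʳ (R.zeroˡ (y i))))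
        ... | Sign.- = begin
          x v (suc i)                              ≈⟨ R.*-identityʳ _ ⟨
          x v (suc i) *ᴿ 1ᴿ                        ≈⟨ R.*-congˡ ys≈1 ⟨
          x v (suc i) *ᴿ (y l *ᴿ s)                ≈⟨ solve 3 (λ a b s → a :* (b :* s) := (b :* a) :* s) ≈-refl (x v (suc i)) (y l) s ⟩
          (y l *ᴿ x v (suc i)) *ᴿ s                ≈⟨ R.*-congʳ (proportional v vᵢ vₗ≡-) ⟨
          (x v (suc l) *ᴿ y i) *ᴿ s                ≈⟨ solve 3 (λ a b s → (a :* b) :* s := (a :* s) :* (con 1ℚ :* b)) ≈-refl (x v (suc l)) (y i) s ⟩
          (x v (suc l) *ᴿ s) *ᴿ (1ᴿ *ᴿ y i)        ∎
          where open SetoidReasoning ℝ-setoid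

      -- Modularity of `t` and its defect at `⊕`

      module Modular (norm : ∀ v → Normalized v) where

        open module N v = Normalized (norm v) using (ν; t; ν≉0)

        -- `a` and `b` are the coefficients, in the normalized vectors, of the lowest corner `v` and
        -- of the corner opposite to it; the two remaining corners both have coefficient `−b`, which
        -- `t-sum` has built in.
        record Square (v : C n) (i j : Fin n) : Set where
          field
            a b   : ℝ
            a≉0   : a ≉ᴿ 0ᴿ
            b≉0   : b ≉ᴿ 0ᴿ
            t-sum : a *ᴿ t v +ᴿ b *ᴿ (t (flipAt i (flipAt j v)) +ᴿ -ᴿ (t (flipAt i v) +ᴿ t (flipAt j v))) ≈ᴿ 0ᴿ
            a≈b   : v ≢ ⊕ → a ≈ᴿ b

        -- Coordinates `i` and `j` of the relation give the two coefficients `−b`. A minus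
        -- coordinate of `v` sees all four corners equally, so the coefficients sum to zero and `a`
        -- equals `b`; at `⊕` no such coordinate exists.
        square : ∀ v {i j} → i ≢ j → lookup v i ≡ Sign.+ → lookup v j ≡ Sign.+ → ¬ ¬ Square v i j
        square v {i} {j} i≢j vᵢ≡+ vⱼ≡+ = do
            a , a≉0 , rel ← rectangle-relation v vⱼ i v≢vⱼ (≡.sym vⱼᵢ)
            pure (from-relation a a≉0 rel)
          where
          vᵢ vⱼ vᵢⱼ : C n
          vᵢ = flipAt i v
          vⱼ = flipAt j v
          vᵢⱼ = flipAt i vⱼ
          v≢vⱼ : v ≢ vⱼ
          v≢vⱼ = v≢flipAt refl
          vⱼᵢ : lookup vⱼ i ≡ lookup v i
          vⱼᵢ = lookup-flipAt-≢ i≢j v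
          open Rectangle v vⱼ i v≢vⱼ (≡.sym vⱼᵢ)
          from-relation : (a : Fin 4 → ℝ) → (∀ r → a r ≉ᴿ 0ᴿ) →
                          (∀ k → sum (λ r → a r *ᴿ w (corner r) k) ≈ᴿ 0ᴿ) → Square v i j
          from-relation a a≉0 rel = record
            { a = c₀ ; b = c₃ ; a≉0 = *≉0 (a≉0 zero) (ν≉0 v) ; b≉0 = *≉0 (a≉0 (suc (suc (suc zero)))) (ν≉0 vᵢⱼ)
            ; t-sum = ≈-trans (solve 8 (λ a b c d p q r s → a :* p :+ d :* (s :- (r :+ q)) :=
                  (a :* p :+ (b :* q :+ (c :* r :+ d :* s))) :- ((b :+ d) :* q :+ (c :+ d) :* r)) ≈-refl
                  c₀ c₁ c₂ c₃ (t v) (t vⱼ) (t vᵢ) (t vᵢⱼ))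
                (+≈0 (coefficient-sum≈0 zero) (-≈0 (+≈0 (≈0-*ˡ b+d≈0) (≈0-*ˡ c+d≈0))))
            ; a≈b = λ v≢⊕ → let (l , vₗ≡-) = ≢⊕⇒minus v≢⊕ in -≈0⇒≈ (≈-trans
                (solve 4 (λ a b c d → a :- d := (a :+ (b :+ (c :+ d))) :- ((b :+ d) :+ (c :+ d))) ≈-refl c₀ c₁ c₂ c₃)
                (+≈0 (at-minus l vₗ≡-) (-≈0 (+≈0 b+d≈0 c+d≈0)))) }
            where
            c₀ c₁ c₂ c₃ : ℝ
            c₀ = a zero *ᴿ ν v
            c₁ = a (suc zero) *ᴿ ν vⱼ
            c₂ = a (suc (suc zero)) *ᴿ ν vᵢ
            c₃ = a (suc (suc (suc zero))) *ᴿ ν vᵢⱼ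
            N₀ N₁ N₂ N₃ : Fin (suc n) → ℝ
            N₀ = normal (t v) v
            N₁ = normal (t vⱼ) vⱼ
            N₂ = normal (t vᵢ) vᵢ
            N₃ = normal (t vᵢⱼ) vᵢⱼ
            coefficient-sum≈0 : ∀ r → c₀ *ᴿ N₀ r +ᴿ (c₁ *ᴿ N₁ r +ᴿ (c₂ *ᴿ N₂ r +ᴿ c₃ *ᴿ N₃ r)) ≈ᴿ 0ᴿ
            coefficient-sum≈0 = basis-independent _ λ k → begin
              comb (λ r → c₀ *ᴿ N₀ r +ᴿ (c₁ *ᴿ N₁ r +ᴿ (c₂ *ᴿ N₂ r +ᴿ c₃ *ᴿ N₃ r))) k
                ≈⟨ ≈-trans (comb-+ (λ r → c₀ *ᴿ N₀ r) (λ r → c₁ *ᴿ N₁ r +ᴿ (c₂ *ᴿ N₂ r +ᴿ c₃ *ᴿ N₃ r)) k) (R.+-congˡ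
                   (≈-trans (comb-+ (λ r → c₁ *ᴿ N₁ r) (λ r → c₂ *ᴿ N₂ r +ᴿ c₃ *ᴿ N₃ r) k) (R.+-congˡ
                   (comb-+ (λ r → c₂ *ᴿ N₂ r) (λ r → c₃ *ᴿ N₃ r) k)))) ⟩
              comb (λ r → c₀ *ᴿ N₀ r) k +ᴿ (comb (λ r → c₁ *ᴿ N₁ r) k +ᴿ (comb (λ r → c₂ *ᴿ N₂ r) k +ᴿ comb (λ r → c₃ *ᴿ N₃ r) k))
                ≈⟨ R.+-cong (term v (a zero) k) (R.+-cong (term vⱼ (a (suc zero)) k)
                     (R.+-cong (term vᵢ (a (suc (suc zero))) k)
                       (≈-trans (term vᵢⱼ (a (suc (suc (suc zero)))) k) (≈-sym (R.+-identityʳ _))))) ⟩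
              sum (λ r → a r *ᴿ w (corner r) k)
                ≈⟨ rel k ⟩
              0ᴿ ∎
              where
              open SetoidReasoning ℝ-setoid
              term : ∀ u b k → comb (λ r → (b *ᴿ ν u) *ᴿ normal (t u) u r) k ≈ᴿ b *ᴿ w u k
              term u b k = ≈-trans (comb-* (b *ᴿ ν u) (normal (t u) u) k)
                (≈-trans (R.*-assoc b (ν u) _) (R.*-congˡ (≈-sym (Normalized.expansion (norm u) k))))
            at : ∀ l {s₀ s₁ s₂ s₃} → lookup v l ≡ s₀ → lookup vⱼ l ≡ s₁ → lookup vᵢ l ≡ s₂ → lookup vᵢⱼ l ≡ s₃ →
                 c₀ *ᴿ m s₀ +ᴿ (c₁ *ᴿ m s₁ +ᴿ (c₂ *ᴿ m s₂ +ᴿ c₃ *ᴿ m s₃)) ≈ᴿ 0ᴿ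
            at l refl refl refl refl = *-cancelˡ-≈0 (y≉0 l) (≈-trans
              (solve 9 (λ y a b c d p q r s → y :* (a :* p :+ (b :* q :+ (c :* r :+ d :* s))) :=
                 a :* (p :* y) :+ (b :* (q :* y) :+ (c :* (r :* y) :+ d :* (s :* y)))) ≈-refl
                 (y l) c₀ c₁ c₂ c₃ (m (lookup v l)) (m (lookup vⱼ l)) (m (lookup vᵢ l)) (m (lookup vᵢⱼ l)))
              (coefficient-sum≈0 (suc l)))
            c+d≈0 : c₂ +ᴿ c₃ ≈ᴿ 0ᴿ
            c+d≈0 = ≈-trans (solve 4 (λ a b c d → c :+ d := a :* con 0ℚ :+ (b :* con 0ℚ :+ (c :* con 1ℚ :+ d :* con 1ℚ))) ≈-refl c₀ c₁ c₂ c₃)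
              (at i vᵢ≡+ (≡.trans vⱼᵢ vᵢ≡+) (flip-minus {v} vᵢ≡+) (flip-minus {vⱼ} (≡.trans vⱼᵢ vᵢ≡+)))
            b+d≈0 : c₁ +ᴿ c₃ ≈ᴿ 0ᴿ
            b+d≈0 = ≈-trans (solve 4 (λ a b c d → b :+ d := a :* con 0ℚ :+ (b :* con 1ℚ :+ (c :* con 0ℚ :+ d :* con 1ℚ))) ≈-refl c₀ c₁ c₂ c₃)
              (at j vⱼ≡+ (flip-minus {v} vⱼ≡+) (≡.trans (lookup-flipAt-≢ (i≢j ∘ ≡.sym) v) vⱼ≡+)
                (≡.trans (lookup-flipAt-≢ (i≢j ∘ ≡.sym) vⱼ) (flip-minus {v} vⱼ≡+)))
            at-minus : ∀ l → lookup v l ≡ Sign.- → c₀ +ᴿ (c₁ +ᴿ (c₂ +ᴿ c₃)) ≈ᴿ 0ᴿ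
            at-minus l vₗ≡- = ≈-trans (solve 4 (λ a b c d → a :+ (b :+ (c :+ d)) :=
                a :* con 1ℚ :+ (b :* con 1ℚ :+ (c :* con 1ℚ :+ d :* con 1ℚ))) ≈-refl c₀ c₁ c₂ c₃)
              (at l vₗ≡- vⱼₗ (≡.trans (lookup-flipAt-≢ l≢i v) vₗ≡-) (≡.trans (lookup-flipAt-≢ l≢i vⱼ) vⱼₗ))
              where
              l≢i : l ≢ i
              l≢i = plus⇒≢ {v} vᵢ≡+ vₗ≡- ∘ ≡.sym
              l≢j : l ≢ j
              l≢j = plus⇒≢ {v} vⱼ≡+ vₗ≡- ∘ ≡.sym
              vⱼₗ : lookup vⱼ l ≡ Sign.-
              vⱼₗ = ≡.trans (lookup-flipAt-≢ l≢j v) vₗ≡-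

        modular : ∀ {v i j} → v ≢ ⊕ → i ≢ j → lookup v i ≡ Sign.+ → lookup v j ≡ Sign.+ →
                  t v +ᴿ t (flipAt i (flipAt j v)) ≈ᴿ t (flipAt i v) +ᴿ t (flipAt j v)
        modular {v} {i} {j} v≢⊕ i≢j vᵢ≡+ vⱼ≡+ = -≈0⇒≈ (≈0-stable λ ≉0 →
          square v i≢j vᵢ≡+ vⱼ≡+ λ sq → let open Square sq in
          *≉0 b≉0 ≉0 (≈-trans (solve 4 (λ b p s q → b :* ((p :+ s) :- q) := b :* p :+ b :* (s :- q)) ≈-refl b _ _ _)
            (≈-trans (R.+-congʳ (R.*-congʳ (≈-sym (a≈b v≢⊕)))) t-sum)))

        excess : Fin n → Fin n → ℝ
        excess i j = t (flipAt i (unit j)) +ᴿ -ᴿ (t (unit i) +ᴿ t (unit j))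

        -- Since `t ⊕` is one, the relation at `⊕` says that `a` plus `b` times the excess is zero,
        -- while `a` is not.
        excess≉0 : ∀ {i j} → i ≢ j → excess i j ≉ᴿ 0ᴿ
        excess≉0 {i} {j} i≢j ≈0 = square ⊕ i≢j (⊕-lookup i) (⊕-lookup j) λ sq → let open Square sq in
          *≉0 a≉0 1≉0 (≈-trans (R.*-congˡ (≈-sym (Normalized.t-⊕ (norm ⊕) refl)))
            (≈-trans (≈-sym (≈-trans (R.+-congˡ (≈0-*ʳ ≈0)) (R.+-identityʳ _))) t-sum))

        excess-sym : ∀ {i j} → i ≢ j → excess i j ≈ᴿ excess j i
        excess-sym {i} {j} i≢j = R.+-cong (≈-reflexive (cong t (flipAt-comm i≢j ⊕))) (R.-‿cong (R.+-comm _ _))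

        -- Compares the modular laws of the two faces of the 3-cube on `i`, `j`, `k` whose lowest
        -- vertices are `unit i` and `unit j`. Both contain the values at the vertices with minus
        -- sets {i,j,k} and {i,j}, which cancel in the difference.
        excess-exchange : ∀ {i j k} → i ≢ j → i ≢ k → j ≢ k → excess i k ≈ᴿ excess j k
        excess-exchange {i} {j} {k} i≢j i≢k j≢k = -≈0⇒≈ (begin
          excess i k +ᴿ -ᴿ excess j k
            ≈⟨ solve 7 (λ tik tjk ti tj tk tijk tij →
                 (tik :- (ti :+ tk)) :- (tjk :- (tj :+ tk)) :=
                 ((tj :+ tijk) :- (tjk :+ tij)) :- ((ti :+ tijk) :- (tik :+ tij))) ≈-refl
                 (t (flipAt i (unit k))) (t (flipAt j (unit k))) (t (unit i)) (t (unit j)) (t (unit k))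
                 (t (flipAt k (flipAt j (unit i)))) (t (flipAt j (unit i))) ⟩
          _ ≈⟨ +≈0 (≈⇒-≈0 at-j) (-≈0 (≈⇒-≈0 at-i)) ⟩
          0ᴿ ∎)
          where
          open SetoidReasoning ℝ-setoid
          at-i : t (unit i) +ᴿ t (flipAt k (flipAt j (unit i))) ≈ᴿ t (flipAt i (unit k)) +ᴿ t (flipAt j (unit i))
          at-i = ≈-trans (modular (flip≢⊕ {⊕} (⊕-lookup i)) (j≢k ∘ ≡.sym) (unit-other (i≢k ∘ ≡.sym)) (unit-other (i≢j ∘ ≡.sym)))
            (R.+-congʳ (≈-reflexive (cong t (flipAt-comm (i≢k ∘ ≡.sym) ⊕))))
          at-j : t (unit j) +ᴿ t (flipAt k (flipAt j (unit i))) ≈ᴿ t (flipAt j (unit k)) +ᴿ t (flipAt j (unit i))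
          at-j = ≈-trans (R.+-congˡ (≈-reflexive (cong (t ∘ flipAt k) (flipAt-comm (i≢j ∘ ≡.sym) ⊕))))
            (≈-trans (modular (flip≢⊕ {⊕} (⊕-lookup j)) (i≢k ∘ ≡.sym) (unit-other (j≢k ∘ ≡.sym)) (unit-other i≢j))
              (R.+-cong (≈-reflexive (cong t (flipAt-comm (j≢k ∘ ≡.sym) ⊕))) (≈-reflexive (cong t (flipAt-comm i≢j ⊕)))))

        common-excess : ∃ λ c → c ≉ᴿ 0ᴿ × (∀ {i j} → i ≢ j → excess i j ≈ᴿ c)
        common-excess with Fin.any? (λ i → ¬? (i Fin.≟ i₀))
        -- In dimension one there is no pair of directions, and any nonzero constant will do.
        ... | no none = 1ᴿ , 1≉0 , λ {i} {j} i≢j →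
                contradiction (≡.trans (only i) (≡.sym (only j))) i≢j
          where
          only : ∀ i → i ≡ i₀
          only i = decidable-stable (i Fin.≟ i₀) λ i≢i₀ → none (i , i≢i₀)
        ... | yes (i₁ , i₁≢i₀) = excess i₁ i₀ , excess≉0 i₁≢i₀ , equal
          where
          exchange : ∀ {i j k} → i ≢ k → j ≢ k → excess i k ≈ᴿ excess j k
          exchange {i} {j} i≢k j≢k = by-case (i Fin.≟ j)
            where
            by-case : Dec (i ≡ j) → _
            by-case (yes refl) = ≈-refl
            by-case (no i≢j)   = excess-exchange i≢j i≢k j≢k
          equal : ∀ {i k} → i ≢ k → excess i k ≈ᴿ excess i₁ i₀
          equal {i} {k} i≢k with k Fin.≟ i₀
          ... | yes refl = exchange i≢k i₁≢i₀
          -- The first index can be exchanged and the excess is symmetric: from (i, k) to (i₀, k),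
          -- then (k, i₀), then (i₁, i₀).
          ... | no k≢i₀ = ≈-trans (exchange i≢k (k≢i₀ ∘ ≡.sym))
                  (≈-trans (excess-sym (k≢i₀ ∘ ≡.sym)) (exchange k≢i₀ i₁≢i₀))

        -- Rescaling at `⊕` and affine dependencies

        module Renormalized (c r : ℝ) (c≉0 : c ≉ᴿ 0ᴿ) (cr≈1 : c *ᴿ r ≈ᴿ 1ᴿ)
                            (excess≈c : ∀ {i j} → i ≢ j → excess i j ≈ᴿ c) where

          -- `h` corrects `t` at `⊕` only. As the excess is `c` for every pair of directions, the
          -- value `−c` is the one that makes the modular law hold at `⊕` as well.
          record Choice (v : C n) : Set where
            field
              μ h       : ℝ
              μ≉0       : μ ≉ᴿ 0ᴿ
              expansion : ∀ k → w v k ≈ᴿ μ *ᴿ comb (normal h v) k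
              h-⊕       : v ≡ ⊕ → h ≈ᴿ -ᴿ c
              h-t       : v ≢ ⊕ → h ≈ᴿ t v

          choice : ∀ v → Choice v
          choice v with v ≟ᶜ ⊕
          ... | no v≢⊕ = record
                  { μ = ν v ; h = t v ; μ≉0 = ν≉0 v ; expansion = Normalized.expansion (norm v)
                  ; h-⊕ = λ v≡⊕ → contradiction v≡⊕ v≢⊕ ; h-t = λ _ → ≈-refl }
          ... | yes refl = record
                  { μ = -ᴿ r ; h = -ᴿ c ; μ≉0 = -≉0 (unitʳ≉0 cr≈1)
                  ; expansion = λ k → ≈-sym (≈-trans (R.*-congˡ (w-⊕ (-ᴿ c) k))
                      (≈-trans (solve 3 (λ c r w → (:- r) :* ((:- c) :* w) := (c :* r) :* w) ≈-refl c r (w ⊕ k))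
                        (≈-trans (R.*-congʳ cr≈1) (R.*-identityˡ _))))
                  ; h-⊕ = λ _ → ≈-refl ; h-t = λ ⊕≢⊕ → contradiction refl ⊕≢⊕ }

          module Ch v = Choice (choice v)
          open Ch using (μ; h)

          -- This is `h (unit i)` minus `h ⊕`, the increment of `h` at the bottom of the cube.
          slope : Fin n → ℝ
          slope i = t (unit i) +ᴿ c

          -- The increment in direction `i` is carried from `v` to `flipAt j v` by the modular law
          -- of the square on `i` and `j`; at `v = ⊕` the common excess takes its place.
          h-step : ∀ v i → lookup v i ≡ Sign.+ → h (flipAt i v) ≈ᴿ h v +ᴿ slope i
          h-step = cube-induction (λ v → ∀ i → lookup v i ≡ Sign.+ → h (flipAt i v) ≈ᴿ h v +ᴿ slope i) base step
            where
            h-flip : ∀ {v i} → lookup v i ≡ Sign.+ → h (flipAt i v) ≈ᴿ t (flipAt i v)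
            h-flip {v} {i} vᵢ≡+ = Choice.h-t (choice (flipAt i v)) (flip≢⊕ {v} vᵢ≡+)
            base : ∀ i → lookup ⊕ i ≡ Sign.+ → h (unit i) ≈ᴿ h ⊕ +ᴿ slope i
            base i ⊕ᵢ = ≈-trans (h-flip {⊕} ⊕ᵢ) (≈-trans
              (solve 2 (λ t c → t := (:- c) :+ (t :+ c)) ≈-refl (t (unit i)) c)
              (R.+-congʳ (≈-sym (Choice.h-⊕ (choice ⊕) refl))))
            step : ∀ v j → lookup v j ≡ Sign.+ → (∀ i → lookup v i ≡ Sign.+ → h (flipAt i v) ≈ᴿ h v +ᴿ slope i) →
                   ∀ i → lookup (flipAt j v) i ≡ Sign.+ → h (flipAt i (flipAt j v)) ≈ᴿ h (flipAt j v) +ᴿ slope i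
            step v j vⱼ≡+ hyp i v′ᵢ≡+ = ≈-trans (h-flip {flipAt j v} v′ᵢ≡+)
                (≈-trans (t-step (v ≟ᶜ ⊕)) (R.+-congʳ (≈-sym (h-flip {v} vⱼ≡+))))
              where
              i≢j : i ≢ j
              i≢j = proj₁ (flip-plus {v} vⱼ≡+ v′ᵢ≡+)
              vᵢ≡+ : lookup v i ≡ Sign.+
              vᵢ≡+ = proj₂ (flip-plus {v} vⱼ≡+ v′ᵢ≡+)
              t-step : Dec (v ≡ ⊕) → t (flipAt i (flipAt j v)) ≈ᴿ t (flipAt j v) +ᴿ slope i
              t-step (yes refl) = ≈-trans
                (solve 3 (λ e a b → e := b :+ (a :+ (e :- (a :+ b)))) ≈-refl
                  (t (flipAt i (unit j))) (t (unit i)) (t (unit j)))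
                (R.+-congˡ (R.+-congˡ (excess≈c i≢j)))
              t-step (no v≢⊕) = -≈0⇒≈ (≈-trans
                (solve 5 (λ tij tj ti tv s → tij :- (tj :+ s) := ((tv :+ tij) :- (ti :+ tj)) :+ (ti :- (tv :+ s))) ≈-refl
                  (t (flipAt i (flipAt j v))) (t (flipAt j v)) (t (flipAt i v)) (t v) (slope i))
                (+≈0 (≈⇒-≈0 (modular v≢⊕ i≢j vᵢ≡+ vⱼ≡+)) (≈⇒-≈0
                  (≈-trans (≈-sym (h-flip {v} vᵢ≡+)) (≈-trans (hyp i vᵢ≡+) (R.+-congʳ (Choice.h-t (choice v) v≢⊕)))))))

          h-affine : ∀ v → h v ≈ᴿ -ᴿ c +ᴿ sum (λ i → m (lookup v i) *ᴿ slope i)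
          h-affine = cube-induction (λ v → h v ≈ᴿ -ᴿ c +ᴿ total v) base step
            where
            total : C n → ℝ
            total v = sum (λ i → m (lookup v i) *ᴿ slope i)
            base : h ⊕ ≈ᴿ -ᴿ c +ᴿ total ⊕
            base = ≈-trans (Choice.h-⊕ (choice ⊕) refl) (≈-sym (≈-trans
              (R.+-congˡ (sum-≈0 {f = λ i → m (lookup ⊕ i) *ᴿ slope i} λ i → ≈0-*ˡ (≈-reflexive (cong m (⊕-lookup i)))))
              (R.+-identityʳ _)))
            step : ∀ v i → lookup v i ≡ Sign.+ → h v ≈ᴿ -ᴿ c +ᴿ total v → h (flipAt i v) ≈ᴿ -ᴿ c +ᴿ total (flipAt i v)
            step v i vᵢ≡+ hyp = ≈-trans (h-step v i vᵢ≡+) (≈-trans (R.+-congʳ hyp) (≈-trans (R.+-assoc _ _ _)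
              (R.+-congˡ (≈-sym total-step))))
              where
              one : Fin n → ℝ
              one l = (m (lookup (flipAt i v) l) +ᴿ -ᴿ m (lookup v l)) *ᴿ slope l
              one-off : ∀ l → l ≢ i → one l ≈ᴿ 0ᴿ
              one-off l l≢i = ≈0-*ˡ (≈⇒-≈0 (≈-reflexive (cong m (lookup-flipAt-≢ l≢i v))))
              one-at : one i ≈ᴿ slope i
              one-at = ≈-trans (R.*-congʳ (R.+-cong (≈-reflexive (cong m (flip-minus {v} vᵢ≡+)))
                                                    (R.-‿cong (≈-reflexive (cong m vᵢ≡+)))))
                (solve 1 (λ s → (con 1ℚ :- con 0ℚ) :* s := s) ≈-refl (slope i))
              total-step : total (flipAt i v) ≈ᴿ total v +ᴿ slope i
              total-step = ≈-trans (R.sum-cong-≋ λ l → solve 3 (λ a b s → a :* s := b :* s :+ (a :- b) :* s) ≈-refl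
                    (m (lookup (flipAt i v) l)) (m (lookup v l)) (slope l))
                (≈-trans (R.∑-distrib-+ (λ l → m (lookup v l) *ᴿ slope l) one)
                  (R.+-congˡ (≈-trans (sum-single {f = one} i one-off) one-at)))

          ∑-scale : ∀ (g f : C n → ℝ) z → ∑ (λ v → g v *ᴿ (f v *ᴿ z)) ≈ᴿ z *ᴿ ∑ (λ v → g v *ᴿ f v)
          ∑-scale g f z = ≈-trans (∑-cong {f = λ v → g v *ᴿ (f v *ᴿ z)} λ v →
              solve 3 (λ g f z → g :* (f :* z) := z :* (g :* f)) ≈-refl (g v) (f v) z)
            (∑-*ˡ z (λ v → g v *ᴿ f v))

          module _ (c′ : C n → ℝ) where

            g : C n → ℝ
            g v = c′ v *ᴿ μ v

            mass : Fin n → ℝ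
            mass i = ∑ (λ v → g v *ᴿ m (lookup v i))

            coefficient : Fin (suc n) → ℝ
            coefficient j = ∑ (λ v → g v *ᴿ normal (h v) v j)

            ∑-comb : ∀ k → ∑ (λ v → c′ v *ᴿ w v k) ≈ᴿ comb coefficient k
            ∑-comb k = begin
              ∑ (λ v → c′ v *ᴿ w v k)
                ≈⟨ ∑-cong {f = λ v → c′ v *ᴿ w v k} (λ v → ≈-trans (R.*-congˡ (Choice.expansion (choice v) k)) (≈-sym (R.*-assoc _ _ _))) ⟩
              ∑ (λ v → g v *ᴿ comb (normal (h v) v) k)
                ≈⟨ ∑-cong {f = λ v → g v *ᴿ comb (normal (h v) v) k} (λ v → R.*-distribˡ-sum (g v) (λ j → normal (h v) v j *ᴿ w (basis j) k)) ⟩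
              ∑ (λ v → sum (λ j → g v *ᴿ (normal (h v) v j *ᴿ w (basis j) k)))
                ≈⟨ ∑-sum (λ v j → g v *ᴿ (normal (h v) v j *ᴿ w (basis j) k)) ⟩
              sum (λ j → ∑ (λ v → g v *ᴿ (normal (h v) v j *ᴿ w (basis j) k)))
                ≈⟨ R.sum-cong-≋ (λ j → ≈-trans (∑-scale g (λ v → normal (h v) v j) (w (basis j) k)) (R.*-comm _ _)) ⟩
              comb coefficient k ∎
              where open SetoidReasoning ℝ-setoid

            coefficient-suc : ∀ i → coefficient (suc i) ≈ᴿ y i *ᴿ mass i
            coefficient-suc i = ∑-scale g (λ v → m (lookup v i)) (y i)

            coefficient-zero : coefficient zero ≈ᴿ -ᴿ c *ᴿ ∑ g +ᴿ sum (λ i → slope i *ᴿ mass i)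
            coefficient-zero = begin
              ∑ (λ v → g v *ᴿ h v)
                ≈⟨ ∑-cong {f = λ v → g v *ᴿ h v} (λ v → ≈-trans (R.*-congˡ (h-affine v)) (≈-trans (R.distribˡ (g v) (-ᴿ c) _)
                     (R.+-cong (R.*-comm (g v) (-ᴿ c)) (R.*-distribˡ-sum (g v) (λ i → m (lookup v i) *ᴿ slope i))))) ⟩
              ∑ (λ v → -ᴿ c *ᴿ g v +ᴿ sum (λ i → g v *ᴿ (m (lookup v i) *ᴿ slope i)))
                ≈⟨ ∑-+ (λ v → -ᴿ c *ᴿ g v) (λ v → sum (λ i → g v *ᴿ (m (lookup v i) *ᴿ slope i))) ⟩
              ∑ (λ v → -ᴿ c *ᴿ g v) +ᴿ ∑ (λ v → sum (λ i → g v *ᴿ (m (lookup v i) *ᴿ slope i)))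
                ≈⟨ R.+-cong (∑-*ˡ (-ᴿ c) g) (≈-trans (∑-sum (λ v i → g v *ᴿ (m (lookup v i) *ᴿ slope i)))
                     (R.sum-cong-≋ λ i → ∑-scale g (λ v → m (lookup v i)) (slope i))) ⟩
              -ᴿ c *ᴿ ∑ g +ᴿ sum (λ i → slope i *ᴿ mass i) ∎
              where open SetoidReasoning ℝ-setoid

            coordinate-sum : ∀ i → ∑ (λ v → g v *ᴿ ⟦ lookup v i ⟧) ≈ᴿ ∑ g +ᴿ -ᴿ 2ᴿ *ᴿ mass i
            coordinate-sum i = ≈-trans (∑-cong {f = λ v → g v *ᴿ ⟦ lookup v i ⟧} λ v →
                ≈-trans (R.*-congˡ (sign (lookup v i))) (solve 3 (λ g t m → g :* (con 1ℚ :+ (:- t) :* m) := g :+ (:- t) :* (g :* m)) ≈-refl (g v) 2ᴿ (m (lookup v i))))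
              (≈-trans (∑-+ g (λ v → -ᴿ 2ᴿ *ᴿ (g v *ᴿ m (lookup v i))))
                (R.+-congˡ (∑-*ˡ (-ᴿ 2ᴿ) (λ v → g v *ᴿ m (lookup v i)))))
              where
              sign : ∀ s → ⟦ s ⟧ ≈ᴿ 1ᴿ +ᴿ -ᴿ 2ᴿ *ᴿ m s
              sign Sign.+ = solve 0 (con 1ℚ := con 1ℚ :+ (:- (con 1ℚ :+ con 1ℚ)) :* con 0ℚ) ≈-refl
              sign Sign.- = solve 0 (:- con 1ℚ := con 1ℚ :+ (:- (con 1ℚ :+ con 1ℚ)) :* con 1ℚ) ≈-refl

            -- In the basis, the sum of the `c′ v *ᴿ w v k` has unit coefficients `y i *ᴿ mass i`,
            -- and its `⊕` coefficient is `−c` times the total of `g` plus a combination of the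
            -- masses. This system is triangular with nonzero diagonal entries `y i` and `−c`, so it
            -- vanishes exactly when the total and all masses do; as a sign is 1 - 2·m, that is
            -- affine dependency.
            relation⇔dependency : Relation c′ ⇔ AffineDependency g
            relation⇔dependency = mk⇔ forward backward
              where
              forward : Relation c′ → AffineDependency g
              forward rel = ∑g≈0 , λ i → ≈-trans (coordinate-sum i) (+≈0 ∑g≈0 (≈0-*ʳ (mass≈0 i)))
                where
                coefficients≈0 : ∀ j → coefficient j ≈ᴿ 0ᴿ
                coefficients≈0 = basis-independent coefficient λ k → ≈-trans (≈-sym (∑-comb k)) (rel k)
                mass≈0 : ∀ i → mass i ≈ᴿ 0ᴿ
                mass≈0 i = *-cancelˡ-≈0 (y≉0 i) (≈-trans (≈-sym (coefficient-suc i)) (coefficients≈0 (suc i)))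
                ∑g≈0 : ∑ g ≈ᴿ 0ᴿ
                ∑g≈0 = *-cancelˡ-≈0 (-≉0 c≉0) (≈-trans (≈-sym (≈-trans
                  (R.+-congˡ (sum-≈0 λ i → ≈0-*ʳ (mass≈0 i))) (R.+-identityʳ _)))
                  (≈-trans (≈-sym coefficient-zero) (coefficients≈0 zero)))
              backward : AffineDependency g → Relation c′
              backward (∑g≈0 , ∑gv≈0) k = ≈-trans (∑-comb k) (sum-≈0 {f = λ j → coefficient j *ᴿ w (basis j) k} λ j → ≈0-*ˡ (coefficients≈0 j))
                where
                mass≈0 : ∀ i → mass i ≈ᴿ 0ᴿ
                mass≈0 i = *-cancelˡ-≈0 (-≉0 2≉0) (≈-trans (≈-sym (≈-trans (R.+-congʳ ∑g≈0) (R.+-identityˡ _)))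
                  (≈-trans (≈-sym (coordinate-sum i)) (∑gv≈0 i)))
                coefficients≈0 : ∀ j → coefficient j ≈ᴿ 0ᴿ
                coefficients≈0 zero    = ≈-trans coefficient-zero (+≈0 (≈0-*ʳ ∑g≈0) (sum-≈0 λ i → ≈0-*ʳ (mass≈0 i)))
                coefficients≈0 (suc i) = ≈-trans (coefficient-suc i) (≈0-*ʳ (mass≈0 i))

    projectively-affine : ¬ ¬ ∃ λ (μ : C n → ℝ) → (∀ v → μ v ≉ᴿ 0ᴿ) ×
                          (∀ c → Relation c ⇔ AffineDependency (λ v → c v *ᴿ μ v))
    projectively-affine = do
      coords ← ¬¬-choice (enumC n) coordinates
      norm ← ¬¬-choice (enumC n) (Scaled.normalize coords)
      let open Scaled.Modular coords norm using (common-excess; module Renormalized)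
          c , c≉0 , excess≈c = common-excess
      r , cr≈1 ← inverse c≉0
      let open Renormalized c r c≉0 cr≈1 excess≈c
      pure (Ch.μ , Ch.μ≉0 , relation⇔dependency)

-- Comparison of linear and affine independence

linearly⇔affinely : ∀ {n d} (w : C n → Fin d → ℝ)
  (μ : C n → ℝ) → (∀ v → μ v ≉ᴿ 0ᴿ) →
  (∀ c → Realization.Relation w c ⇔ AffineDependency (λ v → c v *ᴿ μ v)) →
  ¬ ¬ (∀ S → LinearlyIndependent (enumC n) w S ⇔ AffinelyIndependent S)
linearly⇔affinely {n} w μ μ≉0 rescale = do
    -- Dividing a dependency by `μ` needs reciprocals. They are chosen before `S`, so that one
    -- double negation covers all subsets at once.
    inverses ← ¬¬-choice (enumC n) (λ v → inverse (μ≉0 v))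
    pure λ S → mk⇔ (affinely S inverses) (linearly S)
  where
  open Realization w
  linearly : ∀ S → AffinelyIndependent S → LinearlyIndependent (enumC n) w S
  linearly S ind c off rel v = *-cancelˡ-≈0 (μ≉0 v) (≈-trans (R.*-comm (μ v) (c v))
    (ind (λ v → c v *ᴿ μ v) (λ v v∉S → ≈0-*ˡ (off v v∉S)) (Equivalence.to (rescale c) rel) v))
  affinely : ∀ S → (∀ v → ∃ λ r → μ v *ᴿ r ≈ᴿ 1ᴿ) → LinearlyIndependent (enumC n) w S → AffinelyIndependent S
  affinely S inverses ind c off (∑c , ∑cv) v = ≈-trans (≈-sym (c′μ≈c v)) (≈0-*ˡ
      (ind c′ (λ v v∉S → ≈0-*ˡ (off v v∉S))
        (Equivalence.from (rescale c′)
          ( ≈-trans (∑-cong {f = λ v → c′ v *ᴿ μ v} c′μ≈c) ∑c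
          , λ k → ≈-trans (∑-cong {f = λ v → (c′ v *ᴿ μ v) *ᴿ ⟦ lookup v k ⟧} λ v → R.*-congʳ (c′μ≈c v)) (∑cv k)))
        v))
    where
    c′ : C n → ℝ
    c′ v = c v *ᴿ proj₁ (inverses v)
    c′μ≈c : ∀ v → c′ v *ᴿ μ v ≈ᴿ c v
    c′μ≈c v = ≈-trans (R.*-assoc _ _ _) (≈-trans (R.*-congˡ (≈-trans (R.*-comm _ _) (proj₂ (inverses v)))) (R.*-identityʳ _))

theorem3p3 : (n : ℕ) .{{_ : NonZero n}} (𝓜 : Pred (SignedSet (C n)) 0ℓ) →
    IsOrientedCube n 𝓜 →
    RealizableOverℝ (enumC n) (underlying 𝓜) →
    underlying 𝓜 ≃ underlying (𝐐 n)
theorem3p3 (suc n) 𝓜 cube (d , w , real) = ↔-id (C (suc n)) , λ S → mk⇔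
    (λ ind dep → comparison λ same → Equivalence.from (independent-𝐐⇔ S)
      (Equivalence.to (same S) (Equivalence.to (real S) ind)) dep)
    (λ ind dep → comparison λ same → Equivalence.from (real S)
      (Equivalence.from (same S) (Equivalence.to (independent-𝐐⇔ S) ind)) dep)
  where
  open Realization w
  -- Positive dimension provides the coordinate `zero`, whose minus facet misses `⊕`.
  open ProjectiveCoordinates w zero
  facet-flat : ∀ i s → Flat (Facet i s)
  facet-flat i s {e} e∉ c rel off = let (Y , orth , supp⇔) = facet-cocircuit cube i s in
    coefficient≈0 real {Y} orth (Equivalence.from (supp⇔ e) e∉) c rel λ f f∈Y → off f (Equivalence.to (supp⇔ f) f∈Y)
  skewFacet-flat : ∀ i l → i ≢ l → Flat (SkewFacet i l Sign.+)
  skewFacet-flat i l i≢l {e} e∉ c rel off = let (Y , orth , supp⇔) = skewFacet-cocircuit cube i l Sign.+ i≢l in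
    coefficient≈0 real {Y} orth (Equivalence.from (supp⇔ e) e∉) c rel λ f f∈Y → off f (Equivalence.to (supp⇔ f) f∈Y)
  comparison : ¬ ¬ (∀ S → LinearlyIndependent (enumC (suc n)) w S ⇔ AffinelyIndependent S)
  comparison = do
    μ , μ≉0 , rescale ← projectively-affine facet-flat skewFacet-flat (rectangle-relation real cube)
    linearly⇔affinely w μ μ≉0 rescale
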